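{- Let $\mathbf{P}\subseteq\mathbb{N}$. The following conditions are equivalent: (1) Problem 1 for $\mathbf{P}$ is computable. (2) Problem 2 for $\mathbf{P}$ is computable. (3) Problem 3 for $\mathbf{P}$ is computable. (4) The monadic theory of $\langle\mathbb{N},<,\mathbf{P}\rangle$ (the set of MLO sentences true in it) is decidable. (5) For every MLO formula $\psi(X,Y,P)$, either there is a recursive C-operator $F$ such that $\langle\mathbb{N},<\rangle\models\forall X\,\psi(X,F(X),\mathbf{P})$, or there is a recursive SC-operator $G$ such that $\langle\mathbb{N},<\rangle\models\forall Y\,\neg\psi(G(Y),Y,\mathbf{P})$; moreover, it is decidable (given $\psi$) which of these cases holds, and a description (program) of the corresponding operator is computable from $\psi$.
   Context: MLO (monadic logic of order) is monadic second-order logic over the binary relation symbol $<$ and unary predicate symbols, interpreted in structures $\langle\mathbb{N},<,\mathbf{P}_1,\dots\rangle$ with the usual order; first-order variables range over $\mathbb{N}$ and set variables over subsets of $\mathbb{N}$. A subset of $\mathbb{N}$ is identified with its characteristic $\omega$-string over $\{0,1\}$. An operator is a map $F:\Sigma_1^\omega\to\Sigma_2^\omega$ ($\Sigma_i$ finite alphabets); an operator of two arguments such as $F(X,P)$ is regarded as an operator on $\omega$-strings over the product alphabet. $F$ is causal (a C-operator) if for all $t\in\mathbb{N}$, whenever $X,X'$ coincide on positions $[0,t]$, $F(X),F(X')$ coincide on $[0,t]$; it is strongly causal (an SC-operator) if whenever $X,X'$ coincide on $[0,t)$, $F(X),F(X')$ coincide on $[0,t]$. A causal operator $F$ is recursive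 if the function sending each finite string $a_0\dots a_n$ to the $n$-th letter of $F(a_0\dots a_n w)$ (which does not depend on the $\omega$-string $w$) is computable. Problems (input: an MLO formula $\psi(X,Y,P)$; "Problem $k$ for $\mathbf{P}$ is computable" means there is an algorithm solving it for all inputs): Problem 1: decide whether there is a C-operator $Y=F(X,P)$ with $\langle\mathbb{N},<\rangle\models\forall X\,\psi(X,F(X,\mathbf{P}),\mathbf{P})$, and if there is such a recursive operator, construct (a program for) it. Problem 2: decide whether there is a recursive C-operator $Y=F(X,P)$ with $\langle\mathbb{N},<\rangle\models\forall X\,\psi(X,F(X,\mathbf{P}),\mathbf{P})$, and if so construct it. Problem 3: decide whether there is a recursive C-operator $Y=F(X)$ with $\langle\mathbb{N},<\rangle\models\forall X\,\psi(X,F(X),\mathbf{P})$, and if so construct it. -}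

module Defs where

open import Data.Nat using (ℕ; zero; suc; _<_; _≤_)
open import Data.Bool using (Bool; true; false; _∧_)
open import Data.Product using (Σ; ∃; _×_; _,_)
open import Data.Sum using (_⊎_)
open import Data.Unit using (⊤)
open import Data.List using (List; []; _∷_; map; upTo)
open import Relation.Nullary using (¬_)
open import Relation.Binary.PropositionalEquality using (_≡_)
open import Function.Bundles using (_⇔_)

-- Model of computation: Jones' WHILE language over binary trees.
-- Programs are data (trees), so "an algorithm outputs a program" makes
-- sense.  "Computable"/"recursive" = computed by some WHILE program.

data Tree : Set where
  nil  : Tree
  cons : Tree → Tree → Tree

_==ᵀ_ : Tree → Tree → Bool
nil        ==ᵀ nil        = true
nil        ==ᵀ cons _ _   = false
cons _ _   ==ᵀ nil        = false
cons a b   ==ᵀ cons c d   = (a ==ᵀ c) ∧ (b ==ᵀ d)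

isNil : Tree → Bool
isNil nil        = true
isNil (cons _ _) = false

data Expr : Set where
  var   : ℕ → Expr
  enil  : Expr
  econs : Expr → Expr → Expr
  hd    : Expr → Expr
  tl    : Expr → Expr
  eq?   : Expr → Expr → Expr

data Cmd : Set where
  assign : ℕ → Expr → Cmd
  seq    : Cmd → Cmd → Cmd
  while  : Expr → Cmd → Cmd

-- A program: input placed in variable 0 (all other variables nil),
-- the output is the content of variable 0 on termination.
Prog : Set
Prog = Cmd

Store : Set
Store = ℕ → Tree

encBool : Bool → Tree
encBool false = nil
encBool true  = cons nil nil

eval : Store → Expr → Tree
eval s (var x)     = s x
eval s enil        = nil
eval s (econs e f) = cons (eval s e) (eval s f)
eval s (hd e) with eval s e
... | nil      = nil
... | cons a _ = a
eval s (tl e) with eval s e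
... | nil      = nil
... | cons _ b = b
eval s (eq? e f)   = encBool (eval s e ==ᵀ eval s f)

update : Store → ℕ → Tree → Store
update s zero    v zero    = v
update s zero    v (suc y) = s (suc y)
update s (suc x) v zero    = s zero
update s (suc x) v (suc y) = update (λ n → s (suc n)) x v y

data Exec : Cmd → Store → Store → Set where
  exec-assign : ∀ {x e s} → Exec (assign x e) s (update s x (eval s e))
  exec-seq    : ∀ {c d s s₁ s₂} → Exec c s s₁ → Exec d s₁ s₂ → Exec (seq c d) s s₂
  exec-whileF : ∀ {e c s} → isNil (eval s e) ≡ true → Exec (while e c) s s
  exec-whileT : ∀ {e c s s₁ s₂} → isNil (eval s e) ≡ false →
                Exec c s s₁ → Exec (while e c) s₁ s₂ → Exec (while e c) s s₂

initStore : Tree → Store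
initStore i zero    = i
initStore i (suc _) = nil

Run : Prog → Tree → Tree → Set
Run p i o = Σ Store λ s → Exec p (initStore i) s × s 0 ≡ o

encℕ : ℕ → Tree
encℕ zero    = nil
encℕ (suc n) = cons nil (encℕ n)

encList : {A : Set} → (A → Tree) → List A → Tree
encList e []       = nil
encList e (x ∷ xs) = cons (e x) (encList e xs)

encPair : Bool × Bool → Tree
encPair (a , b) = cons (encBool a) (encBool b)

encExpr : Expr → Tree
encExpr (var x)     = cons (encℕ 0) (encℕ x)
encExpr enil        = cons (encℕ 1) nil
encExpr (econs e f) = cons (encℕ 2) (cons (encExpr e) (encExpr f))
encExpr (hd e)      = cons (encℕ 3) (encExpr e)
encExpr (tl e)      = cons (encℕ 4) (encExpr e)
encExpr (eq? e f)   = cons (encℕ 5) (cons (encExpr e) (encExpr f))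

⌜_⌝ : Prog → Tree
⌜ assign x e ⌝ = cons (encℕ 0) (cons (encℕ x) (encExpr e))
⌜ seq c d ⌝    = cons (encℕ 1) (cons ⌜ c ⌝ ⌜ d ⌝)
⌜ while e c ⌝  = cons (encℕ 2) (cons (encExpr e) ⌜ c ⌝)

-- MLO: monadic second-order logic of order, de Bruijn indices;
-- first-order and set variables have separate index spaces.
-- (Unary predicate symbols are treated as free set variables.)

data Fm : Set where
  _<′_ : ℕ → ℕ → Fm
  _∈′_ : ℕ → ℕ → Fm
  ¬′_  : Fm → Fm
  _∧′_ : Fm → Fm → Fm
  ∃₁   : Fm → Fm
  ∃₂   : Fm → Fm

extend : {A : Set} → A → (ℕ → A) → ℕ → A
extend a ρ zero    = a
extend a ρ (suc n) = ρ n

Sat : (ℕ → ℕ) → (ℕ → ℕ → Bool) → Fm → Set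
Sat ρ σ (x <′ y) = ρ x < ρ y
Sat ρ σ (x ∈′ X) = σ X (ρ x) ≡ true
Sat ρ σ (¬′ φ)   = ¬ Sat ρ σ φ
Sat ρ σ (φ ∧′ ψ) = Sat ρ σ φ × Sat ρ σ ψ
Sat ρ σ (∃₁ φ)   = Σ ℕ λ n → Sat (extend n ρ) σ φ
Sat ρ σ (∃₂ φ)   = Σ (ℕ → Bool) λ S → Sat ρ (extend S σ) φ

FOBelow : ℕ → Fm → Set
FOBelow k (x <′ y) = x < k × y < k
FOBelow k (x ∈′ X) = x < k
FOBelow k (¬′ φ)   = FOBelow k φ
FOBelow k (φ ∧′ ψ) = FOBelow k φ × FOBelow k ψ
FOBelow k (∃₁ φ)   = FOBelow (suc k) φ
FOBelow k (∃₂ φ)   = FOBelow k φ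

SOBelow : ℕ → Fm → Set
SOBelow k (x <′ y) = ⊤
SOBelow k (x ∈′ X) = X < k
SOBelow k (¬′ φ)   = SOBelow k φ
SOBelow k (φ ∧′ ψ) = SOBelow k φ × SOBelow k ψ
SOBelow k (∃₁ φ)   = SOBelow k φ
SOBelow k (∃₂ φ)   = SOBelow (suc k) φ

encFm : Fm → Tree
encFm (x <′ y) = cons (encℕ 0) (cons (encℕ x) (encℕ y))
encFm (x ∈′ X) = cons (encℕ 1) (cons (encℕ x) (encℕ X))
encFm (¬′ φ)   = cons (encℕ 2) (encFm φ)
encFm (φ ∧′ ψ) = cons (encℕ 3) (cons (encFm φ) (encFm ψ))
encFm (∃₁ φ)   = cons (encℕ 4) (encFm φ)
encFm (∃₂ φ)   = cons (encℕ 5) (encFm φ)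

ρ₀ : ℕ → ℕ
ρ₀ _ = 0

σ₀ : ℕ → ℕ → Bool
σ₀ _ _ = false

-- ψ(X,Y,P): set variables 0,1,2 are X,Y,P; no other free variables
Fm3 : Fm → Set
Fm3 ψ = FOBelow 0 ψ × SOBelow 3 ψ

Holds3 : Fm → (ℕ → Bool) → (ℕ → Bool) → (ℕ → Bool) → Set
Holds3 ψ X Y P = Sat ρ₀ (extend X (extend Y (extend P σ₀))) ψ

-- sentences of the signature {<, P}: only free variable is set var 0 = P
Sentence : Fm → Set
Sentence φ = FOBelow 0 φ × SOBelow 1 φ

TrueIn : (ℕ → Bool) → Fm → Set
TrueIn P φ = Sat ρ₀ (extend P σ₀) φ

Causal : {A : Set} → ((ℕ → A) → (ℕ → Bool)) → Set
Causal {A} F = ∀ (t : ℕ) (ω ω′ : ℕ → A) → (∀ i → i ≤ t → ω i ≡ ω′ i) →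
               ∀ i → i ≤ t → F ω i ≡ F ω′ i

StronglyCausal : {A : Set} → ((ℕ → A) → (ℕ → Bool)) → Set
StronglyCausal {A} F = ∀ (t : ℕ) (ω ω′ : ℕ → A) → (∀ i → i < t → ω i ≡ ω′ i) →
                       ∀ i → i ≤ t → F ω i ≡ F ω′ i

prefix : {A : Set} → (ℕ → A) → ℕ → List A
prefix ω n = map ω (upTo (suc n))

Computes : {A : Set} → (A → Tree) → Prog → ((ℕ → A) → (ℕ → Bool)) → Set
Computes {A} enc q F = ∀ (ω : ℕ → A) (n : ℕ) → Run q (encList enc (prefix ω n)) (encBool (F ω n))

RecC : {A : Set} → (A → Tree) → Prog → ((ℕ → A) → (ℕ → Bool)) → Set
RecC enc q F = Causal F × Computes enc q F

RecSC : Prog → ((ℕ → Bool) → (ℕ → Bool)) → Set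
RecSC q G = StronglyCausal G × Computes encBool q G

zipω : (ℕ → Bool) → (ℕ → Bool) → ℕ → Bool × Bool
zipω X P i = (X i , P i)

WinXP : (ℕ → Bool) → Fm → ((ℕ → Bool × Bool) → (ℕ → Bool)) → Set
WinXP P ψ F = ∀ X → Holds3 ψ X (F (zipω X P)) P

WinX : (ℕ → Bool) → Fm → ((ℕ → Bool) → (ℕ → Bool)) → Set
WinX P ψ F = ∀ X → Holds3 ψ X (F X) P

WinY : (ℕ → Bool) → Fm → ((ℕ → Bool) → (ℕ → Bool)) → Set
WinY P ψ G = ∀ Y → ¬ Holds3 ψ (G Y) Y P

-- The problems.  An algorithm is a program a; on input ⌜ψ⌝ it outputs
-- cons (answer bit) (tree), the tree being a program when required.

Problem1Computable : (ℕ → Bool) → Set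
Problem1Computable P = Σ Prog λ a → ∀ ψ → Fm3 ψ → Σ Bool λ b → Σ Tree λ t →
  Run a (encFm ψ) (cons (encBool b) t) ×
  (b ≡ true ⇔ (Σ ((ℕ → Bool × Bool) → (ℕ → Bool)) λ F → Causal F × WinXP P ψ F)) ×
  ((Σ Prog λ q → Σ ((ℕ → Bool × Bool) → (ℕ → Bool)) λ F → RecC encPair q F × WinXP P ψ F) →
     Σ Prog λ q → t ≡ ⌜ q ⌝ × Σ ((ℕ → Bool × Bool) → (ℕ → Bool)) λ F → RecC encPair q F × WinXP P ψ F)

Problem2Computable : (ℕ → Bool) → Set
Problem2Computable P = Σ Prog λ a → ∀ ψ → Fm3 ψ → Σ Bool λ b → Σ Tree λ t →
  Run a (encFm ψ) (cons (encBool b) t) ×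
  (b ≡ true ⇔ (Σ Prog λ q → Σ ((ℕ → Bool × Bool) → (ℕ → Bool)) λ F → RecC encPair q F × WinXP P ψ F)) ×
  (b ≡ true →
     Σ Prog λ q → t ≡ ⌜ q ⌝ × Σ ((ℕ → Bool × Bool) → (ℕ → Bool)) λ F → RecC encPair q F × WinXP P ψ F)

Problem3Computable : (ℕ → Bool) → Set
Problem3Computable P = Σ Prog λ a → ∀ ψ → Fm3 ψ → Σ Bool λ b → Σ Tree λ t →
  Run a (encFm ψ) (cons (encBool b) t) ×
  (b ≡ true ⇔ (Σ Prog λ q → Σ ((ℕ → Bool) → (ℕ → Bool)) λ F → RecC encBool q F × WinX P ψ F)) ×
  (b ≡ true →
     Σ Prog λ q → t ≡ ⌜ q ⌝ × Σ ((ℕ → Bool) → (ℕ → Bool)) λ F → RecC encBool q F × WinX P ψ F)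

MonadicTheoryDecidable : (ℕ → Bool) → Set
MonadicTheoryDecidable P = Σ Prog λ a → ∀ φ → Sentence φ → Σ Bool λ b →
  Run a (encFm φ) (encBool b) × (b ≡ true ⇔ TrueIn P φ)

EffectiveDeterminacy : (ℕ → Bool) → Set
EffectiveDeterminacy P =
  (∀ ψ → Fm3 ψ →
     (Σ Prog λ q → Σ ((ℕ → Bool) → (ℕ → Bool)) λ F → RecC encBool q F × WinX P ψ F) ⊎
     (Σ Prog λ q → Σ ((ℕ → Bool) → (ℕ → Bool)) λ G → RecSC q G × WinY P ψ G)) ×
  (Σ Prog λ a → ∀ ψ → Fm3 ψ → Σ Bool λ b → Σ Prog λ q →
     Run a (encFm ψ) (cons (encBool b) ⌜ q ⌝) ×
     (b ≡ true → Σ ((ℕ → Bool) → (ℕ → Bool)) λ F → RecC encBool q F × WinX P ψ F) ×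
     (b ≡ false → Σ ((ℕ → Bool) → (ℕ → Bool)) λ G → RecSC q G × WinY P ψ G))

-- classical logic (the paper's metatheory)
ExcludedMiddle : Set₁
ExcludedMiddle = (A : Set) → A ⊎ ¬ A

{-# OPTIONS --safe #-}
-- Each of (1), (2), (3), (5) decides a sentence φ(P), read as a game whose winner depends on
-- φ alone, and (5) gives (1)–(3) because a causal and a strongly causal operator can be played
-- against each other. The content is (4) ⇒ (5).
--
-- For every P and ψ one of the players has a winning operator that is definable in ⟨ℕ,<,P⟩.
-- By induction on formulas, ψ is recognised by a finite automaton run on the segments of a
-- factorisation of the word. Started afresh at every position, with runs that reach the same
-- state identified, this automaton turns into a deterministic parity automaton. The game on
-- (state, time) is then a parity game, won by a positional strategy, that is, by a tuple of
-- subsets of ℕ. That this tuple wins is expressible, and a satisfiable MLO condition has a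
-- definable solution: choose, as early as possible, cuts at which an accepting run returns to
-- a fixed state, and then the leftmost solution compatible with these cuts.
--
-- Hence a decision procedure for the theory of ⟨ℕ,<,P⟩ suffices to find a winner: enumerate
-- formulas c, ask whether the operator defined by c (made causal by truncating its input) wins
-- for one of the players, and output a program that evaluates c by further such queries.
module Submission where

open import Defs
open import Data.Bool using (Bool; _∧_; _∨_; false; if_then_else_; not; true)
open import Data.Bool.Properties using (T-≡; not-¬; ¬-not)
open import Data.Nat using (_*_; _+_; _<_; _∸_; _≡ᵇ_; _≤_; _⊓_; _⊔_; suc; s≤s; zero; z≤n; ℕ)
open import Data.Nat.Properties hiding (eq?)
open import Data.Product using (_,_; _×_; proj₁; proj₂; Σ)
open import Data.Sum using (_⊎_; inj₁; inj₂)
open import Data.Empty using (⊥; ⊥-elim)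
open import Data.Unit using (tt; ⊤)
open import Relation.Nullary using (Dec; no; yes; ¬_)
open import Relation.Binary using (tri<; tri>; tri≈)
open import Relation.Binary.PropositionalEquality using (_≡_; _≢_; cong; cong₂; refl; subst; sym; trans; ≢-sym)
open import Function.Bundles using (Equivalence; _⇔_; mk⇔)
open import Function using (_∘_)

-- A recogniser promises only that equal segment states force equal membership. This condition is
-- symmetric in the two words, so negation leaves the automaton unchanged; and the infinite
-- factorisation for which Ramsey's theorem is usually invoked is read off the merges of threads.
-- The predicate `P` enters the game through the time component of a vertex: the arena is infinite,
-- but there are finitely many priorities. The obstacle to definable choice is that the solutions of
-- a condition need not form a closed set, so the leftmost branch through the tree of their prefixes
-- may fail to be a solution. Once cuts are fixed at which the run returns to a state whose priority
-- is the even limit inferior, what remains is a closed condition, and the leftmost branch satisfies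
-- it. Everything up to the definable strategy is classical: state sets, acceptance and even the
-- formulas are decided by excluded middle, so no program can be read off. The search restores
-- effectivity because it uses only the existence of a good formula and checks each candidate by at
-- most one sentence per player.

-- Structured programming in WHILE

module While where
  open import Data.List using ([]; _∷_; foldl)
  open import Data.List.Relation.Unary.All using (All; []; _∷_)
  import Data.List.Relation.Unary.All as All

  hdT tlT : Tree → Tree
  hdT nil        = nil
  hdT (cons a _) = a
  tlT nil        = nil
  tlT (cons _ b) = b

  data E₀ : Set where
    ●       : E₀
    con     : Tree → E₀
    _∙_     : E₀ → E₀ → E₀
    hd₀ tl₀ : E₀ → E₀
    _≟₀_    : E₀ → E₀ → E₀

  infixr 5 _∙_

  ⟦_⟧ : E₀ → Tree → Tree
  ⟦ ● ⟧ i      = i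
  ⟦ con t ⟧ i  = t
  ⟦ a ∙ b ⟧ i  = cons (⟦ a ⟧ i) (⟦ b ⟧ i)
  ⟦ hd₀ a ⟧ i  = hdT (⟦ a ⟧ i)
  ⟦ tl₀ a ⟧ i  = tlT (⟦ a ⟧ i)
  ⟦ a ≟₀ b ⟧ i = encBool (⟦ a ⟧ i ==ᵀ ⟦ b ⟧ i)

  quoteE : Tree → Expr
  quoteE nil        = enil
  quoteE (cons a b) = econs (quoteE a) (quoteE b)

  eval-quote : ∀ s t → eval s (quoteE t) ≡ t
  eval-quote s nil        = refl
  eval-quote s (cons a b) = cong₂ cons (eval-quote s a) (eval-quote s b)

  compile : E₀ → Expr
  compile ●        = var 0
  compile (con t)  = quoteE t
  compile (a ∙ b)  = econs (compile a) (compile b)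
  compile (hd₀ a)  = hd (compile a)
  compile (tl₀ a)  = tl (compile a)
  compile (a ≟₀ b) = eq? (compile a) (compile b)

  eval-hd : ∀ s e → eval s (hd e) ≡ hdT (eval s e)
  eval-hd s e with eval s e
  ... | nil      = refl
  ... | cons _ _ = refl

  eval-tl : ∀ s e → eval s (tl e) ≡ tlT (eval s e)
  eval-tl s e with eval s e
  ... | nil      = refl
  ... | cons _ _ = refl

  eval-compile : ∀ s e → eval s (compile e) ≡ ⟦ e ⟧ (s 0)
  eval-compile s ●        = refl
  eval-compile s (con t)  = eval-quote s t
  eval-compile s (a ∙ b)  = cong₂ cons (eval-compile s a) (eval-compile s b)
  eval-compile s (hd₀ a)  = trans (eval-hd s (compile a)) (cong hdT (eval-compile s a))
  eval-compile s (tl₀ a)  = trans (eval-tl s (compile a)) (cong tlT (eval-compile s a))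
  eval-compile s (a ≟₀ b) = cong₂ (λ u v → encBool (u ==ᵀ v)) (eval-compile s a) (eval-compile s b)

  update-same : ∀ s x v → update s x v x ≡ v
  update-same s zero    v = refl
  update-same s (suc x) v = update-same (λ n → s (suc n)) x v

  update-other : ∀ s x v y → y ≢ x → update s x v y ≡ s y
  update-other s zero    v zero    y≢x = ⊥-elim (y≢x refl)
  update-other s zero    v (suc y) y≢x = refl
  update-other s (suc x) v zero    y≢x = refl
  update-other s (suc x) v (suc y) y≢x = update-other (λ n → s (suc n)) x v y λ e → y≢x (cong suc e)

  update-cong : ∀ s t x {v v′} y → v ≡ v′ → s y ≡ t y → update s x v y ≡ update t x v′ y
  update-cong s t zero    zero    e f = e
  update-cong s t zero    (suc y) e f = f
  update-cong s t (suc x) zero    e f = f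
  update-cong s t (suc x) (suc y) e f = update-cong (λ n → s (suc n)) (λ n → t (suc n)) x y e f

  boundE : Expr → ℕ
  boundE (var x)     = suc x
  boundE enil        = 0
  boundE (econs a b) = boundE a ⊔ boundE b
  boundE (hd a)      = boundE a
  boundE (tl a)      = boundE a
  boundE (eq? a b)   = boundE a ⊔ boundE b

  boundC : Cmd → ℕ
  boundC (assign x e) = suc x ⊔ boundE e
  boundC (seq c d)    = boundC c ⊔ boundC d
  boundC (while e c)  = boundE e ⊔ boundC c

  AgreeBelow : ℕ → Store → Store → Set
  AgreeBelow b s t = ∀ y → y < b → s y ≡ t y

  ⊔-≤ˡ : ∀ m n {b} → m ⊔ n ≤ b → m ≤ b
  ⊔-≤ˡ m n = ≤-trans (m≤m⊔n m n)

  ⊔-≤ʳ : ∀ m n {b} → m ⊔ n ≤ b → n ≤ b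
  ⊔-≤ʳ m n = ≤-trans (m≤n⊔m m n)

  eval-agree : ∀ e {b s t} → boundE e ≤ b → AgreeBelow b s t → eval s e ≡ eval t e
  eval-agree (var x) h a = a x h
  eval-agree enil h a = refl
  eval-agree (econs e f) h a =
    cong₂ cons (eval-agree e (⊔-≤ˡ (boundE e) _ h) a) (eval-agree f (⊔-≤ʳ (boundE e) _ h) a)
  eval-agree (hd e) {b} {s} {t} h a =
    trans (eval-hd s e) (trans (cong hdT (eval-agree e h a)) (sym (eval-hd t e)))
  eval-agree (tl e) {b} {s} {t} h a =
    trans (eval-tl s e) (trans (cong tlT (eval-agree e h a)) (sym (eval-tl t e)))
  eval-agree (eq? e f) h a =
    cong₂ (λ u v → encBool (u ==ᵀ v)) (eval-agree e (⊔-≤ˡ (boundE e) _ h) a)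
        (eval-agree f (⊔-≤ʳ (boundE e) _ h) a)

  -- Needed to execute a program, known only through its runs from `initStore`, in the middle of
  -- another one: what the other keeps in the variables from `b` on is neither read nor changed.
  exec-agree : ∀ {c s s₁ t} b → Exec c s s₁ → boundC c ≤ b → AgreeBelow b s t →
    Σ Store λ t₁ → Exec c t t₁ × AgreeBelow b s₁ t₁ × (∀ y → b ≤ y → t₁ y ≡ t y)
  exec-agree {t = t} b (exec-assign {x} {e} {s}) h a =
    _ , exec-assign ,
    (λ y y<b → update-cong s t x y (eval-agree e (⊔-≤ʳ (suc x) _ h) a) (a y y<b)) ,
    λ y b≤y → update-other t x _ y (≢-sym (<⇒≢ (≤-trans (⊔-≤ˡ (suc x) (boundE e) h) b≤y)))
  exec-agree b (exec-seq {c} {d} p q) h a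
    with exec-agree b p (⊔-≤ˡ (boundC c) _ h) a
  ... | t₁ , p′ , a₁ , f₁ with exec-agree b q (⊔-≤ʳ (boundC c) _ h) a₁
  ... | t₂ , q′ , a₂ , f₂ = t₂ , exec-seq p′ q′ , a₂ , λ y l → trans (f₂ y l) (f₁ y l)
  exec-agree b (exec-whileF {e} n) h a =
    _ , exec-whileF (trans (cong isNil (sym (eval-agree e (⊔-≤ˡ (boundE e) _ h) a))) n) , a , λ y l → refl
  exec-agree b (exec-whileT {e} {c} n p q) h a
    with exec-agree b p (⊔-≤ʳ (boundE e) _ h) a
  ... | t₁ , p′ , a₁ , f₁ with exec-agree b q h a₁
  ... | t₂ , q′ , a₂ , f₂ =
    t₂ , exec-whileT (trans (cong isNil (sym (eval-agree e (⊔-≤ˡ (boundE e) _ h) a))) n) p′ q′ ,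
    a₂ , λ y l → trans (f₂ y l) (f₁ y l)

  clear : ℕ → Cmd
  clear zero    = assign 0 (var 0)
  clear (suc n) = seq (clear n) (assign (suc n) enil)

  exec-clear : ∀ n s → Σ Store λ s′ → Exec (clear n) s s′ × s′ 0 ≡ s 0 ×
    (∀ y → y < n → s′ (suc y) ≡ nil) × (∀ y → n ≤ y → s′ (suc y) ≡ s (suc y))
  exec-clear zero    s = _ , exec-assign , refl , (λ y ()) , λ _ _ → refl
  exec-clear (suc n) s with exec-clear n s
  ... | s₁ , x , z , c , f = _ , exec-seq x exec-assign , z ,
    (λ y l → cl y (m<1+n⇒m<n∨m≡n l)) ,
    λ y l → trans (update-other (λ v → s₁ (suc v)) n nil y (≢-sym (<⇒≢ l))) (f y (≤-trans (n≤1+n n) l))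
    where
    cl : ∀ y → y < n ⊎ y ≡ n → update s₁ (suc n) nil (suc y) ≡ nil
    cl y (inj₁ l) = trans (update-other (λ v → s₁ (suc v)) n nil y (<⇒≢ l)) (c y l)
    cl y (inj₂ refl) = update-same (λ v → s₁ (suc v)) y nil

  infixr 5 _⨾_

  -- A procedure transforms a single tree. `under` is the only way to save a value: it sets the head
  -- aside while its argument works on the tail.
  data Proc : Set where
    expr  : E₀ → Proc
    _⨾_   : Proc → Proc → Proc
    under : Proc → Proc
    loop  : Proc → Proc
    call  : Prog → Proc

  infix 4 _⊢_⇒_

  data _⊢_⇒_ : Proc → Tree → Tree → Set where
    ⇒expr  : ∀ {e i} → expr e ⊢ i ⇒ ⟦ e ⟧ i
    ⇒seq   : ∀ {p q i m o} → p ⊢ i ⇒ m → q ⊢ m ⇒ o → p ⨾ q ⊢ i ⇒ o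
    ⇒under : ∀ {p a i o} → p ⊢ i ⇒ o → under p ⊢ cons a i ⇒ cons a o
    ⇒stop  : ∀ {p x} → loop p ⊢ cons nil x ⇒ cons nil x
    ⇒loop  : ∀ {p a b x i o} → p ⊢ cons (cons a b) x ⇒ i → loop p ⊢ i ⇒ o → loop p ⊢ cons (cons a b) x ⇒ o
    ⇒call  : ∀ {a i o} → Run a i o → call a ⊢ i ⇒ o

  scratch : Proc → ℕ
  scratch (expr e)  = 0
  scratch (p ⨾ q)   = scratch p ⊔ scratch q
  scratch (under p) = suc (scratch p)
  scratch (loop p)  = scratch p
  scratch (call a)  = boundC a

  code : Proc → Prog
  code (expr e)  = assign 0 (compile e)
  code (p ⨾ q)   = seq (code p) (code q)
  -- The saved head lies just above the scratch variables of `p`; resetting it to nil at the end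
  -- restores the invariant on the store.
  code (under p) = let m = suc (scratch p) in
    seq (assign m (hd (var 0))) (seq (assign 0 (tl (var 0))) (seq (code p)
    (seq (assign 0 (econs (var m) (var 0))) (assign m enil))))
  code (loop p)  = while (hd (var 0)) (code p)
  code (call a)  = seq a (clear (boundC a))

  -- The variables 1 .. scratch p hold nil on entry and again on exit.
  exec-code : ∀ {p i o} → p ⊢ i ⇒ o → ∀ s → s 0 ≡ i → (∀ y → y < scratch p → s (suc y) ≡ nil) →
    Σ Store λ s′ → Exec (code p) s s′ × s′ 0 ≡ o × (∀ y → s′ (suc y) ≡ s (suc y))
  exec-code (⇒expr {e}) s refl _ = _ , exec-assign , eval-compile s e , λ _ → refl
  exec-code (⇒seq {p} {q} P Q) s e n with exec-code P s e (λ y l → n y (≤-trans l (m≤m⊔n (scratch p) _)))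
  ... | s₁ , x₁ , z₁ , f₁ with exec-code Q s₁ z₁ (λ y l → trans (f₁ y) (n y (≤-trans l (m≤n⊔m (scratch p) _))))
  ... | s₂ , x₂ , z₂ , f₂ = s₂ , exec-seq x₁ x₂ , z₂ , λ y → trans (f₂ y) (f₁ y)
  exec-code (⇒under {p} {a} {i} {o} P) s e n = s₅ ,
    exec-seq exec-assign (exec-seq exec-assign (exec-seq X (exec-seq exec-assign exec-assign))) ,
    cong₂ cons va vo , out
    where
    m = suc (scratch p)
    s₁ = update s m (eval s (hd (var 0)))
    s₂ = update s₁ 0 (eval s₁ (tl (var 0)))
    s₁m : s₁ m ≡ a
    s₁m = trans (update-same s m _) (trans (eval-hd s (var 0)) (cong hdT e))
    callee = exec-code P s₂ (trans (eval-tl s₁ (var 0)) (cong tlT e))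
             (λ y l → trans (update-other s m _ (suc y) (<⇒≢ (s≤s l))) (n y (m<n⇒m<1+n l)))
    s₃ = proj₁ callee
    X = proj₁ (proj₂ callee)
    vo : s₃ 0 ≡ o
    vo = proj₁ (proj₂ (proj₂ callee))
    fr : ∀ y → s₃ (suc y) ≡ s₁ (suc y)
    fr = proj₂ (proj₂ (proj₂ callee))
    va : s₃ m ≡ a
    va = trans (fr (scratch p)) s₁m
    s₄ = update s₃ 0 (eval s₃ (econs (var m) (var 0)))
    s₅ = update s₄ m (eval s₄ enil)
    out : ∀ y → s₅ (suc y) ≡ s (suc y)
    out y with y ≟ scratch p
    ... | yes refl = trans (update-same s₄ m nil) (sym (n (scratch p) ≤-refl))
    ... | no  d = trans (update-other s₄ m nil (suc y) λ { refl → d refl })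
                   (trans (fr y) (update-other s m _ (suc y) λ { refl → d refl }))
  exec-code ⇒stop s e n = s , exec-whileF (cong isNil (trans (eval-hd s (var 0)) (cong hdT e))) , e , λ _ → refl
  exec-code (⇒loop P Q) s e n with exec-code P s e n
  ... | s₁ , x₁ , z₁ , f₁ with exec-code Q s₁ z₁ (λ y l → trans (f₁ y) (n y l))
  ... | s₂ , x₂ , z₂ , f₂ =
    s₂ , exec-whileT (cong isNil (trans (eval-hd s (var 0)) (cong hdT e))) x₁ x₂ , z₂ , λ y → trans (f₂ y) (f₁ y)
  -- The bound is `suc (boundC a)` so that variable 0, which carries the result, is covered even
  -- when `boundC a` is 0.
  exec-code (⇒call {a} (s₁ , x , z)) s e n
    with exec-agree (suc (boundC a)) x (n≤1+n _) (λ { zero l → sym e ; (suc y) (s≤s l) → sym (n y l) })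
  ... | t₁ , x′ , ag , fr with exec-clear (boundC a) t₁
  ... | t₂ , x″ , z″ , cl , kp =
    t₂ , exec-seq x′ x″ , trans z″ (trans (sym (ag 0 (s≤s z≤n))) z) , out
    where
    out : ∀ y → t₂ (suc y) ≡ s (suc y)
    out y with <-≤-connex y (boundC a)
    ... | inj₁ l = trans (cl y l) (sym (n y l))
    ... | inj₂ l = trans (kp y l) (fr (suc y) (s≤s l))

  run-code : ∀ p {i o} → p ⊢ i ⇒ o → Run (code p) i o
  run-code p r with exec-code r (initStore _) refl (λ _ _ → refl)
  ... | s , e , z , _ = s , e , z

  -- WHILE has no conditional. Two loops, guarded by the flag and by its precomputed negation,
  -- replace it; each body clears its own guard, so exactly one of them runs, and only once.
  ifP : Proc → Proc → Proc
  ifP p q = expr (hd₀ ● ∙ (hd₀ ● ≟₀ con nil) ∙ tl₀ ●)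
    ⨾ loop (under (under p) ⨾ expr (con nil ∙ tl₀ ●))
    ⨾ expr (hd₀ (tl₀ ●) ∙ con nil ∙ tl₀ (tl₀ ●))
    ⨾ loop (under (under q) ⨾ expr (con nil ∙ tl₀ ●))
    ⨾ expr (tl₀ (tl₀ ●))

  ⇒if-true : ∀ {p q a b x o} → p ⊢ x ⇒ o → ifP p q ⊢ cons (cons a b) x ⇒ o
  ⇒if-true P =
    ⇒seq ⇒expr (⇒seq (⇒loop (⇒seq (⇒under (⇒under P)) ⇒expr) ⇒stop)
    (⇒seq ⇒expr (⇒seq ⇒stop ⇒expr)))

  ⇒if-false : ∀ {p q x o} → q ⊢ x ⇒ o → ifP p q ⊢ cons nil x ⇒ o
  ⇒if-false Q =
    ⇒seq ⇒expr (⇒seq ⇒stop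
    (⇒seq ⇒expr (⇒seq (⇒loop (⇒seq (⇒under (⇒under Q)) ⇒expr) ⇒stop) ⇒expr)))

  -- The remaining list is kept at the head, where `loop` tests it, and `f` meets only the current
  -- element and the accumulator.
  foldP : Proc → Proc
  foldP f = loop (expr (tl₀ (hd₀ ●) ∙ hd₀ (hd₀ ●) ∙ tl₀ ●) ⨾ under f) ⨾ expr (tl₀ ●)

  ⇒fold-All : ∀ {A B : Set} {f} (e : A → Tree) (g : B → Tree) (F : B → A → B) (Ok : A → Set) →
    (∀ x y → Ok x → f ⊢ cons (e x) (g y) ⇒ g (F y x)) →
    ∀ xs y → All Ok xs → foldP f ⊢ cons (encList e xs) (g y) ⇒ g (foldl F y xs)
  ⇒fold-All {f = f} e g F Ok H xs y ok = ⇒seq (go xs y ok) ⇒expr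
    where
    go : ∀ xs y → All Ok xs → loop (expr (tl₀ (hd₀ ●) ∙ hd₀ (hd₀ ●) ∙ tl₀ ●) ⨾ under f)
           ⊢ cons (encList e xs) (g y) ⇒ cons nil (g (foldl F y xs))
    go []       y _ = ⇒stop
    go (x ∷ xs) y (v ∷ vs) = ⇒loop (⇒seq ⇒expr (⇒under (H x y v))) (go xs (F y x) vs)

  ⇒fold : ∀ {A B : Set} {f} (e : A → Tree) (g : B → Tree) (F : B → A → B) →
    (∀ x y → f ⊢ cons (e x) (g y) ⇒ g (F y x)) →
    ∀ xs y → foldP f ⊢ cons (encList e xs) (g y) ⇒ g (foldl F y xs)
  ⇒fold e g F H xs y = ⇒fold-All e g F (λ _ → ⊤) (λ x y _ → H x y) xs y (All.universal (λ _ → tt) xs)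

-- Classical logic, infinite recurrence and the parity condition

module Classical (em : ExcludedMiddle) where
  open import Data.Vec using (Vec; []; _∷_; head; tail)

  ¬¬-elim : ∀ {A : Set} → ¬ ¬ A → A
  ¬¬-elim {A} h with em A
  ... | inj₁ a = a
  ... | inj₂ n = ⊥-elim (h n)

  ¬∀⇒∃¬ : ∀ {A : Set} {B : A → Set} → ¬ (∀ a → B a) → Σ A λ a → ¬ B a
  ¬∀⇒∃¬ h = ¬¬-elim λ n → h λ a → ¬¬-elim λ nb → n (a , nb)

  ⌊_⌋ : Set → Bool
  ⌊ A ⌋ with em A
  ... | inj₁ _ = true
  ... | inj₂ _ = false

  ⌊⌋-true : ∀ {A} → A → ⌊ A ⌋ ≡ true
  ⌊⌋-true {A} a with em A
  ... | inj₁ _ = refl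
  ... | inj₂ n = ⊥-elim (n a)

  true-⌊⌋ : ∀ {A} → ⌊ A ⌋ ≡ true → A
  true-⌊⌋ {A} h with em A
  ... | inj₁ a = a

  ⌊⌋-false : ∀ {A} → ¬ A → ⌊ A ⌋ ≡ false
  ⌊⌋-false {A} n with em A
  ... | inj₁ a = ⊥-elim (n a)
  ... | inj₂ _ = refl

  ⌊⌋-cong : ∀ {A B} → (A → B) → (B → A) → ⌊ A ⌋ ≡ ⌊ B ⌋
  ⌊⌋-cong {A} {B} f g with em B
  ... | inj₁ b = ⌊⌋-true (g b)
  ... | inj₂ n = ⌊⌋-false λ a → n (f a)

  Least : (ℕ → Set) → ℕ → Set
  Least Q n = Q n × (∀ m → m < n → ¬ Q m)

  least : (Q : ℕ → Set) → Σ ℕ Q → Σ ℕ (Least Q)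
  least Q (n , q) = ¬¬-elim λ none → below none (suc n) n ≤-refl q
    where
    below : ¬ Σ ℕ (Least Q) → ∀ n m → m < n → ¬ Q m
    below none (suc n) m l q with m<1+n⇒m<n∨m≡n l
    ... | inj₁ l′   = below none n m l′ q
    ... | inj₂ refl = none (m , q , below none m)

  Inf Ev : (ℕ → Set) → Set
  Inf Q = ∀ T → Σ ℕ λ k → T ≤ k × Q k
  Ev Q = Σ ℕ λ T → ∀ k → T ≤ k → Q k

  Inf-mono : ∀ {Q R : ℕ → Set} → (∀ k → Q k → R k) → Inf Q → Inf R
  Inf-mono f h T with h T
  ... | k , l , q = k , l , f k q

  Ev-and : ∀ {Q R : ℕ → Set} → Ev Q → Ev R → Ev (λ k → Q k × R k)
  Ev-and (T , f) (S , g) = T ⊔ S , λ k l → f k (≤-trans (m≤m⊔n T S) l) , g k (≤-trans (m≤n⊔m T S) l)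

  Inf-Ev : ∀ {Q R : ℕ → Set} → Inf Q → Ev R → Inf (λ k → Q k × R k)
  Inf-Ev h (S , g) T with h (T ⊔ S)
  ... | k , l , q = k , ≤-trans (m≤m⊔n T S) l , q , g k (≤-trans (m≤n⊔m T S) l)

  ¬Inf⇒Ev : ∀ {Q : ℕ → Set} → ¬ Inf Q → Ev (λ k → ¬ Q k)
  ¬Inf⇒Ev h with ¬∀⇒∃¬ h
  ... | T , n = T , λ k l q → n (k , l , q)

  Inf-⊎ : ∀ {Q R : ℕ → Set} → Inf (λ k → Q k ⊎ R k) → Inf Q ⊎ Inf R
  Inf-⊎ {Q} h with em (Inf Q)
  ... | inj₁ i = inj₁ i
  ... | inj₂ n = inj₂ (Inf-mono (λ { k (inj₁ q , nq) → ⊥-elim (nq q) ; k (inj₂ r , _) → r })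
                        (Inf-Ev h (¬Inf⇒Ev n)))

  pigeon-Vec : ∀ {n} (Q : ℕ → Set) (f : ℕ → Vec Bool n) → Inf Q → Σ (Vec Bool n) λ v → Inf (λ k → Q k × f k ≡ v)
  pigeon-Vec {zero} Q f h = [] , Inf-mono (λ k q → q , empty (f k)) h
    where
    empty : (v : Vec Bool 0) → v ≡ []
    empty [] = refl
  pigeon-Vec {suc n} Q f h = go (Inf-⊎ (Inf-mono split h))
    where
    eta : ∀ {b} (v : Vec Bool (suc n)) → head v ≡ b → v ≡ b ∷ tail v
    eta (_ ∷ _) refl = refl
    split : ∀ k → Q k → (Q k × head (f k) ≡ true) ⊎ (Q k × head (f k) ≡ false)
    split k q with head (f k)
    ... | true  = inj₁ (q , refl)
    ... | false = inj₂ (q , refl)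
    sub : ∀ b → Inf (λ k → Q k × head (f k) ≡ b) → Σ (Vec Bool (suc n)) λ v → Inf (λ k → Q k × f k ≡ v)
    sub b i with pigeon-Vec _ (λ k → tail (f k)) i
    ... | v , j = (b ∷ v) , Inf-mono (λ { k ((q , e) , e′) → q , trans (eta (f k) e) (cong (b ∷_) e′) }) j
    go : _ ⊎ _ → Σ (Vec Bool (suc n)) λ v → Inf (λ k → Q k × f k ≡ v)
    go (inj₁ i) = sub true i
    go (inj₂ i) = sub false i

  pigeon-ℕ : ∀ B {P : ℕ → ℕ → Set} → Inf (λ k → Σ ℕ λ v → v < B × P k v) → Σ ℕ λ v → Inf (λ k → P k v)
  pigeon-ℕ zero h with h 0
  ... | _ , _ , _ , () , _
  pigeon-ℕ (suc B) {P} h with Inf-⊎ (Inf-mono split h)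
    where
    split : ∀ k → (Σ ℕ λ v → v < suc B × P k v) → (Σ ℕ λ v → v < B × P k v) ⊎ P k B
    split k (v , l , p) with m<1+n⇒m<n∨m≡n l
    ... | inj₁ l′   = inj₁ (v , l′ , p)
    ... | inj₂ refl = inj₂ p
  ... | inj₁ i = pigeon-ℕ B i
  ... | inj₂ i = B , i

  even : ℕ → Bool
  even zero    = true
  even (suc n) = not (even n)

  -- The min-parity condition: `m` is the limit inferior of `p`, and player `true` is favoured by an
  -- even one.
  Parity : Bool → (ℕ → ℕ) → Set
  Parity b p = Σ ℕ λ m → even m ≡ b × Inf (λ k → p k ≡ m) × Ev (λ k → m ≤ p k)

  liminf : ∀ B (p : ℕ → ℕ) → (∀ k → p k < B) → Σ ℕ λ m → Inf (λ k → p k ≡ m) × Ev (λ k → m ≤ p k)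
  liminf B p bd with least (λ m → Inf (λ k → p k ≡ m)) (pigeon-ℕ B (λ T → T , ≤-refl , p T , bd T , refl))
  ... | m , im , lt = m , im , ev m lt
    where
    ev : ∀ m → (∀ j → j < m → ¬ Inf (λ k → p k ≡ j)) → Ev (λ k → m ≤ p k)
    ev zero    n = 0 , λ _ _ → z≤n
    ev (suc m) n with Ev-and (ev m (λ j l → n j (m<n⇒m<1+n l))) (¬Inf⇒Ev (n m ≤-refl))
    ... | T , f = T , λ k l → strict (m≤n⇒m<n∨m≡n (proj₁ (f k l))) (proj₂ (f k l))
      where
      strict : ∀ {k} → m < p k ⊎ m ≡ p k → p k ≢ m → suc m ≤ p k
      strict (inj₁ l) _ = l
      strict (inj₂ e) d = ⊥-elim (d (sym e))

  Parity-unique : ∀ {b c p} → Parity b p → Parity c p → b ≡ c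
  Parity-unique {p = p} (m , e , i , v) (m′ , e′ , i′ , v′) =
    trans (sym e) (trans (cong even (≤-antisym (le i′ v) (le i v′))) e′)
    where
    le : ∀ {m m′} → Inf (λ k → p k ≡ m′) → Ev (λ k → m ≤ p k) → m ≤ m′
    le i v with Inf-Ev i v 0
    ... | k , _ , refl , l = l

  Parity-tail : ∀ {b p} T → Parity b (λ k → p (T + k)) → Parity b p
  Parity-tail {b} {p} T (m , e , i , (S , v)) = m , e , inf , (T + S , λ k l → ev k l)
    where
    inf : Inf (λ k → p k ≡ m)
    inf N with i N
    ... | k , l , q = T + k , ≤-trans l (m≤n+m k T) , q
    ev : ∀ k → T + S ≤ k → m ≤ p k
    ev k l with k ∸ T | m+[n∸m]≡n (≤-trans (m≤m+n T S) l)
    ... | j | refl = v j (+-cancelˡ-≤ T S j l)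

-- Recognition of MLO formulas by automata run on segments

module Recognition (em : ExcludedMiddle) where
  open Classical em
  open import Data.Vec using (Vec; []; _∷_; head; _++_; take; drop)
  open import Data.Vec.Properties using (++-injective)

  take-++ : ∀ {A : Set} {m n} (xs : Vec A m) (ys : Vec A n) → take m (xs ++ ys) ≡ xs
  take-++ []       ys = refl
  take-++ (x ∷ xs) ys = cong (x ∷_) (take-++ xs ys)

  drop-++ : ∀ {A : Set} {m n} (xs : Vec A m) (ys : Vec A n) → drop m (xs ++ ys) ≡ ys
  drop-++ []       ys = refl
  drop-++ (x ∷ xs) ys = drop-++ xs ys

  size : ℕ → ℕ
  size zero    = 1
  size (suc n) = size n + size n

  -- Truth tables turn sets of states back into bit vectors, so that the powerset construction does
  -- not leave `Vec Bool`; the strategy tables of the game use them too.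
  table : ∀ {n} → (Vec Bool n → Bool) → Vec Bool (size n)
  table {zero}  f = f [] ∷ []
  table {suc n} f = table (λ v → f (true ∷ v)) ++ table (λ v → f (false ∷ v))

  look : ∀ {n} → Vec Bool (size n) → Vec Bool n → Bool
  look {zero}  t []          = head t
  look {suc n} t (true ∷ v)  = look (take (size n) t) v
  look {suc n} t (false ∷ v) = look (drop (size n) t) v

  look-table : ∀ {n} (f : Vec Bool n → Bool) v → look (table f) v ≡ f v
  look-table {zero}  f []          = refl
  look-table {suc n} f (true ∷ v)  =
    trans (cong (λ t → look t v) (take-++ (table (λ v → f (true ∷ v))) _)) (look-table _ v)
  look-table {suc n} f (false ∷ v) =
    trans (cong (λ t → look t v) (drop-++ (table (λ v → f (true ∷ v))) _)) (look-table _ v)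

  ≡ᵇ-true : ∀ {m n} → (m ≡ᵇ n) ≡ true → m ≡ n
  ≡ᵇ-true {m} {n} e = ≡ᵇ⇒≡ m n (Equivalence.from T-≡ e)

  ≡ᵇ-refl : ∀ n → (n ≡ᵇ n) ≡ true
  ≡ᵇ-refl n = Equivalence.to T-≡ (≡⇒≡ᵇ n n refl)

  ≡ᵇ-≢ : ∀ {m n} → m ≢ n → (m ≡ᵇ n) ≡ false
  ≡ᵇ-≢ d = ¬-not λ e → d (≡ᵇ-true e)

  Monotone Unbounded : (ℕ → ℕ) → Set
  Monotone c  = ∀ k → c k ≤ c (suc k)
  Unbounded c = ∀ t → Σ ℕ λ k → t < c k

  -- Cuts may repeat, so segments may be empty. This is used: the first segment of the factorisation
  -- found below is empty when the surviving thread was born at time 0.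
  record Cuts (c : ℕ → ℕ) : Set where
    field
      start : c 0 ≡ 0
      mono  : Monotone c
      unbd  : Unbounded c

    mono≤ : ∀ {k l} → k ≤ l → c k ≤ c l
    mono≤ {k} {l} k≤l = subst (λ j → c k ≤ c j) (m∸n+n≡m k≤l) (go (l ∸ k))
      where
      go : ∀ j → c k ≤ c (j + k)
      go zero    = ≤-refl
      go (suc j) = ≤-trans (go j) (mono (j + k))

    locate : ∀ t → Σ ℕ λ k → c k ≤ t × t < c (suc k)
    locate t = down (proj₁ (unbd t)) (proj₂ (unbd t))
      where
      down : ∀ k → t < c k → Σ ℕ λ k → c k ≤ t × t < c (suc k)
      down zero    l = ⊥-elim (n≮0 (subst (t <_) start l))
      down (suc k) l with <-≤-connex t (c k)
      ... | inj₁ l′ = down k l′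
      ... | inj₂ l′ = k , l′ , l

    locate-unique : ∀ {t k l} → c k ≤ t × t < c (suc k) → c l ≤ t × t < c (suc l) → k ≡ l
    locate-unique {t} {k} {l} (a , b) (a′ , b′) with <-cmp k l
    ... | tri< x _ _ = ⊥-elim (<-irrefl refl (<-≤-trans b (≤-trans (mono≤ x) a′)))
    ... | tri≈ _ e _ = e
    ... | tri> _ _ x = ⊥-elim (<-irrefl refl (<-≤-trans b′ (≤-trans (mono≤ x) a)))

  module Segments {Q S : Set} (ι : Q) (step : Q → S → Q) where
    run : (ℕ → S) → ℕ → ℕ → Q
    run w i zero    = ι
    run w i (suc l) = step (run w i l) (w (i + l))

    seg : (ℕ → S) → ℕ → ℕ → Q
    seg w i j = run w i (j ∸ i)

    run-cong : ∀ {w w′} i l → (∀ t → i ≤ t → t < i + l → w t ≡ w′ t) → run w i l ≡ run w′ i l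
    run-cong i zero    h = refl
    run-cong i (suc l) h = cong₂ step
      (run-cong i l λ t a b → h t a (<-≤-trans b (+-monoʳ-≤ i (n≤1+n l))))
      (h (i + l) (m≤m+n i l) (+-monoʳ-< i ≤-refl))

  -- A finite automaton, restarted at each cut, whose states at the ends of the segments
  -- determine membership in L.
  record Recogniser {S : Set} (L : (ℕ → S) → Set) : Set where
    field
      bits     : ℕ
      ι        : Vec Bool bits
      step     : Vec Bool bits → S → Vec Bool bits
    open Segments ι step public
    field
      transfer : ∀ w w′ c c′ → Cuts c → Cuts c′ →
        (∀ k → seg w (c k) (c (suc k)) ≡ seg w′ (c′ k) (c′ (suc k))) → L w → L w′
  open Recogniser

  -- Complementation keeps the automaton, because `transfer` can be applied with the two words
  -- exchanged.
  rec-¬ : ∀ {S} {L : (ℕ → S) → Set} → Recogniser L → Recogniser (λ w → ¬ L w)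
  bits (rec-¬ R) = bits R
  ι    (rec-¬ R) = ι R
  step (rec-¬ R) = step R
  transfer (rec-¬ R) w w′ c c′ C C′ e n l = n (transfer R w′ w c′ c C′ C (λ k → sym (e k)) l)

  module Product {S} {L M : (ℕ → S) → Set} (R : Recogniser L) (R′ : Recogniser M) where
    step× : Vec Bool (bits R + bits R′) → S → Vec Bool (bits R + bits R′)
    step× v a = step R (take (bits R) v) a ++ step R′ (drop (bits R) v) a

    open Segments (ι R ++ ι R′) step× renaming (run to run×; seg to seg×)

    run≡ : ∀ w i l → run× w i l ≡ run R w i l ++ run R′ w i l
    run≡ w i zero    = refl
    run≡ w i (suc l) rewrite run≡ w i l | take-++ (run R w i l) (run R′ w i l) | drop-++ (run R w i l)
        (run R′ w i l) = refl

    both : ∀ w w′ i j i′ j′ → seg× w i j ≡ seg× w′ i′ j′ →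
        seg R w i j ≡ seg R w′ i′ j′ × seg R′ w i j ≡ seg R′ w′ i′ j′
    both w w′ i j i′ j′ e = ++-injective (seg R w i j) (seg R w′ i′ j′)
      (trans (sym (run≡ w i (j ∸ i))) (trans e (run≡ w′ i′ (j′ ∸ i′))))

    rec-× : Recogniser (λ w → L w × M w)
    bits rec-× = bits R + bits R′
    ι    rec-× = ι R ++ ι R′
    step rec-× = step×
    transfer rec-× w w′ c c′ C C′ e (x , y) =
      transfer R w w′ c c′ C C′ (λ k → proj₁ (both w w′ (c k) (c (suc k)) (c′ k) (c′ (suc k)) (e k))) x ,
      transfer R′ w w′ c c′ C C′ (λ k → proj₂ (both w w′ (c k) (c (suc k)) (c′ k) (c′ (suc k)) (e k))) y

  open Product using (rec-×)

  module Projection {S S′ : Set} (ins : Bool → S → S′) {L : (ℕ → S′) → Set} (R : Recogniser L) where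
    with-bits : (ℕ → Bool) → (ℕ → S) → ℕ → S′
    with-bits z w t = ins (z t) (w t)

    ιₚ : Vec Bool (size (bits R))
    ιₚ = table (λ q → ⌊ q ≡ ι R ⌋)

    stepₚ : Vec Bool (size (bits R)) → S → Vec Bool (size (bits R))
    stepₚ A a = table (λ q′ → ⌊ (Σ (Vec Bool (bits R)) λ q → look A q ≡ true × Σ Bool λ b →
        step R q (ins b a) ≡ q′) ⌋)

    open Segments ιₚ stepₚ renaming (run to runₚ; seg to segₚ; run-cong to runₚ-cong)

    member : ∀ w i l q → look (runₚ w i l) q ≡ true → Σ (ℕ → Bool) λ z → run R (with-bits z w) i l ≡ q
    member w i zero    q h = (λ _ → false) , sym (true-⌊⌋ (trans (sym (look-table _ q)) h))
    member w i (suc l) q h with true-⌊⌋ (trans (sym (look-table _ q)) h)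
    ... | q₀ , h₀ , b , e with member w i l q₀ h₀
    ... | z₀ , e₀ = z , trans (cong₂ (step R) (trans (run-cong R i l same) e₀)
          (cong (λ b → ins b (w (i + l))) here)) e
      where
      z : ℕ → Bool
      z t = if t ≡ᵇ (i + l) then b else z₀ t
      here : z (i + l) ≡ b
      here rewrite ≡ᵇ-refl (i + l) = refl
      same : ∀ t → i ≤ t → t < i + l → with-bits z w t ≡ with-bits z₀ w t
      same t _ l< rewrite ≡ᵇ-≢ (<⇒≢ l<) = refl

    member⁻¹ : ∀ w i l z → look (runₚ w i l) (run R (with-bits z w) i l) ≡ true
    member⁻¹ w i zero    z = trans (look-table {bits R} _ (ι R)) (⌊⌋-true refl)
    member⁻¹ w i (suc l) z = trans (look-table {bits R} _ (run R (with-bits z w) i (suc l)))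
      (⌊⌋-true (run R (with-bits z w) i l , member⁻¹ w i l z , z (i + l) , refl))

    -- The subset automaton. A witness for `w′` is pasted from pieces: on each segment, equality of
    -- the state sets yields bits leading to the very state that `z` reaches on the corresponding
    -- segment of `w`.
    project : Recogniser (λ w → Σ (ℕ → Bool) λ z → L (with-bits z w))
    bits project = size (bits R)
    ι    project = ιₚ
    step project = stepₚ
    transfer project w w′ c c′ C C′ e (z , x) = z′ , transfer R _ _ c c′ C C′ agree x
      where
      open Cuts C′ using (locate; locate-unique)
      target : ∀ k → Vec Bool (bits R)
      target k = seg R (with-bits z w) (c k) (c (suc k))
      pieces : ∀ k → Σ (ℕ → Bool) λ z → seg R (with-bits z w′) (c′ k) (c′ (suc k)) ≡ target k
      pieces k = member w′ (c′ k) (c′ (suc k) ∸ c′ k) (target k)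
        (trans (cong (λ A → look A (target k)) (sym (e k))) (member⁻¹ w (c k) (c (suc k) ∸ c k) z))
      z′ : ℕ → Bool
      z′ t = proj₁ (pieces (proj₁ (locate t))) t
      agree : ∀ k → target k ≡ seg R (with-bits z′ w′) (c′ k) (c′ (suc k))
      agree k = trans (sym (proj₂ (pieces k))) (run-cong R (c′ k) _ λ t a b →
        cong (λ j → ins (proj₁ (pieces j) t) (w′ t))
          (locate-unique (a , <-≤-trans b (≤-reflexive (m+[n∸m]≡n (Cuts.mono C′ k)))) (proj₂ (locate t))))

  ∨-true : ∀ a b → a ∨ b ≡ true → a ≡ true ⊎ b ≡ true
  ∨-true true  b e = inj₁ refl
  ∨-true false b e = inj₂ e

  ∨-trueʳ : ∀ a {b} → b ≡ true → a ∨ b ≡ true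
  ∨-trueʳ true  e = refl
  ∨-trueʳ false e = e

  ∧-true : ∀ a b → a ∧ b ≡ true → a ≡ true × b ≡ true
  ∧-true true b e = refl , e

  module _ {S : Set} (f g : S → Bool) where
    private
      -- The three bits record that `f` has occurred, that `g` has occurred, and that `g` has
      -- occurred strictly after `f`; the last uses the old value of the first, whence the
      -- strictness.
      st : Vec Bool 3 → S → Vec Bool 3
      st (a ∷ b ∷ c ∷ []) x = (a ∨ f x) ∷ (b ∨ g x) ∷ (c ∨ (a ∧ g x)) ∷ []
      i₀ : Vec Bool 3
      i₀ = false ∷ false ∷ false ∷ []
      open Segments i₀ st renaming (run to run₃; seg to seg₃)
      F G B : Vec Bool 3 → Bool
      F (a ∷ _) = a
      G (_ ∷ b ∷ _) = b
      B (_ ∷ _ ∷ c ∷ []) = c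

      Fst : ∀ v x → F (st v x) ≡ F v ∨ f x
      Fst (a ∷ b ∷ c ∷ []) x = refl
      Gst : ∀ v x → G (st v x) ≡ G v ∨ g x
      Gst (a ∷ b ∷ c ∷ []) x = refl
      Bst : ∀ v x → B (st v x) ≡ B v ∨ (F v ∧ g x)
      Bst (a ∷ b ∷ c ∷ []) x = refl

      last : ∀ i l → i + l < i + suc l
      last i l = +-monoʳ-< i ≤-refl
      wk : ∀ {i l t} → t < i + l → t < i + suc l
      wk {i} {l} h = <-≤-trans h (+-monoʳ-≤ i (n≤1+n l))
      cmp : ∀ i {l t} → t < i + suc l → t < i + l ⊎ t ≡ i + l
      cmp i {l} {t} h = m<1+n⇒m<n∨m≡n (subst (t <_) (+-suc i l) h)

      module Seen (h : S → Bool) (H : Vec Bool 3 → Bool) (H-init : H i₀ ≡ false)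
        (H-step : ∀ v x → H (st v x) ≡ H v ∨ h x) where
        sound : ∀ w i l → H (run₃ w i l) ≡ true → Σ ℕ λ t → i ≤ t × t < i + l × h (w t) ≡ true
        sound w i zero    e with trans (sym H-init) e
        ... | ()
        sound w i (suc l) e with ∨-true _ _ (trans (sym (H-step (run₃ w i l) _)) e)
        ... | inj₂ e′ = i + l , m≤m+n i l , last i l , e′
        ... | inj₁ e′ with sound w i l e′
        ... | t , a , b , e″ = t , a , wk b , e″

        complete : ∀ w i l t → i ≤ t → t < i + l → h (w t) ≡ true → H (run₃ w i l) ≡ true
        complete w i zero t a b e = ⊥-elim (<⇒≱ b (≤-trans (≤-reflexive (+-identityʳ i)) a))
        complete w i (suc l) t a b e with cmp i b
        ... | inj₁ b′ = trans (H-step (run₃ w i l) _) (cong (_∨ h (w (i + l))) (complete w i l t a b′ e))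
        ... | inj₂ refl = trans (H-step (run₃ w i l) _) (∨-trueʳ _ e)

      open Seen f F refl Fst renaming (sound to Fs; complete to Fc)
      open Seen g G refl Gst renaming (sound to Gs; complete to Gc)

      Bs : ∀ w i l → B (run₃ w i l) ≡ true → Σ ℕ λ s → Σ ℕ λ t → s < t × f (w s) ≡ true × g (w t) ≡ true
      Bs w i (suc l) h with ∨-true _ _ (trans (sym (Bst (run₃ w i l) _)) h)
      ... | inj₁ h′ = Bs w i l h′
      ... | inj₂ e with ∧-true _ _ e
      ... | e₁ , e₂ with Fs w i l e₁
      ... | s , a , b , e = s , i + l , b , e , e₂

      Bc : ∀ w i l s t → i ≤ s → s < t → t < i + l → f (w s) ≡ true → g (w t) ≡ true → B (run₃ w i l) ≡ true
      Bc w i zero s t a b c e e′ = ⊥-elim (<⇒≱ (<-trans b c) (≤-trans (≤-reflexive (+-identityʳ i)) a))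
      Bc w i (suc l) s t a b c e e′ with cmp i c
      ... | inj₁ c′ = trans (Bst (run₃ w i l) _)
            (cong (_∨ (F (run₃ w i l) ∧ g (w (i + l)))) (Bc w i l s t a b c′ e e′))
      ... | inj₂ refl = trans (Bst (run₃ w i l) _)
                          (∨-trueʳ (B (run₃ w i l)) (cong₂ _∧_ (Fc w i l s a b e) e′))

      end : ∀ {c} → Cuts c → ∀ k → c k + (c (suc k) ∸ c k) ≡ c (suc k)
      end C k = m+[n∸m]≡n (Cuts.mono C k)

      Fseg : ∀ {w c} (C : Cuts c) t → f (w t) ≡ true →
          F (seg₃ w (c (proj₁ (Cuts.locate C t))) (c (suc (proj₁ (Cuts.locate C t))))) ≡ true
      Fseg {w} {c} C t e with Cuts.locate C t
      ... | k , a , b = Fc w (c k) _ t a (subst (t <_) (sym (end C k)) b) e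

    Somewhere Before : (ℕ → S) → Set
    Somewhere w = Σ ℕ λ t → f (w t) ≡ true
    Before w = Σ ℕ λ s → Σ ℕ λ t → s < t × f (w s) ≡ true × g (w t) ≡ true

    rec-somewhere : Recogniser Somewhere
    bits rec-somewhere = 3
    ι    rec-somewhere = i₀
    step rec-somewhere = st
    transfer rec-somewhere w w′ c c′ C C′ eq (t , e)
      with Fs w′ (c′ k₀) (c′ (suc k₀) ∸ c′ k₀) (trans (cong F (sym (eq k₀))) (Fseg {w} C t e))
      where k₀ = proj₁ (Cuts.locate C t)
    ... | t′ , _ , _ , e′ = t′ , e′

    -- Two positions in one segment are reported by its third bit; positions in different segments
    -- by the first bit of the earlier and the second bit of the later one.
    rec-before : Recogniser Before
    bits rec-before = 3
    ι    rec-before = i₀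
    step rec-before = st
    transfer rec-before w w′ c c′ C C′ eq (s , t , lt , e , e′) with Cuts.locate C s | Cuts.locate C t
    ... | k , a , b | j , a′ , b′ with <-cmp k j
    ...   | tri> _ _ x = ⊥-elim (<⇒≱ lt (≤-trans (<⇒≤ b′) (≤-trans (Cuts.mono≤ C x) a)))
    ...   | tri≈ _ refl _ = Bs w′ (c′ k) (c′ (suc k) ∸ c′ k) (trans (cong B (sym (eq k)))
              (Bc w (c k) _ s t a lt (subst (t <_) (sym (end C k)) b′) e e′))
    ...   | tri< x _ _
            with Fs w′ (c′ k) (c′ (suc k) ∸ c′ k) (trans (cong F (sym (eq k)))
                (Fc w (c k) _ s a (subst (s <_) (sym (end C k)) b) e))
               | Gs w′ (c′ j) (c′ (suc j) ∸ c′ j) (trans (cong G (sym (eq j)))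
                   (Gc w (c j) _ t a′ (subst (t <_) (sym (end C j)) b′) e′))
    ...     | s′ , _ , sl , se | t′ , tge , _ , te =
              s′ , t′ , <-≤-trans (subst (s′ <_) (end C′ k) sl) (≤-trans (Cuts.mono≤ C′ x) tge) , se , te

  at : ∀ {n} → Vec Bool n → ℕ → Bool
  at []      _       = false
  at (b ∷ v) zero    = b
  at (b ∷ v) (suc x) = at v x

  Letter : ℕ → ℕ → Set
  Letter a b = Vec Bool a × Vec Bool b

  -- A first-order variable is read as its singleton, one track per variable.
  Represents : ∀ {a b} → (ℕ → Letter a b) → (ℕ → ℕ) → (ℕ → ℕ → Bool) → Set
  Represents {a} {b} w ρ σ = (∀ t x → x < a → at (proj₁ (w t)) x ≡ (ρ x ≡ᵇ t)) ×
      (∀ t X → X < b → at (proj₂ (w t)) X ≡ σ X t)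

  -- A word whose first-order tracks are not singletons represents no assignment, so the language
  -- cannot be given by `Sat`. It is built along the formula and compared with `Sat` on representing
  -- words only.
  record Recognised (φ : Fm) (a b : ℕ) : Set₁ where
    field
      Lang     : (ℕ → Letter a b) → Set
      recog    : Recogniser Lang
      sound    : ∀ w ρ σ → Represents w ρ σ → Lang w → Sat ρ σ φ
      complete : ∀ w ρ σ → Represents w ρ σ → Sat ρ σ φ → Lang w
  open Recognised

  recognise : ∀ φ a b → FOBelow a φ → SOBelow b φ → Recognised φ a b
  recognise (x <′ y) a b (fx , fy) so = record
    { Lang = Before (λ l → at (proj₁ l) x) (λ l → at (proj₁ l) y)
    ; recog = rec-before (λ l → at (proj₁ l) x) (λ l → at (proj₁ l) y)
    ; sound = λ { w ρ σ (R , _) (s , t , lt , e , e′) →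
        subst (ρ x <_) (sym (≡ᵇ-true (trans (sym (R t y fy)) e′)))
          (subst (_< t) (sym (≡ᵇ-true (trans (sym (R s x fx)) e))) lt) }
    ; complete = λ { w ρ σ (R , _) lt → ρ x , ρ y , lt ,
        trans (R (ρ x) x fx) (≡ᵇ-refl (ρ x)) , trans (R (ρ y) y fy) (≡ᵇ-refl (ρ y)) } }
  recognise (x ∈′ X) a b fo so = record
    { Lang = Somewhere (λ l → at (proj₁ l) x ∧ at (proj₂ l) X) (λ _ → false)
    ; recog = rec-somewhere (λ l → at (proj₁ l) x ∧ at (proj₂ l) X) (λ _ → false)
    ; sound = λ { w ρ σ (R , R′) (t , e) → let (e₁ , e₂) = ∧-true _ _ e in
        trans (cong (σ X) (≡ᵇ-true (trans (sym (R t x fo)) e₁))) (trans (sym (R′ t X so)) e₂) }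
    ; complete = λ { w ρ σ (R , R′) e → ρ x ,
        cong₂ _∧_ (trans (R (ρ x) x fo) (≡ᵇ-refl (ρ x))) (trans (R′ (ρ x) X so) e) } }
  recognise (¬′ φ) a b fo so with recognise φ a b fo so
  ... | r = record
    { Lang = λ w → ¬ Lang r w
    ; recog = rec-¬ (recog r)
    ; sound = λ w ρ σ R n s → n (complete r w ρ σ R s)
    ; complete = λ w ρ σ R n s → n (sound r w ρ σ R s) }
  recognise (φ ∧′ ψ) a b (fo , fo′) (so , so′) with recognise φ a b fo so | recognise ψ a b fo′ so′
  ... | r | r′ = record
    { Lang = λ w → Lang r w × Lang r′ w
    ; recog = rec-× (recog r) (recog r′)
    ; sound = λ { w ρ σ R (x , y) → sound r w ρ σ R x , sound r′ w ρ σ R y }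
    ; complete = λ { w ρ σ R (x , y) → complete r w ρ σ R x , complete r′ w ρ σ R y } }
  recognise (∃₁ φ) a b fo so with recognise φ (suc a) b fo so
  ... | r = record
    { Lang = λ w → Σ (ℕ → Bool) λ z → Lang₁ (with-bits z w)
    ; recog = project
    ; sound = λ { w ρ σ R (z , x , (n , e) , u) → n ,
        sound r _ (extend n ρ) σ (ext w ρ σ R z n (single z w n e u)) x }
    ; complete = λ { w ρ σ R (n , s) → (n ≡ᵇ_) ,
        complete r _ (extend n ρ) σ (ext w ρ σ R (n ≡ᵇ_) n (λ _ → refl)) s , (n , ≡ᵇ-refl n) ,
        λ { (i , j , lt , e , e′) → <-irrefl (trans (sym (≡ᵇ-true {n} e)) (≡ᵇ-true {n} e′)) lt } } }
    where
    bit₀ : Letter (suc a) b → Bool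
    bit₀ l = head (proj₁ l)
    -- First-order quantification becomes set quantification over singletons: the new track has an
    -- element, and no two of them one before the other.
    Lang₁ : (ℕ → Letter (suc a) b) → Set
    Lang₁ w = Lang r w × Somewhere bit₀ bit₀ w × ¬ Before bit₀ bit₀ w
    insert : Bool → Letter a b → Letter (suc a) b
    insert z (u , v) = (z ∷ u) , v
    open Projection insert {Lang₁} (rec-× (recog r) (rec-× (rec-somewhere bit₀ bit₀) (rec-¬ (rec-before bit₀ bit₀))))
    ext : ∀ w ρ σ → Represents w ρ σ → ∀ z n → (∀ t → z t ≡ (n ≡ᵇ t)) → Represents (with-bits z w) (extend n ρ) σ
    ext w ρ σ (R , R′) z n e = (λ { t zero l → e t ; t (suc x) (s≤s l) → R t x l }) , R′
    single : ∀ z w n → bit₀ (with-bits z w n) ≡ true → ¬ Before bit₀ bit₀ (with-bits z w) → ∀ t → z t ≡ (n ≡ᵇ t)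
    single z w n e u t with <-cmp n t
    ... | tri≈ _ refl _ = trans e (sym (≡ᵇ-refl n))
    ... | tri< l d _ = trans (¬-not (λ e′ → u (n , t , l , e , e′))) (sym (≡ᵇ-≢ d))
    ... | tri> _ d l = trans (¬-not (λ e′ → u (t , n , l , e′ , e))) (sym (≡ᵇ-≢ d))
  recognise (∃₂ φ) a b fo so with recognise φ a (suc b) fo so
  ... | r = record
    { Lang = λ w → Σ (ℕ → Bool) λ z → Lang r (with-bits z w)
    ; recog = project
    ; sound = λ { w ρ σ R (z , x) → z , sound r _ ρ (extend z σ) (ext w ρ σ R z) x }
    ; complete = λ { w ρ σ R (z , s) → z , complete r _ ρ (extend z σ) (ext w ρ σ R z) s } }
    where
    insert : Bool → Letter a b → Letter a (suc b)
    insert z (u , v) = u , (z ∷ v)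
    open Projection insert {Lang r} (recog r)
    ext : ∀ w ρ σ → Represents w ρ σ → ∀ z → Represents (with-bits z w) ρ (extend z σ)
    ext w ρ σ (R , R′) z = R , λ { t zero l → refl ; t (suc X) (s≤s l) → R′ t X l }

-- Lists without repetition and the removal of duplicates

module Merging (em : ExcludedMiddle) where
  open Classical em
  open Recognition em
  open import Data.Maybe using (Maybe; just; nothing)
  import Data.Maybe as Maybe
  open import Data.List using (List; []; _∷_; [_]; map; length; take) renaming (_++_ to _++ᴸ_)
  open import Data.List.Properties using (map-++; length-++; ++-assoc; ++-identityʳ)
  open import Data.List.Relation.Unary.All using (All; []; _∷_)
  import Data.List.Relation.Unary.All as All
  import Data.List.Relation.Unary.All.Properties as Allₚ
  open import Data.List.Relation.Unary.Any using (here; there)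
  open import Data.List.Relation.Unary.AllPairs using ([]; _∷_)
  import Data.List.Relation.Unary.AllPairs.Properties as APₚ
  open import Data.List.Relation.Unary.Unique.Propositional using (Unique)
  open import Data.List.Membership.Propositional using (_∈_; _∉_)
  open import Data.List.Membership.Propositional.Properties using (∈-++⁻)
  open import Data.Vec using (Vec; []; _∷_)

  tails : ∀ {m} → Bool → List (Vec Bool (suc m)) → List (Vec Bool m)
  tails b [] = []
  tails true  ((true ∷ v) ∷ xs)  = v ∷ tails true xs
  tails true  ((false ∷ v) ∷ xs) = tails true xs
  tails false ((true ∷ v) ∷ xs)  = tails false xs
  tails false ((false ∷ v) ∷ xs) = v ∷ tails false xs

  length-tails : ∀ {m} (xs : List (Vec Bool (suc m))) →
      length xs ≡ length (tails true xs) + length (tails false xs)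
  length-tails [] = refl
  length-tails ((true ∷ v) ∷ xs)  = cong suc (length-tails xs)
  length-tails ((false ∷ v) ∷ xs) = trans (cong suc (length-tails xs)) (sym (+-suc (length (tails true xs)) _))

  tails-≢ : ∀ {m} b (v : Vec Bool m) xs → All (b ∷ v ≢_) xs → All (v ≢_) (tails b xs)
  tails-≢ b v [] [] = []
  tails-≢ true  v ((true ∷ u) ∷ xs)  (d ∷ ds) = (λ { refl → d refl }) ∷ tails-≢ true v xs ds
  tails-≢ true  v ((false ∷ u) ∷ xs) (d ∷ ds) = tails-≢ true v xs ds
  tails-≢ false v ((true ∷ u) ∷ xs)  (d ∷ ds) = tails-≢ false v xs ds
  tails-≢ false v ((false ∷ u) ∷ xs) (d ∷ ds) = (λ { refl → d refl }) ∷ tails-≢ false v xs ds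

  tails-unique : ∀ {m} b (xs : List (Vec Bool (suc m))) → Unique xs → Unique (tails b xs)
  tails-unique b [] [] = []
  tails-unique true  ((true ∷ v) ∷ xs)  (d ∷ u) = tails-≢ true v xs d ∷ tails-unique true xs u
  tails-unique true  ((false ∷ v) ∷ xs) (d ∷ u) = tails-unique true xs u
  tails-unique false ((true ∷ v) ∷ xs)  (d ∷ u) = tails-unique false xs u
  tails-unique false ((false ∷ v) ∷ xs) (d ∷ u) = tails-≢ false v xs d ∷ tails-unique false xs u

  -- Induction on `m`: sorting by the first bit gives two lists of tails, each again without
  -- repetition.
  unique-length : ∀ m (xs : List (Vec Bool m)) → Unique xs → length xs ≤ size m
  unique-length zero    []               u = z≤n
  unique-length zero    (x ∷ [])         u = s≤s z≤n
  unique-length zero    ([] ∷ [] ∷ xs) ((d ∷ _) ∷ _) = ⊥-elim (d refl)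
  unique-length (suc m) xs u = ≤-trans (≤-reflexive (length-tails xs))
    (+-mono-≤ (unique-length m _ (tails-unique true xs u)) (unique-length m _ (tails-unique false xs u)))

  nth : ∀ {X : Set} → X → List X → ℕ → X
  nth d []       r       = d
  nth d (x ∷ xs) zero    = x
  nth d (x ∷ xs) (suc r) = nth d xs r

  nth-map : ∀ {X Y : Set} d e (f : X → Y) xs r → r < length xs → nth e (map f xs) r ≡ f (nth d xs r)
  nth-map d e f (x ∷ xs) zero    l = refl
  nth-map d e f (x ∷ xs) (suc r) (s≤s l) = nth-map d e f xs r l

  nth-++ : ∀ {X : Set} (d : X) xs ys r → r < length xs → nth d (xs ++ᴸ ys) r ≡ nth d xs r
  nth-++ d (x ∷ xs) ys zero    l = refl
  nth-++ d (x ∷ xs) ys (suc r) (s≤s l) = nth-++ d xs ys r l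

  nth-take : ∀ {X : Set} (d : X) xs r → nth d (take (suc r) xs) r ≡ nth d xs r
  nth-take d []       r       = refl
  nth-take d (x ∷ xs) zero    = refl
  nth-take d (x ∷ xs) (suc r) = nth-take d xs r

  take-++-≤ : ∀ {X : Set} k (xs ys : List X) → k ≤ length xs → take k (xs ++ᴸ ys) ≡ take k xs
  take-++-≤ zero    xs       ys l = refl
  take-++-≤ (suc k) (x ∷ xs) ys (s≤s l) = cong (x ∷_) (take-++-≤ k xs ys l)

  length-take : ∀ {X : Set} k (xs : List X) → k ≤ length xs → length (take k xs) ≡ k
  length-take zero    xs       l = refl
  length-take (suc k) (x ∷ xs) (s≤s l) = cong suc (length-take k xs l)

  take-length : ∀ {X : Set} k (xs : List X) → length (take k xs) ≤ length xs
  take-length zero    xs = z≤n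
  take-length (suc k) [] = z≤n
  take-length (suc k) (x ∷ xs) = s≤s (take-length k xs)

  module Dedupe {Q : Set} (_≟Q_ : ∀ (p q : Q) → Dec (p ≡ q)) where
    find : ∀ {X : Set} → (X → Q) → Q → List X → Maybe ℕ
    find key q [] = nothing
    find key q (x ∷ xs) with key x ≟Q q
    ... | yes _ = just 0
    ... | no  _ = Maybe.map suc (find key q xs)

    -- The second component lists the removed elements, each with the rank in the first
    -- component of the element that it duplicates.
    dedupe : ∀ {X : Set} → (X → Q) → List X → List X → List X × List (ℕ × X)
    dedupe key kept [] = kept , []
    dedupe key kept (x ∷ xs) with find key (key x) kept
    ... | just r  = proj₁ (dedupe key kept xs) , (r , x) ∷ proj₂ (dedupe key kept xs)
    ... | nothing = dedupe key (kept ++ᴸ [ x ]) xs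

    find-map : ∀ {X Y : Set} (f : X → Y) key q xs → find key q (map f xs) ≡ find (key ∘ f) q xs
    find-map f key q [] = refl
    find-map f key q (x ∷ xs) with key (f x) ≟Q q
    ... | yes _ = refl
    ... | no  _ = cong (Maybe.map suc) (find-map f key q xs)

    tag : ∀ {X Y : Set} → (X → Y) → ℕ × X → ℕ × Y
    tag f (r , x) = r , f x

    -- Naturality. The automaton compares pairs of a state and a snapshot, whereas the analysis
    -- compares birth times, which no finite automaton can store; this identifies the two
    -- computations.
    dedupe-map : ∀ {X Y : Set} (f : X → Y) key kept xs →
      dedupe key (map f kept) (map f xs) ≡
        (map f (proj₁ (dedupe (key ∘ f) kept xs)) , map (tag f) (proj₂ (dedupe (key ∘ f) kept xs)))
    dedupe-map f key kept [] = refl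
    dedupe-map f key kept (x ∷ xs) rewrite find-map f key (key (f x)) kept with find (key ∘ f) (key (f x)) kept
    ... | just r  rewrite dedupe-map f key kept xs = refl
    ... | nothing rewrite sym (map-++ f kept [ x ]) = dedupe-map f key (kept ++ᴸ [ x ]) xs

    find-just : ∀ {X : Set} (d : X) key q xs {r} → find key q xs ≡ just r → r < length xs × key (nth d xs r) ≡ q
    find-just d key q (x ∷ xs) e with key x ≟Q q
    find-just d key q (x ∷ xs) refl | yes k = s≤s z≤n , k
    find-just d key q (x ∷ xs) e | no _ with find key q xs in eq
    find-just d key q (x ∷ xs) refl | no _ | just r with find-just d key q xs eq
    ... | l , k = s≤s l , k

    find-nothing : ∀ {X : Set} key q (xs : List X) → find key q xs ≡ nothing → All (λ x → key x ≢ q) xs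
    find-nothing key q [] e = []
    find-nothing key q (x ∷ xs) e with key x ≟Q q
    find-nothing key q (x ∷ xs) e | no n with find key q xs in eq
    find-nothing key q (x ∷ xs) e | no n | nothing = n ∷ find-nothing key q xs eq

    module _ {X : Set} (d : X) (key : X → Q) where
      dedupe-prefix : ∀ kept xs → Σ (List X) λ ys → proj₁ (dedupe key kept xs) ≡ kept ++ᴸ ys
      dedupe-prefix kept [] = [] , sym (++-identityʳ kept)
      dedupe-prefix kept (x ∷ xs) with find key (key x) kept
      ... | just r  = dedupe-prefix kept xs
      ... | nothing with dedupe-prefix (kept ++ᴸ [ x ]) xs
      ... | ys , e = x ∷ ys , trans e (++-assoc kept [ x ] ys)

      dedupe-event : ∀ kept xs r x → (r , x) ∈ proj₂ (dedupe key kept xs) →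
        r < length (proj₁ (dedupe key kept xs)) × key (nth d (proj₁ (dedupe key kept xs)) r) ≡ key x × x ∈ xs
      dedupe-event kept (y ∷ xs) r x i with find key (key y) kept in eq
      dedupe-event kept (y ∷ xs) r x (here refl) | just _ with find-just d key (key y) kept eq
          | dedupe-prefix kept xs
      ... | l , k | ys , e rewrite e =
        <-≤-trans l (≤-trans (m≤m+n _ _) (≤-reflexive (sym (length-++ kept)))) ,
            trans (cong key (nth-++ d kept ys r l)) k , here refl
      dedupe-event kept (y ∷ xs) r x (there i) | just _ with dedupe-event kept xs r x i
      ... | a , b , c = a , b , there c
      dedupe-event kept (y ∷ xs) r x i | nothing with dedupe-event (kept ++ᴸ [ y ]) xs r x i
      ... | a , b , c = a , b , there c

      dedupe-none : ∀ kept xs → proj₂ (dedupe key kept xs) ≡ [] → proj₁ (dedupe key kept xs) ≡ kept ++ᴸ xs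
      dedupe-none kept [] e = sym (++-identityʳ kept)
      dedupe-none kept (x ∷ xs) e with find key (key x) kept
      ... | nothing = trans (dedupe-none (kept ++ᴸ [ x ]) xs e) (++-assoc kept [ x ] xs)

      -- When an element is dropped in favour of one of rank at least `k`, more than `k` elements
      -- have already been kept, so the first `k + 1` positions are settled.
      dedupe-take : ∀ k kept xs → (∀ r x → (r , x) ∈ proj₂ (dedupe key kept xs) → k ≤ r) →
        take (suc k) (proj₁ (dedupe key kept xs)) ≡ take (suc k) (kept ++ᴸ xs)
      dedupe-take k kept [] h = cong (take (suc k)) (sym (++-identityʳ kept))
      dedupe-take k kept (x ∷ xs) h with find key (key x) kept in eq
      ... | nothing = trans (dedupe-take k (kept ++ᴸ [ x ]) xs h) (cong (take (suc k)) (++-assoc kept [ x ] xs))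
      ... | just r with dedupe-prefix kept xs
      ... | ys , e rewrite e = trans (take-++-≤ (suc k) kept ys l) (sym (take-++-≤ (suc k) kept (x ∷ xs) l))
        where
        l : suc k ≤ length kept
        l = ≤-trans (s≤s (h r x (here refl))) (proj₁ (find-just d key (key x) kept eq))

      snoc-unique : ∀ {Y : Set} (ys : List Y) y → Unique ys → All (_≢ y) ys → Unique (ys ++ᴸ [ y ])
      snoc-unique ys y u a = APₚ.++⁺ u ([] ∷ []) (All.map (λ d → d ∷ []) a)

      dedupe-unique : ∀ kept xs → Unique (map key kept) → Unique (map key (proj₁ (dedupe key kept xs)))
      dedupe-unique kept [] u = u
      dedupe-unique kept (x ∷ xs) u with find key (key x) kept in eq
      ... | just r  = dedupe-unique kept xs u
      ... | nothing = dedupe-unique (kept ++ᴸ [ x ]) xs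
        (subst Unique (sym (map-++ key kept [ x ]))
            (snoc-unique _ _ u (Allₚ.map⁺ (find-nothing key (key x) kept eq))))

      dedupe-∈ : ∀ kept xs {x} → x ∈ proj₁ (dedupe key kept xs) → x ∈ kept ⊎ x ∈ xs
      dedupe-∈ kept [] i = inj₁ i
      dedupe-∈ kept (y ∷ xs) i with find key (key y) kept
      dedupe-∈ kept (y ∷ xs) i | just r with dedupe-∈ kept xs i
      ... | inj₁ j = inj₁ j
      ... | inj₂ j = inj₂ (there j)
      dedupe-∈ kept (y ∷ xs) i | nothing with dedupe-∈ (kept ++ᴸ [ y ]) xs i
      ... | inj₂ j = inj₂ (there j)
      ... | inj₁ j with ∈-++⁻ kept j
      ...   | inj₁ a = inj₁ a
      ...   | inj₂ (here refl) = inj₂ (here refl)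

      -- Distinctness matters: a second copy of a kept element would be dropped and yet remain in
      -- the list.
      dedupe-gone : ∀ kept xs → Unique xs → (∀ {x} → x ∈ kept → x ∉ xs) → ∀ r x →
        (r , x) ∈ proj₂ (dedupe key kept xs) → x ∉ proj₁ (dedupe key kept xs)
      dedupe-gone kept (y ∷ xs) (a ∷ u) dj r x i j with find key (key y) kept
      dedupe-gone kept (y ∷ xs) (a ∷ u) dj r x (here refl) j | just _ with dedupe-∈ kept xs j
      ... | inj₁ k = dj k (here refl)
      ... | inj₂ k = All.lookup a k refl
      dedupe-gone kept (y ∷ xs) (a ∷ u) dj r x (there i) j | just _ =
        dedupe-gone kept xs u (λ p q → dj p (there q)) r x i j
      dedupe-gone kept (y ∷ xs) (a ∷ u) dj r x i j | nothing = dedupe-gone (kept ++ᴸ [ y ]) xs u dj′ r x i j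
        where
        dj′ : ∀ {z} → z ∈ kept ++ᴸ [ y ] → z ∉ xs
        dj′ p q with ∈-++⁻ kept p
        ... | inj₁ p′ = dj p′ (there q)
        ... | inj₂ (here refl) = All.lookup a q refl

  -- Acceptance is 0 because an even limit inferior accepts.
  bit : Bool → ℕ
  bit true  = 0
  bit false = 1

  even-double : ∀ r → even (r + r) ≡ true
  even-double zero = refl
  even-double (suc r) rewrite +-suc r r | even-double r = refl

  even-code : ∀ r b → even (r + r + bit b) ≡ b
  even-code r true  rewrite +-identityʳ (r + r) = even-double r
  even-code r false rewrite +-comm (r + r) 1 | even-double r = refl

  code-rank : ∀ {r s b c} → r + r + bit b ≤ s + s + bit c → r ≤ s
  code-rank {r} {s} {b} {c} l = ≮⇒≥ λ s<r → <⇒≱ (lt s<r) l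
    where
    bit≤1 : ∀ c → bit c ≤ 1
    bit≤1 true  = z≤n
    bit≤1 false = s≤s z≤n
    lt : s < r → s + s + bit c < r + r + bit b
    lt s<r = ≤-trans (s≤s (≤-trans (+-monoʳ-≤ (s + s) (bit≤1 c)) (≤-reflexive (+-comm (s + s) 1))))
               (≤-trans (≤-trans (≤-reflexive (cong suc (sym (+-suc s s)))) (+-mono-≤ s<r s<r))
                   (m≤m+n (r + r) (bit b)))

-- Determinisation by merging threads

module ThreadAutomaton (em : ExcludedMiddle) where
  open Classical em
  open Recognition em
  open Merging em
  open import Data.List using (List; []; _∷_; [_]; map; length; take) renaming (_++_ to _++ᴸ_)
  open import Data.List.Properties using (map-++; length-++; length-map; map-∘; map-cong-local)
  open import Data.List.Relation.Unary.All using (All; []; _∷_)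
  import Data.List.Relation.Unary.All as All
  import Data.List.Relation.Unary.All.Properties as Allₚ
  open import Data.List.Relation.Unary.Any using (here; there)
  open import Data.List.Relation.Unary.AllPairs using ([]; _∷_)
  import Data.List.Relation.Unary.AllPairs as AP
  import Data.List.Relation.Unary.AllPairs.Properties as APₚ
  open import Data.List.Relation.Unary.Unique.Propositional using (Unique)
  open import Data.List.Membership.Propositional using (_∈_; _∉_)
  open import Data.List.Membership.Propositional.Properties using (∈-++⁻)
  open import Data.Vec using (Vec; []; _∷_)
  open import Data.Vec.Properties using (≡-dec)

  module Threads {S : Set} {L : (ℕ → S) → Set} (R : Recogniser L) where
    open Recogniser R
    Q : Set
    Q = Vec Bool bits
    open Dedupe {Q} (≡-dec Data.Bool._≟_)

    Pattern : Q → Q → (ℕ → S) → (ℕ → ℕ) → Set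
    Pattern s p w c = Cuts c × seg w (c 0) (c 1) ≡ s × (∀ k → seg w (c (suc k)) (c (suc (suc k))) ≡ p)

    acc : Q → Q → Bool
    acc s p = ⌊ (Σ (ℕ → S) λ w → Σ (ℕ → ℕ) λ c → Pattern s p w c × L w) ⌋

    -- All words with segment states `s`, `p`, `p`, ... agree on membership by `transfer`, so the
    -- one that `acc` asks for decides for all.
    acc-correct : ∀ s p w c → Pattern s p w c → acc s p ≡ ⌊ L w ⌋
    acc-correct s p w c (C , e , h) = ⌊⌋-cong
      (λ { (w′ , c′ , (C′ , e′ , h′) , l) → transfer w′ w c′ c C′ C
             (λ { zero → trans e′ (sym e) ; (suc k) → trans (h′ k) (sym (h k)) }) l })
      (λ l → w , c , (C , e , h) , l)

    -- The priority of a time without merges. It exceeds every event code, since at most `size bits`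
    -- threads have distinct states and ranks are therefore smaller.
    top : ℕ
    top = size bits + size bits

    -- A merge into the thread of rank r has priority 2r or 2r + 1. The types s and p of the
    -- factorisation it witnesses are read off the values that the older threads had when the
    -- two merging threads were born.
    eventCode : ℕ → List Q → List Q → ℕ
    eventCode r target merged = r + r + bit (acc (nth ι target 0) (nth ι merged r))

    priority : ∀ {X : Set} → (X → List Q) → List X → List (ℕ × X) → ℕ
    priority sn K [] = top
    priority sn K ((r , x) ∷ es) = eventCode r (nth [] (map sn K) r) (sn x) ⊓ priority sn K es

    priority-map : ∀ {X Y : Set} (f : X → Y) sn K es →
        priority sn (map f K) (map (tag f) es) ≡ priority (sn ∘ f) K es
    priority-map f sn K [] = refl
    priority-map f sn K ((r , x) ∷ es) =
      cong₂ (λ ys p → eventCode r (nth [] ys r) (sn (f x)) ⊓ p) (sym (map-∘ K)) (priority-map f sn K es)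

    priority-≤ : ∀ {X : Set} (sn : X → List Q) K es r x → (r , x) ∈ es →
        priority sn K es ≤ eventCode r (nth [] (map sn K) r) (sn x)
    priority-≤ sn K (_ ∷ es) r x (here refl) = m⊓n≤m _ _
    priority-≤ sn K (_ ∷ es) r x (there i) = ≤-trans (m⊓n≤n _ _) (priority-≤ sn K es r x i)

    priority-top : ∀ {X : Set} (sn : X → List Q) K es → priority sn K es ≤ top
    priority-top sn K [] = ≤-refl
    priority-top sn K (e ∷ es) = ≤-trans (m⊓n≤n _ _) (priority-top sn K es)

    priority-event : ∀ {X : Set} (sn : X → List Q) K es → priority sn K es < top →
      Σ ℕ λ r → Σ X λ x → (r , x) ∈ es × priority sn K es ≡ eventCode r (nth [] (map sn K) r) (sn x)
    priority-event sn K [] l = ⊥-elim (<-irrefl refl l)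
    priority-event sn K ((r , x) ∷ es) l with ⊓-sel (eventCode r (nth [] (map sn K) r) (sn x)) (priority sn K es)
    ... | inj₁ e = r , x , here refl , e
    ... | inj₂ e with priority-event sn K es (subst (_< top) e l)
    ... | r′ , x′ , i , e′ = r′ , x′ , there i , trans e e′

    -- The second component of a thread is frozen at its birth: the states of the older threads at
    -- that time, that is, the types of the segments ending there.
    Thread State : Set
    Thread = Q × List Q
    State  = List Thread × ℕ

    advance : S → Thread → Thread
    advance a (v , sn) = step v a , sn

    restart : List Thread × List (ℕ × Thread) → State
    restart (K , es) = K ++ᴸ [ ι , map proj₁ K ] , priority proj₂ K es

    next : State → S → State
    next (ts , _) a = restart (dedupe proj₁ [] (map (advance a) ts))

    first : State
    first = [ ι , [] ] , top

    module Word (w : ℕ → S) where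
      val : ℕ → ℕ → Q
      val i t = seg w i t

      val-self : ∀ i → val i i ≡ ι
      val-self i = cong (run w i) (n∸n≡0 i)

      val-suc : ∀ i t → i ≤ t → val i (suc t) ≡ step (val i t) (w t)
      val-suc i t l = trans (cong (run w i) (+-∸-assoc 1 l)) (cong (λ u → step (val i t) (w u)) (m+[n∸m]≡n l))

      val-merge : ∀ i j u → i ≤ u → j ≤ u → val i u ≡ val j u → ∀ d → val i (d + u) ≡ val j (d + u)
      val-merge i j u a b e zero    = e
      val-merge i j u a b e (suc d) = trans (val-suc i (d + u) (≤-trans a (m≤n+m u d)))
        (trans (cong (λ q → step q (w (d + u))) (val-merge i j u a b e d))
            (sym (val-suc j (d + u) (≤-trans b (m≤n+m u d)))))

      -- The birth times of the threads alive at each time, and the merges that just occurred.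
      KE : ℕ → List ℕ × List (ℕ × ℕ)
      KE zero    = [] , []
      KE (suc t) = dedupe (λ i → val i (suc t)) [] (proj₁ (KE t) ++ᴸ [ t ])

      K : ℕ → List ℕ
      K t = proj₁ (KE t)
      E : ℕ → List (ℕ × ℕ)
      E t = proj₂ (KE t)

      snap : ℕ → List Q
      snap i = map (λ j → val j i) (K i)

      π : ℕ → ℕ
      π t = priority snap (K t) (E t)

      K-< : ∀ t {x} → x ∈ K t → x < t
      K-< (suc t) i with dedupe-∈ 0 (λ i → val i (suc t)) [] (K t ++ᴸ [ t ]) i
      ... | inj₂ j with ∈-++⁻ (K t) j
      ...   | inj₁ a = m<n⇒m<1+n (K-< t a)
      ...   | inj₂ (here refl) = ≤-refl

      K-length : ∀ t → length (K t) ≤ size bits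
      K-length zero    = z≤n
      K-length (suc t) = ≤-trans (≤-reflexive (sym (length-map (λ i → val i (suc t)) (K (suc t)))))
        (unique-length bits _ (dedupe-unique 0 (λ i → val i (suc t)) [] (K t ++ᴸ [ t ]) []))

      K-unique : ∀ t → Unique (K t)
      K-unique zero    = []
      K-unique (suc t) = AP.map (λ d e → d (cong (λ i → val i (suc t)) e))
        (APₚ.map⁻ (dedupe-unique 0 (λ i → val i (suc t)) [] (K t ++ᴸ [ t ]) []))

      G-unique : ∀ t → Unique (K t ++ᴸ [ t ])
      G-unique t = snoc-unique 0 (λ i → val i t) (K t) t (K-unique t) (All.tabulate λ i → <⇒≢ (K-< t i))

      view : ℕ → ℕ → Thread
      view t i = val i t , snap i

      state : ℕ → State
      state zero    = first
      state (suc t) = next (state t) (w t)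

      G-≤ : ∀ t {i} → i ∈ K t ++ᴸ [ t ] → i ≤ t
      G-≤ t j with ∈-++⁻ (K t) j
      ... | inj₁ a = <⇒≤ (K-< t a)
      ... | inj₂ (here refl) = ≤-refl

      state≡ : ∀ t → state t ≡ (map (view t) (K t ++ᴸ [ t ]) , π t)
      state≡ zero = refl
      state≡ (suc t) rewrite state≡ t =
        trans (cong restart (trans (cong (dedupe proj₁ []) adv)
            (dedupe-map (view (suc t)) proj₁ [] (K t ++ᴸ [ t ]))))
          (cong₂ _,_ threads (priority-map (view (suc t)) proj₂ (K (suc t)) (E (suc t))))
        where
        adv : map (advance (w t)) (map (view t) (K t ++ᴸ [ t ])) ≡ map (view (suc t)) (K t ++ᴸ [ t ])
        adv = trans (sym (map-∘ (K t ++ᴸ [ t ])))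
          (map-cong-local (All.tabulate λ {i} j → cong (_, snap i) (sym (val-suc i t (G-≤ t j)))))
        threads : map (view (suc t)) (K (suc t)) ++ᴸ [ ι ,
            map proj₁ (map (view (suc t)) (K (suc t))) ] ≡ map (view (suc t)) (K (suc t) ++ᴸ [ suc t ])
        threads = trans (cong (λ x → map (view (suc t)) (K (suc t)) ++ᴸ [ x ])
            (cong₂ _,_ (sym (val-self (suc t))) (sym (map-∘ (K (suc t))))))
          (sym (map-++ (view (suc t)) (K (suc t)) [ suc t ]))

      event : ∀ t r x → (r , x) ∈ E (suc t) →
        r < length (K (suc t)) × val (nth 0 (K (suc t)) r) (suc t) ≡ val x (suc t) × x ∈ K t ++ᴸ [ t ]
      event t r x = dedupe-event 0 (λ i → val i (suc t)) [] (K t ++ᴸ [ t ]) r x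

      gone : ∀ t r x → (r , x) ∈ E (suc t) → x ∉ K (suc t)
      gone t = dedupe-gone 0 (λ i → val i (suc t)) [] (K t ++ᴸ [ t ]) (G-unique t) (λ ())

      gone-forever : ∀ u x → x < u → x ∉ K u → ∀ d → x ∉ K (d + u)
      gone-forever u x l n zero    = n
      gone-forever u x l n (suc d) i with dedupe-∈ 0 (λ i → val i (suc (d + u))) [] (K (d + u) ++ᴸ [ d + u ]) i
      ... | inj₂ j with ∈-++⁻ (K (d + u)) j
      ...   | inj₁ a = gone-forever u x l n d a
      ...   | inj₂ (here refl) = <⇒≱ l (m≤n+m u d)

      eventCode<top : ∀ t r x sn sn′ → (r , x) ∈ E (suc t) → eventCode r sn sn′ < top
      eventCode<top t r x sn sn′ i = <-≤-trans (lt (acc _ _)) (+-mono-≤ r<N r<N)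
        where
        r<N : r < size bits
        r<N = <-≤-trans (proj₁ (event t r x i)) (K-length (suc t))
        lt : ∀ b → r + r + bit b < suc r + suc r
        lt true  rewrite +-identityʳ (r + r) | +-suc r r = m<n⇒m<1+n ≤-refl
        lt false rewrite +-comm (r + r) 1 | +-suc r r = ≤-refl

      -- Without merges each time step adds a thread for good, in conflict with `K-length`; so
      -- merges recur and the limit inferior lies below `top`.
      grow : ∀ T → (∀ t → T ≤ t → E (suc t) ≡ []) → ∀ d → d ≤ length (K (d + T))
      grow T h zero    = z≤n
      grow T h (suc d) = ≤-trans (s≤s (grow T h d)) (≤-reflexive (sym
        (trans (cong length (dedupe-none 0 (λ i → val i (suc (d + T))) [] (K (d + T) ++ᴸ [ d + T ])
            (h (d + T) (m≤n+m T d))))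
          (trans (length-++ (K (d + T))) (+-comm (length (K (d + T))) 1)))))

      abstract
        μ-data : Σ ℕ λ m → Inf (λ t → π t ≡ m) × Ev (λ t → m ≤ π t)
        μ-data = liminf (suc top) π (λ t → s≤s (priority-top snap (K t) (E t)))

      μ : ℕ
      μ = proj₁ μ-data

      μ<top : μ < top
      μ<top = ≰⇒> λ top≤μ → let (T , ev) = proj₂ (proj₂ μ-data) in
        <-irrefl refl (≤-trans (grow T (λ t l → none t (≤-trans top≤μ (ev (suc t) (m≤n⇒m≤1+n l))))
            (suc (size bits))) (K-length (suc (size bits) + T)))
        where
        none : ∀ t → top ≤ π (suc t) → E (suc t) ≡ []
        none t l with E (suc t) in eq
        ... | [] = refl
        ... | (r , x) ∷ es = ⊥-elim (<⇒≱ (eventCode<top t r x (nth [] (map snap (K (suc t))) r) (snap x)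
              (subst ((r , x) ∈_) (sym eq) (here refl)))
                (≤-trans l (m⊓n≤m _ _)))

      EventAt : ℕ → ℕ → ℕ → Set
      EventAt t r x = (r , x) ∈ E (suc t) × μ ≡ eventCode r (nth [] (map snap (K (suc t))) r) (snap x)

      priority-μ : ∀ t → π (suc t) ≡ μ → Σ ℕ λ r → Σ ℕ λ x → EventAt t r x
      priority-μ t e = let (r , x , i , e′) = priority-event snap (K (suc t)) (E (suc t)) (subst (_< top) (sym e) μ<top)
        in r , x , i , trans (sym e) e′

      abstract
        minimal-events : ∀ T → Σ ℕ λ t → T ≤ t × Σ ℕ λ r → Σ ℕ λ x → EventAt t r x
        minimal-events T = go (proj₁ (proj₂ μ-data) (suc T))
          where
          go : (Σ ℕ λ t → suc T ≤ t × π t ≡ μ) → Σ ℕ λ t → T ≤ t × Σ ℕ λ r → Σ ℕ λ x → EventAt t r x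
          go (suc t , s≤s l , e) = t , l , priority-μ t e

      T₀ : ℕ
      T₀ = proj₁ (proj₂ (proj₂ μ-data))

      t₁ k : ℕ
      t₁ = proj₁ (minimal-events T₀)
      k  = proj₁ (proj₂ (proj₂ (minimal-events T₀)))

      ev₁ : Σ ℕ (EventAt t₁ k)
      ev₁ = proj₂ (proj₂ (proj₂ (minimal-events T₀)))

      rank-≥ : ∀ t → T₀ ≤ t → ∀ r x → (r , x) ∈ E (suc t) → k ≤ r
      rank-≥ t l r x i = code-rank (≤-trans (≤-reflexive (sym (proj₂ (proj₂ ev₁))))
        (≤-trans (proj₂ (proj₂ (proj₂ μ-data)) (suc t) (m≤n⇒m≤1+n l))
            (priority-≤ snap (K (suc t)) (E (suc t)) r x i)))

      rank-unique : ∀ t r x → EventAt t r x → r ≡ k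
      rank-unique t r x (_ , e) = ≤-antisym
        (code-rank (≤-reflexive (trans (sym e) (proj₂ (proj₂ ev₁)))))
        (code-rank (≤-reflexive (trans (sym (proj₂ (proj₂ ev₁))) e)))

      -- A merge into rank `r` removes a thread younger than the one of rank `r`; merges of rank at
      -- least `k` thus leave the threads up to rank `k` in place.
      stable : ∀ k T → (∀ t → T ≤ t → ∀ r x → (r , x) ∈ E (suc t) → k ≤ r) → k < length (K T) →
        ∀ d → k < length (K (d + T)) × nth 0 (K (d + T)) k ≡ nth 0 (K T) k
      stable k T h l zero    = l , refl
      stable k T h l (suc d) with stable k T h l d
      ... | l′ , e = ≤-trans (≤-reflexive (sym len)) (take-length (suc k) (K (suc (d + T)))) ,
          trans (sym (nth-take 0 (K (suc (d + T))) k))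
              (trans (cong (λ xs → nth 0 xs k) same) (trans (nth-take 0 (K (d + T)) k) e))
        where
        same : take (suc k) (K (suc (d + T))) ≡ take (suc k) (K (d + T))
        same = trans (dedupe-take 0 (λ i → val i (suc (d + T))) k [] (K (d + T) ++ᴸ [ d + T ])
            (h (d + T) (m≤n+m T d)))
          (take-++-≤ (suc k) (K (d + T)) [ d + T ] l′)
        len : length (take (suc k) (K (suc (d + T)))) ≡ suc k
        len = trans (cong length same) (length-take (suc k) (K (d + T)) l′)

      t₂ i : ℕ
      t₂ = suc t₁
      i  = nth 0 (K t₂) k

      T₀≤t₂ : T₀ ≤ t₂
      T₀≤t₂ = m≤n⇒m≤1+n (proj₁ (proj₂ (minimal-events T₀)))

      stable-i : ∀ t → t₂ ≤ t → k < length (K t) × nth 0 (K t) k ≡ i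
      stable-i t l = subst (λ u → k < length (K u) × nth 0 (K u) k ≡ i) (m∸n+n≡m l)
        (stable k t₂ (λ t l → rank-≥ t (≤-trans T₀≤t₂ l)) (proj₁ (event t₁ k _ (proj₁ (proj₂ ev₁)))) (t ∸ t₂))

      nth-∈ : ∀ (xs : List ℕ) r → r < length xs → nth 0 xs r ∈ xs
      nth-∈ (x ∷ xs) zero    l = here refl
      nth-∈ (x ∷ xs) (suc r) (s≤s l) = there (nth-∈ xs r l)

      i<t₂ : i < t₂
      i<t₂ = K-< t₂ (nth-∈ (K t₂) k (proj₁ (stable-i t₂ ≤-refl)))

      snap-head : ∀ j → nth ι (snap j) 0 ≡ val 0 j
      -- There is no older thread at time 0, and the default value `ι` of `nth` is the right one:
      -- the state after the empty word.
      snap-head zero = refl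
      snap-head (suc j) with stable 0 1 (λ _ _ _ _ _ → z≤n) (s≤s z≤n) j
      ... | l , e = trans (subst (λ u → nth ι (snap u) 0 ≡ val (nth 0 (K u) 0) u) (+-comm j 1)
            (nth-map 0 ι _ (K (j + 1)) 0 l))
        (cong (λ x → val x (suc j)) (trans (cong (λ u → nth 0 (K u) 0) (+-comm 1 j)) e))

      Merge : ℕ → Set
      Merge j = Σ ℕ λ t → t₂ ≤ j × j ≤ t × val i (suc t) ≡ val j (suc t) × μ ≡ eventCode k (snap i) (snap j)

      -- Minimal merges recur. Were the merging threads all born before a fixed time, one of them
      -- would merge infinitely often by pigeonhole; but a thread that has merged is gone for good.
      merges : Inf Merge
      merges T = ¬¬-elim λ none → never none
        where
        early : (¬ Σ ℕ λ j → T ≤ j × Merge j) → Inf (λ t → Σ ℕ λ j → j < T ⊔ t₂ × (k , j) ∈ E (suc t))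
        early none N with minimal-events (N ⊔ t₂)
        ... | t , l , r , x , ev with rank-unique t r x ev
        ... | refl = t , ≤-trans (m≤m⊔n N t₂) l , x , ≰⇒> late , proj₁ ev
          where
          t₂≤t : t₂ ≤ t
          t₂≤t = ≤-trans (m≤n⊔m N t₂) l
          st = stable-i (suc t) (m≤n⇒m≤1+n t₂≤t)
          late : ¬ (T ⊔ t₂ ≤ x)
          late h = none (x , ≤-trans (m≤m⊔n T t₂) h , t , ≤-trans (m≤n⊔m T t₂) h ,
              G-≤ t (proj₂ (proj₂ (event t k x (proj₁ ev)))) ,
            trans (cong (λ y → val y (suc t)) (sym (proj₂ st))) (proj₁ (proj₂ (event t k x (proj₁ ev)))) ,
            trans (proj₂ ev) (cong (λ sn → eventCode k sn (snap x))
                (trans (nth-map 0 [] snap (K (suc t)) k (proj₁ st)) (cong snap (proj₂ st)))))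
        never : (¬ Σ ℕ λ j → T ≤ j × Merge j) → ⊥
        never none with pigeon-ℕ (T ⊔ t₂) (early none)
        ... | j , inf with inf 0
        ... | t , _ , a with inf (suc t)
        ... | t′ , l , b with ∈-++⁻ (K t′) (proj₂ (proj₂ (event t′ k j b)))
        ...   | inj₂ (here refl) = <⇒≱ l (G-≤ t (proj₂ (proj₂ (event t k j a))))
        ...   | inj₁ c = subst (λ u → j ∉ K u) (m∸n+n≡m l)
                  (gone-forever (suc t) j (s≤s (G-≤ t (proj₂ (proj₂ (event t k j a))))) (gone t k j a)
                      (t′ ∸ suc t)) c

      abstract
        p-data : Σ Q λ p → Inf (λ j → Merge j × val i j ≡ p)
        p-data = pigeon-Vec Merge (val i) merges

      p : Q
      p = proj₁ p-data

      abstract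
        -- Each thread is chosen so late that its predecessor in the sequence has already merged
        -- into thread `i` when it is born.
        J : ℕ → Σ ℕ λ j → Merge j × val i j ≡ p
        J zero    = let (j , _ , x) = proj₂ p-data 0 in j , x
        J (suc n) = let (j , _ , x) = proj₂ p-data (suc (proj₁ (proj₁ (proj₂ (J n))))) in j , x

        J-next : ∀ n → suc (proj₁ (proj₁ (proj₂ (J n)))) ≤ proj₁ (J (suc n))
        J-next n = proj₁ (proj₂ (proj₂ p-data (suc (proj₁ (proj₁ (proj₂ (J n)))))))

      c : ℕ → ℕ
      c zero          = 0
      c (suc zero)    = i
      c (suc (suc n)) = proj₁ (J n)

      J-< : ∀ n → proj₁ (J n) < proj₁ (J (suc n))
      J-< n = ≤-trans (s≤s (proj₁ (proj₂ (proj₂ (proj₁ (proj₂ (J n))))))) (J-next n)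

      i<J : ∀ n → i < proj₁ (J n)
      i<J n = <-≤-trans i<t₂ (proj₁ (proj₂ (proj₁ (proj₂ (J n)))))

      cuts : Cuts c
      cuts = record { start = refl ; mono = mono ; unbd = λ t → suc (suc (suc t)) , far (suc t) }
        where
        mono : ∀ n → c n ≤ c (suc n)
        mono zero = z≤n
        mono (suc zero) = <⇒≤ (i<J 0)
        mono (suc (suc n)) = <⇒≤ (J-< n)
        far : ∀ n → n ≤ proj₁ (J n)
        far zero = z≤n
        far (suc n) = ≤-trans (s≤s (far n)) (J-< n)

      -- When the next thread of the sequence is born, the previous one has merged into thread `i`
      -- and shares its state; so the segment between the two births has the state that thread `i`
      -- shows there, which is `p`.
      pattern-found : Pattern (val 0 i) p w c
      pattern-found = cuts , refl , segs
        where
        segs : ∀ n → seg w (c (suc n)) (c (suc (suc n))) ≡ p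
        segs zero    = proj₂ (proj₂ (J 0))
        segs (suc n) with J n | J-next n | i<J n
        ... | j , (t , _ , j≤t , e , _) , _ | l | i<j = trans (sym (subst (λ u → val i u ≡ val j u) (m∸n+n≡m l)
                (val-merge i j (suc t) (m≤n⇒m≤1+n (≤-trans (<⇒≤ i<j) j≤t)) (m≤n⇒m≤1+n j≤t) e
                    (proj₁ (J (suc n)) ∸ suc t))))
                (proj₂ (proj₂ (J (suc n))))

      -- The two snapshots in the code of a minimal merge contain the states of the segments from 0
      -- to `i` and from `i` to `j₀`. These are the two types of the factorisation, on which `acc`
      -- decides membership.
      even-μ : even μ ≡ ⌊ L w ⌋
      even-μ = trans (cong even code≡) (trans (even-code k _)
        (trans (cong₂ acc (snap-head i) snap-p) (acc-correct (val 0 i) p w c pattern-found)))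
        where
        j₀ = proj₁ (J 0)
        m₀ = proj₁ (proj₂ (J 0))
        code≡ : μ ≡ eventCode k (snap i) (snap j₀)
        code≡ = proj₂ (proj₂ (proj₂ (proj₂ m₀)))
        st = stable-i j₀ (proj₁ (proj₂ m₀))
        snap-p : nth ι (snap j₀) k ≡ p
        snap-p = trans (nth-map 0 ι (λ j → val j j₀) (K j₀) k (proj₁ st))
            (trans (cong (λ x → val x j₀) (proj₂ st)) (proj₂ (proj₂ (J 0))))

      parity : Parity ⌊ L w ⌋ π
      parity = μ , even-μ , proj₂ μ-data

-- Deterministic parity automata with bit vectors as states

module ParityAutomata (em : ExcludedMiddle) where
  open Classical em
  open Recognition em
  open Merging em
  open ThreadAutomaton em
  open import Data.List using (List; []; _∷_; [_]; map; length) renaming (_++_ to _++ᴸ_)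
  open import Data.List.Properties using (length-++; length-map)
  open import Data.List.Relation.Unary.All using (All; []; _∷_)
  import Data.List.Relation.Unary.All as All
  import Data.List.Relation.Unary.All.Properties as Allₚ
  open import Data.Vec using (Vec; []; _∷_; _++_; take; drop; replicate)

  -- The type of thread states is infinite. Only the values satisfying `Valid`, among them all
  -- states reached on some word, have to survive encoding and decoding.
  record Coding (A : Set) : Set₁ where
    field
      Valid   : A → Set
      bits    : ℕ
      enc     : A → Vec Bool bits
      dec     : Vec Bool bits → A
      dec-enc : ∀ a → Valid a → dec (enc a) ≡ a
  open Coding

  vecᶜ : ∀ n → Coding (Vec Bool n)
  vecᶜ n = record { Valid = λ _ → ⊤ ; bits = n ; enc = λ v → v ; dec = λ v → v ; dec-enc = λ _ _ → refl }

  _×ᶜ_ : ∀ {A B} → Coding A → Coding B → Coding (A × B)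
  c ×ᶜ d = record
    { Valid = λ { (a , b) → Valid c a × Valid d b }
    ; bits = bits c + bits d
    ; enc = λ { (a , b) → enc c a ++ enc d b }
    ; dec = λ v → dec c (take (bits c) v) , dec d (drop (bits c) v)
    ; dec-enc = λ { (a , b) (x , y) → cong₂ _,_ (trans (cong (dec c) (take-++ (enc c a) _)) (dec-enc c a x))
                                                (trans (cong (dec d) (drop-++ (enc c a) _)) (dec-enc d b y)) } }

  natᶜ : ℕ → Coding ℕ
  natᶜ B = record { Valid = _≤ B ; bits = B ; enc = e B ; dec = d ; dec-enc = de B }
    where
    e : ∀ B → ℕ → Vec Bool B
    e zero    n       = []
    e (suc B) zero    = false ∷ e B 0
    e (suc B) (suc n) = true ∷ e B n
    d : ∀ {B} → Vec Bool B → ℕ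
    d []          = 0
    d (false ∷ v) = 0
    d (true ∷ v)  = suc (d v)
    de : ∀ B n → n ≤ B → d (e B n) ≡ n
    de zero    zero    l = refl
    de (suc B) zero    l = refl
    de (suc B) (suc n) (s≤s l) = cong suc (de B n l)

  listᶜ : ∀ {A} → Coding A → ℕ → Coding (List A)
  listᶜ {A} c B = record { Valid = λ xs → length xs ≤ B × All (Valid c) xs ; bits = B * suc (bits c) ; enc =
      e B ; dec = d B ; dec-enc = λ { xs (l , v) → de B xs l v } }
    where
    e : ∀ B → List A → Vec Bool (B * suc (bits c))
    e zero    xs       = []
    e (suc B) []       = replicate _ false
    e (suc B) (x ∷ xs) = (true ∷ enc c x) ++ e B xs
    d : ∀ B → Vec Bool (B * suc (bits c)) → List A
    d zero    v           = []
    d (suc B) (false ∷ v) = []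
    d (suc B) (true ∷ v)  = dec c (take (bits c) v) ∷ d B (drop (bits c) v)
    de : ∀ B xs → length xs ≤ B → All (Valid c) xs → d B (e B xs) ≡ xs
    de zero    []       l v = refl
    de (suc B) []       l v = refl
    de (suc B) (x ∷ xs) (s≤s l) (v ∷ vs) =
      cong₂ _∷_ (trans (cong (dec c) (take-++ (enc c x) (e B xs))) (dec-enc c x v))
                (trans (cong (d B) (drop-++ (enc c x) (e B xs))) (de B xs l vs))

  record Automaton (S : Set) : Set where
    field
      dim   : ℕ
      start : Vec Bool dim
      δ     : Vec Bool dim → S → Vec Bool dim
      prio  : Vec Bool dim → ℕ

    states : (ℕ → S) → ℕ → Vec Bool dim
    states w zero    = start
    states w (suc t) = δ (states w t) (w t)

  bounded : ∀ {n} (f : Vec Bool n → ℕ) → Σ ℕ λ B → ∀ v → f v < B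
  bounded {zero}  f = suc (f []) , λ { [] → ≤-refl }
  bounded {suc n} f with bounded (λ v → f (true ∷ v)) | bounded (λ v → f (false ∷ v))
  ... | B , h | B′ , h′ = B ⊔ B′ , λ { (true ∷ v) → <-≤-trans (h v) (m≤m⊔n B B′) ; (false ∷ v) →
        <-≤-trans (h′ v) (m≤n⊔m B B′) }

  Parity-cong : ∀ {b p p′} → (∀ t → p t ≡ p′ t) → Parity b p → Parity b p′
  Parity-cong e (m , x , i , (T , v)) =
    m , x , Inf-mono (λ k q → trans (sym (e k)) q) i , T , λ k l → ≤-trans (v k l) (≤-reflexive (e k))

  module Determinise {S : Set} {L : (ℕ → S) → Set} (R : Recogniser L) where
    open Threads R
    N : ℕ
    N = size (Recogniser.bits R)

    coding : Coding State
    coding = listᶜ (vecᶜ (Recogniser.bits R) ×ᶜ listᶜ (vecᶜ (Recogniser.bits R)) N) (suc N) ×ᶜ natᶜ top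

    automaton : Automaton S
    automaton = record
      { dim   = bits coding
      ; start = enc coding first
      ; δ     = λ v a → enc coding (next (dec coding v) a)
      ; prio  = λ v → proj₂ (dec coding v) }

    open Automaton automaton

    module _ (w : ℕ → S) where
      open Word w

      valid : ∀ t → Valid coding (state t)
      valid t rewrite state≡ t = (len , Allₚ.map⁺
          (All.tabulate λ {i} _ → tt , snapLen i , All.tabulate (λ _ → tt))) ,
          priority-top snap (K t) (E t)
        where
        snapLen : ∀ i → length (snap i) ≤ N
        snapLen i = ≤-trans (≤-reflexive (length-map _ (K i))) (K-length i)
        len : length (map (view t) (K t ++ᴸ [ t ])) ≤ suc N
        len = ≤-trans (≤-reflexive (trans (length-map _ (K t ++ᴸ [ t ]))
            (trans (length-++ (K t)) (+-comm (length (K t)) 1)))) (s≤s (K-length t))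

      states≡ : ∀ t → states w t ≡ enc coding (state t)
      states≡ zero    = refl
      states≡ (suc t) = cong (λ s → enc coding (next s (w t)))
          (trans (cong (dec coding) (states≡ t)) (dec-enc coding (state t) (valid t)))

      correct : Parity ⌊ L w ⌋ (λ t → prio (states w t))
      correct = Parity-cong (λ t → sym (trans (cong prio (states≡ t))
        (trans (cong proj₂ (dec-enc coding (state t) (valid t))) (cong proj₂ (state≡ t))))) parity

  slice : ∀ k → (ℕ → ℕ → Bool) → ℕ → Vec Bool k
  slice zero    σ t = []
  slice (suc k) σ t = σ 0 t ∷ slice k (λ X → σ (suc X)) t

  at-slice : ∀ k σ t X → X < k → at (slice k σ t) X ≡ σ X t
  at-slice (suc k) σ t zero    l = refl
  at-slice (suc k) σ t (suc X) (s≤s l) = at-slice k (λ X → σ (suc X)) t X l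

  fm-automaton : ∀ φ b → FOBelow 0 φ → SOBelow b φ → Σ (Automaton (Vec Bool b)) λ A →
    ∀ ρ σ → Parity ⌊ Sat ρ σ φ ⌋ (λ t → Automaton.prio A (Automaton.states A (slice b σ) t))
  fm-automaton φ b fo so = A , λ ρ σ → Parity-cong (λ t → cong prio (same σ t))
      (subst (λ x → Parity x _) (⌊⌋-cong (sound _ ρ σ (rep ρ σ)) (complete _ ρ σ (rep ρ σ)))
          (correct (λ t → [] , slice b σ t)))
    where
    open Recognised (recognise φ 0 b fo so)
    open Determinise recog
    open Automaton automaton
    A : Automaton (Vec Bool b)
    A = record { dim = dim ; start = start ; δ = λ q v → δ q ([] , v) ; prio = prio }
    same : ∀ σ t → states (λ t → [] , slice b σ t) t ≡ Automaton.states A (slice b σ) t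
    same σ zero    = refl
    same σ (suc t) = cong (λ q → δ q ([] , slice b σ t)) (same σ t)
    rep : ∀ ρ σ → Represents {0} {b} (λ t → [] , slice b σ t) ρ σ
    rep ρ σ = (λ t x ()) , λ t X l → at-slice b σ t X l

-- Positional determinacy of parity games on countable arenas

module ParityGames (em : ExcludedMiddle) (V : Set) (own : V → Bool) (succ : V → Bool → V) (pr : V → ℕ)
  (ν : ℕ → V) (ν-onto : ∀ v → Σ ℕ λ i → ν i ≡ v) where
  open Classical em

  Region Strategy : Set
  Region   = V → Bool
  Strategy = V → Bool

  infix 4 _∈_ _∉_
  _∈_ _∉_ : V → Region → Set
  v ∈ W = W v ≡ true
  v ∉ W = ¬ (v ∈ W)

  Follows : Bool → Strategy → (ℕ → V) → Set
  Follows σ f π = ∀ k → Σ Bool λ b → π (suc k) ≡ succ (π k) b × (own (π k) ≡ σ → b ≡ f (π k))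

  -- `A` is the current subgame: moves of the opponent out of `A` are disregarded, which lets the
  -- induction shrink the arena without changing `succ`.
  record WinReg (σ : Bool) (A W : Region) (f : Strategy) : Set where
    field
      sub  : ∀ v → v ∈ W → v ∈ A
      mine : ∀ v → v ∈ W → own v ≡ σ → succ v (f v) ∈ W
      his  : ∀ v → v ∈ W → own v ≢ σ → ∀ b → succ v b ∈ A → succ v b ∈ W
      win  : ∀ π → (∀ k → π k ∈ W) → Follows σ f π → Parity σ (λ k → pr (π k))
  open WinReg

  Closed : Region → Set
  Closed A = ∀ v → v ∈ A → Σ Bool λ b → succ v b ∈ A

  Follows-tail : ∀ {σ f π} T → Follows σ f π → Follows σ f (λ k → π (T + k))
  Follows-tail {π = π} T F k with F (T + k)
  ... | b , e , c = b , trans (cong π (+-suc T k)) e , c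

  eventually-constant : (i : ℕ → ℕ) → (∀ k → i (suc k) ≤ i k) → Σ ℕ λ T → ∀ k → i (T + k) ≡ i T
  eventually-constant i dec with least (λ v → Σ ℕ λ k → i k ≡ v) (i 0 , 0 , refl)
  ... | v , (T , e) , min = T , λ k → ≤-antisym (down k)
        (≤-trans (≤-reflexive e) (≮⇒≥ λ l → min _ l (T + k , refl)))
    where
    down : ∀ k → i (T + k) ≤ i T
    down zero    = ≤-reflexive (cong i (+-identityʳ T))
    down (suc k) = ≤-trans (≤-reflexive (cong i (+-suc T k))) (≤-trans (dec (T + k)) (down k))

  -- A countable family of winning regions is glued by following, at each vertex, the strategy of
  -- least index whose region contains it: along a play this index never increases.
  module Union (σ : Bool) (A : Region) (W : ℕ → Region) (f : ℕ → Strategy) (R : ∀ i → WinReg σ A (W i) (f i)) where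
    ⋃ : Region
    ⋃ v = ⌊ Σ ℕ (λ i → v ∈ W i) ⌋

    index : ∀ v → v ∈ ⋃ → Σ ℕ (Least (λ i → v ∈ W i))
    index v u = least _ (true-⌊⌋ u)

    glue : Strategy
    glue v with em (Σ ℕ (Least (λ i → v ∈ W i)))
    ... | inj₁ (i , _) = f i v
    ... | inj₂ _       = false

    glue≡ : ∀ v i → Least (λ i → v ∈ W i) i → glue v ≡ f i v
    glue≡ v i (q , l) with em (Σ ℕ (Least (λ i → v ∈ W i)))
    ... | inj₂ n = ⊥-elim (n (i , q , l))
    ... | inj₁ (j , q′ , l′) with <-cmp i j
    ...   | tri< a _ _ = ⊥-elim (l′ i a q)
    ...   | tri≈ _ refl _ = refl
    ...   | tri> _ _ a = ⊥-elim (l j a q′)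

    in⋃ : ∀ i v → v ∈ W i → v ∈ ⋃
    in⋃ i v w = ⌊⌋-true (i , w)

    region : WinReg σ A ⋃ glue
    sub region v u with index v u
    ... | i , w , _ = sub (R i) v w
    mine region v u o with index v u
    ... | i , q@(w , _) = in⋃ i _ (subst (λ b → succ v b ∈ W i) (sym (glue≡ v i q)) (mine (R i) v w o))
    his region v u o b a with index v u
    ... | i , w , _ = in⋃ i _ (his (R i) v w o b a)
    win region π inside F = Parity-tail T (win (R (ι T)) _ inTail (λ k → follow k (F (T + k))))
      where
      ι : ℕ → ℕ
      ι k = proj₁ (index (π k) (inside k))
      ιL : ∀ k → Least (λ i → π k ∈ W i) (ι k)
      ιL k = proj₂ (index (π k) (inside k))
      stay : ∀ k → π (suc k) ∈ W (ι k)
      stay k with F k | own (π k) Data.Bool.≟ σ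
      ... | b , e , c | yes o = subst (_∈ W (ι k))
            (sym (trans e (cong (succ (π k)) (trans (c o) (glue≡ _ _ (ιL k))))))
                                  (mine (R (ι k)) _ (proj₁ (ιL k)) o)
      ... | b , e , c | no o = subst (_∈ W (ι k)) (sym e)
                                  (his (R (ι k)) _ (proj₁ (ιL k)) o b (subst (_∈ A) e
                                      (sub region _ (inside (suc k)))))
      dec : ∀ k → ι (suc k) ≤ ι k
      dec k = ≮⇒≥ λ l → proj₂ (ιL (suc k)) (ι k) l (stay k)
      T = proj₁ (eventually-constant ι dec)
      const : ∀ k → ι (T + k) ≡ ι T
      const = proj₂ (eventually-constant ι dec)
      inTail : ∀ k → π (T + k) ∈ W (ι T)
      inTail k = subst (λ i → π (T + k) ∈ W i) (const k) (proj₁ (ιL (T + k)))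
      follow : ∀ k → (Σ Bool λ b → π (suc (T + k)) ≡ succ (π (T + k)) b ×
          (own (π (T + k)) ≡ σ → b ≡ glue (π (T + k)))) →
        Σ Bool λ b → π (T + suc k) ≡ succ (π (T + k)) b × (own (π (T + k)) ≡ σ → b ≡ f (ι T) (π (T + k)))
      follow k (b , e , c) = b , trans (cong π (+-suc T k)) e ,
        λ o → trans (c o) (trans (glue≡ _ _ (ιL (T + k))) (cong (λ i → f i (π (T + k))) (const k)))

  module Maximal (σ : Bool) (A : Region) where
    Candidate : V → Set
    Candidate v = Σ Region λ W → Σ Strategy λ f → WinReg σ A W f × v ∈ W

    cand : ∀ v → Candidate v ⊎ ¬ Candidate v → Σ Region λ W → Σ Strategy (WinReg σ A W)
    cand v (inj₁ (W , f , r , _)) = W , f , r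
    cand v (inj₂ _) = (λ _ → false) , (λ _ → false) , record
      { sub = λ _ () ; mine = λ _ () ; his = λ _ () ; win = λ π i → ⊥-elim (absurd (i 0)) }
      where absurd : false ≡ true → ⊥
            absurd ()

    chosen : ℕ → Σ Region λ W → Σ Strategy (WinReg σ A W)
    chosen i = cand (ν i) (em (Candidate (ν i)))

    open Union σ A (λ i → proj₁ (chosen i)) (λ i → proj₁ (proj₂ (chosen i))) (λ i → proj₂ (proj₂ (chosen i))) public

    -- One region for each vertex that lies in any suffices for the union, and `ν` makes this family
    -- countable.
    maximal : ∀ W f → WinReg σ A W f → ∀ v → v ∈ W → v ∈ ⋃
    maximal W f r v w with ν-onto v
    ... | i , refl = in⋃ i (ν i) (hit (em (Candidate (ν i))))
      where
      hit : (x : Candidate (ν i) ⊎ ¬ Candidate (ν i)) → ν i ∈ proj₁ (cand (ν i) x)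
      hit (inj₁ (_ , _ , _ , w′)) = w′
      hit (inj₂ n) = ⊥-elim (n (W , f , r , w))

  module Extension (σ : Bool) (A ⋃ : Region) (glue : Strategy) (region : WinReg σ A ⋃ glue)
    (maximal : ∀ W f → WinReg σ A W f → ∀ v → v ∈ W → v ∈ ⋃) where
    -- Together with `⋃` the set `W` is a winning region: play `f` until `⋃` is entered and `glue`
    -- from then on, as the play never leaves `⋃` again. Maximality absorbs it.
    extension : (W : Region) (f : Strategy) → (∀ v → v ∈ W → v ∈ A) →
      (∀ v → v ∈ W → v ∉ ⋃ → own v ≡ σ → succ v (f v) ∈ W ⊎ succ v (f v) ∈ ⋃) →
      (∀ v → v ∈ W → v ∉ ⋃ → own v ≢ σ → ∀ b → succ v b ∈ A → succ v b ∈ W ⊎ succ v b ∈ ⋃) →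
      (∀ π → (∀ k → π k ∈ W × π k ∉ ⋃) → Follows σ f π → Parity σ (λ k → pr (π k))) →
      ∀ v → v ∈ W → v ∈ ⋃
    extension W f W⊆A mv hs wn v w = maximal W⁺ g reg v (⌊⌋-true (inj₁ w))
      where
      W⁺ : Region
      W⁺ v = ⌊ v ∈ W ⊎ v ∈ ⋃ ⌋
      g : Strategy
      g v = if ⋃ v then glue v else f v
      g-in : ∀ v → v ∈ ⋃ → g v ≡ glue v
      g-in v u rewrite u = refl
      g-out : ∀ v → v ∉ ⋃ → g v ≡ f v
      g-out v u rewrite ¬-not u = refl
      reg : WinReg σ A W⁺ g
      sub reg v i with true-⌊⌋ i
      ... | inj₁ w = W⊆A v w
      ... | inj₂ u = sub region v u
      mine reg v i o with em (v ∈ ⋃)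
      ... | inj₁ u = ⌊⌋-true (inj₂ (subst (λ b → succ v b ∈ ⋃) (sym (g-in v u)) (mine region v u o)))
      ... | inj₂ n with true-⌊⌋ i
      ...   | inj₁ w = ⌊⌋-true (subst (λ b → succ v b ∈ W ⊎ succ v b ∈ ⋃) (sym (g-out v n)) (mv v w n o))
      ...   | inj₂ u = ⊥-elim (n u)
      his reg v i o b a with em (v ∈ ⋃)
      ... | inj₁ u = ⌊⌋-true (inj₂ (his region v u o b a))
      ... | inj₂ n with true-⌊⌋ i
      ...   | inj₁ w = ⌊⌋-true (hs v w n o b a)
      ...   | inj₂ u = ⊥-elim (n u)
      win reg π i F with em (Σ ℕ λ T → π T ∈ ⋃)
      ... | inj₁ (T , u) = Parity-tail T (win region _ stay λ k → fol k)
        where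
        stay : ∀ k → π (T + k) ∈ ⋃
        stay zero = subst (λ j → π j ∈ ⋃) (sym (+-identityʳ T)) u
        stay (suc k) = subst (λ j → π j ∈ ⋃) (sym (+-suc T k)) (step (F (T + k)) (own (π (T + k)) Data.Bool.≟ σ))
          where
          step : _ → _ → π (suc (T + k)) ∈ ⋃
          step (b , e , c) (yes o) = subst (_∈ ⋃) (sym
              (trans e (cong (succ _) (trans (c o) (g-in _ (stay k)))))) (mine region _ (stay k) o)
          step (b , e , c) (no o) = subst (_∈ ⋃) (sym e)
              (his region _ (stay k) o b (subst (_∈ A) e (sub reg _ (i (suc (T + k))))))
        fol : ∀ k → _
        fol k with Follows-tail {f = g} T F k
        ... | b , e , c = b , e , λ o → trans (c o) (g-in _ (stay k))
      ... | inj₂ n = wn π (λ k → [ k ] (true-⌊⌋ (i k)) , λ u → n (k , u))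
                       λ k → proj₁ (F k) , proj₁ (proj₂ (F k)) , λ o →
                           trans (proj₂ (proj₂ (F k)) o) (g-out _ λ u → n (k , u))
        where
        [_] : ∀ k → π k ∈ W ⊎ π k ∈ ⋃ → π k ∈ W
        [ k ] (inj₁ w) = w
        [ k ] (inj₂ u) = ⊥-elim (n (k , u))

  Determined : Region → Set
  Determined A = Σ (Bool → Region) λ W → Σ (Bool → Strategy) λ f →
    (∀ σ → WinReg σ A (W σ) (f σ)) × (∀ v → v ∈ A → v ∈ W true ⊎ v ∈ W false)

  pick : ∀ {X : Set} → Bool → X → X → Bool → X
  pick true  a b true  = a
  pick true  a b false = b
  pick false a b false = a
  pick false a b true  = b

  pick-elim : ∀ {A} σ {W W′ f f′} → WinReg σ A W f → WinReg (not σ) A W′ f′ →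
    ∀ τ → WinReg τ A (pick σ W W′ τ) (pick σ f f′ τ)
  pick-elim true  r r′ true  = r
  pick-elim true  r r′ false = r′
  pick-elim false r r′ false = r
  pick-elim false r r′ true  = r′

  pick-cover : ∀ σ {W W′ : Region} v → v ∈ W ⊎ v ∈ W′ → v ∈ pick σ W W′ true ⊎ v ∈ pick σ W W′ false
  pick-cover true  v c = c
  pick-cover false v (inj₁ w) = inj₂ w
  pick-cover false v (inj₂ w) = inj₁ w

  un-pick : ∀ σ {W : Bool → Region} v → v ∈ W true ⊎ v ∈ W false → v ∈ W σ ⊎ v ∈ W (not σ)
  un-pick true  v c = c
  un-pick false v (inj₁ w) = inj₂ w
  un-pick false v (inj₂ w) = inj₁ w

  -- Induction on the number of priorities, where `σ` is the player favoured by the least one, `m`.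
  -- Remove from `A` all that the opponent wins, leaving `A′`, and from this what `σ` can attract to
  -- priority `m`, leaving `Z` with one priority fewer. The opponent wins nothing in `Z`. So `σ`
  -- wins all of `A′`, attracting to `m` outside `Z` and playing the strategy for `Z` inside: either
  -- `m` recurs, or the play finally stays in `Z`.
  module Step (m n : ℕ) (IH : ∀ A → Closed A → (∀ v → v ∈ A → suc m ≤ pr v × pr v < suc m + n) → Determined A)
    (A : Region) (closed : Closed A) (bounds : ∀ v → v ∈ A → m ≤ pr v × pr v < m + suc n)
    (⋃ : Region) (glue : Strategy) (region : WinReg (not (even m)) A ⋃ glue)
    (maximal : ∀ W f → WinReg (not (even m)) A W f → ∀ v → v ∈ W → v ∈ ⋃) where

    σ = even m
    open Extension (not σ) A ⋃ glue region maximal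

    A′ : Region
    A′ v = ⌊ v ∈ A × v ∉ ⋃ ⌋

    opp : ∀ {v} → own v ≢ not σ → own v ≡ σ
    opp {v} d with own v | σ
    ... | true  | true  = refl
    ... | false | false = refl
    ... | true  | false = ⊥-elim (d refl)
    ... | false | true  = ⊥-elim (d refl)

    opp′ : ∀ {v} → own v ≢ σ → own v ≡ not σ
    opp′ {v} d with own v | σ
    ... | true  | false = refl
    ... | false | true = refl
    ... | true  | true = ⊥-elim (d refl)
    ... | false | false  = ⊥-elim (d refl)

    Pre : V → Set
    Pre v = v ∈ A × v ∉ ⋃ ×
      ((own v ≡ not σ × Σ Bool λ b → succ v b ∈ ⋃) ⊎ (own v ≢ not σ × ∀ b → succ v b ∈ A → succ v b ∈ ⋃))

    Pre⊥ : ∀ v → ¬ Pre v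
    Pre⊥ v p@(_ , n , _) = n (extension (λ v → ⌊ Pre v ⌋) g (λ v i → proj₁ (true-⌊⌋ i))
        (λ v i _ o → inj₂ (mv v (true-⌊⌋ i) o))
        (λ v i _ o b a → inj₂ (hs v (true-⌊⌋ i) o b a))
        -- The winning condition is vacuous: the very first move leads into `⋃`, so no play stays
        -- outside it.
        (λ π i F → ⊥-elim (proj₂ (i 1) (esc π (true-⌊⌋ (proj₁ (i 0))) (F 0) (true-⌊⌋ (proj₁ (i 1))))))
        v (⌊⌋-true p))
      where
      g : Strategy
      g v with em (Σ Bool λ b → succ v b ∈ ⋃)
      ... | inj₁ (b , _) = b
      ... | inj₂ _ = false
      mv : ∀ v → Pre v → own v ≡ not σ → succ v (g v) ∈ ⋃
      mv v (_ , _ , inj₂ (o , _)) o′ = ⊥-elim (o o′)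
      mv v (_ , _ , inj₁ (_ , x)) o with em (Σ Bool λ b → succ v b ∈ ⋃)
      ... | inj₁ (_ , u) = u
      ... | inj₂ n = ⊥-elim (n x)
      hs : ∀ v → Pre v → own v ≢ not σ → ∀ b → succ v b ∈ A → succ v b ∈ ⋃
      hs v (_ , _ , inj₁ (o , _)) o′ = ⊥-elim (o′ o)
      hs v (_ , _ , inj₂ (_ , x)) o = x
      esc : ∀ π → Pre (π 0) → (Σ Bool λ b → π 1 ≡ succ (π 0) b × (own (π 0) ≡ not σ → b ≡ g (π 0))) →
          Pre (π 1) → π 1 ∈ ⋃
      esc π p (b , e , c) q with own (π 0) Data.Bool.≟ not σ
      ... | yes o = subst (_∈ ⋃) (sym (trans e (cong (succ _) (c o)))) (mv _ p o)
      ... | no  o = subst (_∈ ⋃) (sym e) (hs _ p o b (subst (_∈ A) e (proj₁ q)))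

    A′-his : ∀ v → v ∈ A′ → own v ≢ σ → ∀ b → succ v b ∈ A → succ v b ∈ A′
    A′-his v i o b a = ⌊⌋-true (a , λ u → Pre⊥ v (proj₁ (true-⌊⌋ i) , proj₂ (true-⌊⌋ i) , inj₁ (opp′ o , b , u)))

    A′-mine : ∀ v → v ∈ A′ → own v ≡ σ → Σ Bool λ b → succ v b ∈ A′
    A′-mine v i o = ¬¬-elim λ none → Pre⊥ v (proj₁ (true-⌊⌋ i) , proj₂ (true-⌊⌋ i) ,
      inj₂ ((λ o′ → not-¬ refl (trans (sym o) o′)) ,
            λ b a → ¬¬-elim λ nu → none (b , ⌊⌋-true (a , nu))))

    -- The stages of the attractor of `σ` towards priority `m`, within `A′`.
    Att : ℕ → V → Set
    Att zero    v = pr v ≡ m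
    Att (suc r) v = Att r v ⊎ (own v ≡ σ × Σ Bool λ b → succ v b ∈ A′ × Att r (succ v b))
                            ⊎ (own v ≢ σ × ∀ b → succ v b ∈ A′ → Att r (succ v b))

    Att-+ : ∀ r s v → Att r v → Att (s + r) v
    Att-+ r zero    v a = a
    Att-+ r (suc s) v a = inj₁ (Att-+ r s v a)

    Att-≤ : ∀ {r s} v → r ≤ s → Att r v → Att s v
    Att-≤ {r} {s} v l a = subst (λ t → Att t v) (m∸n+n≡m l) (Att-+ r _ v a)

    Z : Region
    Z v = ⌊ v ∈ A′ × ¬ Σ ℕ (λ r → Att r v) ⌋

    Z⊆A′ : ∀ v → v ∈ Z → v ∈ A′
    Z⊆A′ v z = proj₁ (true-⌊⌋ z)

    Z⊆A : ∀ v → v ∈ Z → v ∈ A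
    Z⊆A v z = proj₁ (true-⌊⌋ (Z⊆A′ v z))

    Z-mine : ∀ v → v ∈ Z → own v ≡ σ → ∀ b → succ v b ∈ A′ → succ v b ∈ Z
    Z-mine v z o b a = ⌊⌋-true (a , λ { (r , x) → proj₂ (true-⌊⌋ z) (suc r , inj₂ (inj₁ (o , b , a , x))) })

    -- With two successors their ranks have a maximum, so finite stages suffice for the attractor:
    -- if both successors were attracted, the vertex would be too.
    Z-his : ∀ v → v ∈ Z → own v ≢ σ → Σ Bool λ b → succ v b ∈ Z
    Z-his v z o = ¬¬-elim λ none → let at = λ b a → ¬¬-elim {Σ ℕ λ r → Att r (succ v b)} λ nr → none (b , ⌊⌋-true (a , nr)) in
      proj₂ (true-⌊⌋ z) (both (λ a → at true a) (λ a → at false a))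
      where
      rank : ∀ b → (succ v b ∈ A′ → Σ ℕ λ r → Att r (succ v b)) → Σ ℕ λ r → succ v b ∈ A′ → Att r (succ v b)
      rank b h with em (succ v b ∈ A′)
      ... | inj₁ a = proj₁ (h a) , λ _ → proj₂ (h a)
      ... | inj₂ n = 0 , λ a → ⊥-elim (n a)
      both : (succ v true ∈ A′ → Σ ℕ λ r → Att r (succ v true)) →
          (succ v false ∈ A′ → Σ ℕ λ r → Att r (succ v false)) →
        Σ ℕ λ r → Att r v
      both f g with rank true f | rank false g
      ... | r , x | s , y = suc (r ⊔ s) , inj₂ (inj₂ (o , λ { true  a → Att-≤ _ (m≤m⊔n r s) (x a)
                                                           ; false a → Att-≤ _ (m≤n⊔m r s) (y a) }))

    Z-closed : Closed Z
    Z-closed v z with own v Data.Bool.≟ σ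
    ... | yes o = let (b , a) = A′-mine v (Z⊆A′ v z) o in b , Z-mine v z o b a
    ... | no  o = Z-his v z o

    Z-bounds : ∀ v → v ∈ Z → suc m ≤ pr v × pr v < suc m + n
    Z-bounds v z = ≤∧≢⇒< (proj₁ bd) (λ e → proj₂ (true-⌊⌋ z) (0 , sym e)) ,
                   subst (pr v <_) (+-suc m n) (proj₂ bd)
      where bd = bounds v (Z⊆A v z)

    D = IH Z Z-closed Z-bounds
    WZ = proj₁ D
    fZ = proj₁ (proj₂ D)
    RZ : ∀ τ → WinReg τ Z (WZ τ) (fZ τ)
    RZ = proj₁ (proj₂ (proj₂ D))

    -- From `Z` the player `σ` can move only within `Z` or into `⋃`, so what the opponent wins in
    -- `Z` is won in `A` as well. By `extension` it lies in `⋃`, which `Z` avoids.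
    lost⊥ : ∀ v → ¬ (v ∈ WZ (not σ))
    lost⊥ v w = proj₂ (true-⌊⌋ (Z⊆A′ v (sub R v w))) (extension (WZ (not σ)) (fZ (not σ))
      (λ v w → Z⊆A v (sub R v w))
      (λ v w _ o → inj₁ (mine R v w o))
      hs
      (λ π i F → win R π (λ k → proj₁ (i k)) F)
      v w)
      where
      R = RZ (not σ)
      hs : ∀ v → v ∈ WZ (not σ) → v ∉ ⋃ → own v ≢ not σ → ∀ b → succ v b ∈ A →
          succ v b ∈ WZ (not σ) ⊎ succ v b ∈ ⋃
      hs v w _ o b a with em (succ v b ∈ ⋃)
      ... | inj₁ u = inj₂ u
      ... | inj₂ n = inj₁ (his R v w o b (Z-mine v (sub R v w) (opp o) b (⌊⌋-true (a , n))))

    Z⊆WZ : ∀ v → v ∈ Z → v ∈ WZ σ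
    Z⊆WZ v z with un-pick σ {WZ} v (proj₂ (proj₂ (proj₂ D)) v z)
    ... | inj₁ w = w
    ... | inj₂ w = ⊥-elim (lost⊥ v w)

    -- Inside Z follow the strategy for Z; elsewhere decrease the attractor rank.
    Good : V → Bool → Set
    Good v b = (v ∈ Z × b ≡ fZ σ v) ⊎ (v ∉ Z × succ v b ∈ A′ ×
        (∀ r → Att (suc r) v → ¬ Att r v → Att r (succ v b)))

    good : ∀ v → v ∈ A′ → own v ≡ σ → Σ Bool (Good v)
    good v a o with em (v ∈ Z)
    ... | inj₁ z = fZ σ v , inj₁ (z , refl)
    ... | inj₂ n with least (λ r → Att r v) (¬¬-elim λ na → n (⌊⌋-true (a , na)))
    ...   | zero , x , _ = let (b , a′) = A′-mine v a o in b , inj₂ (n , a′ , λ r _ nr → ⊥-elim (nr (Att-≤ v z≤n x)))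
    ...   | suc r , inj₁ x , l = ⊥-elim (l r ≤-refl x)
    ...   | suc r , inj₂ (inj₂ (o′ , _)) , l = ⊥-elim (o′ o)
    ...   | suc r , inj₂ (inj₁ (_ , b , a′ , x)) , l = b ,
          inj₂ (n , a′ , λ s y ny → Att-≤ _ (≮⇒≥ λ s<r → l s (m<n⇒m<1+n s<r) (⊥-elim (l (suc s) (s≤s s<r) y))) x)

    g : Strategy
    g v with em (Σ Bool (Good v))
    ... | inj₁ (b , _) = b
    ... | inj₂ _ = false

    g-good : ∀ v → v ∈ A′ → own v ≡ σ → Good v (g v)
    g-good v a o with em (Σ Bool (Good v))
    ... | inj₁ (_ , x) = x
    ... | inj₂ n = ⊥-elim (n (good v a o))

    reg : WinReg σ A A′ g
    sub reg v a = proj₁ (true-⌊⌋ a)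
    mine reg v a o with g-good v a o
    ... | inj₁ (z , e) = Z⊆A′ _ (sub (RZ σ) _
          (subst (λ b → succ v b ∈ WZ σ) (sym e) (mine (RZ σ) v (Z⊆WZ v z) o)))
    ... | inj₂ (_ , x , _) = x
    his reg = A′-his
    win reg π i F with em (Inf (λ k → pr (π k) ≡ m))
    ... | inj₁ inf = m , refl , inf , 0 , λ k _ → proj₁ (bounds _ (sub reg _ (i k)))
    ... | inj₂ fin = tailwin (¬Inf⇒Ev fin)
      where
      tailwin : Ev (λ k → pr (π k) ≢ m) → Parity σ (λ k → pr (π k))
      tailwin (T , ev) = Parity-tail T (win (RZ σ) (λ k → π (T + k)) (λ k → Z⊆WZ _ (inZ k)) fol)
        where
        -- Induction on the rank: each move from an attracted vertex lowers it, so the play would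
        -- meet priority `m` after finitely many moves, yet `m` no longer occurs after `T`.
        noAtt : ∀ r k → T ≤ k → ¬ Att r (π k)
        noAtt zero    k l a = ev k l a
        noAtt (suc r) k l a = noAtt r (suc k) (≤-trans l (n≤1+n k)) (next (F k) a)
          where
          next : (Σ Bool λ b → π (suc k) ≡ succ (π k) b × (own (π k) ≡ σ → b ≡ g (π k))) →
              Att (suc r) (π k) → Att r (π (suc k))
          next (b , e , c) (inj₁ x) = ⊥-elim (noAtt r k l x)
          next (b , e , c) (inj₂ (inj₂ (o , x))) = subst (Att r) (sym e) (x b (subst (_∈ A′) e (i (suc k))))
          next (b , e , c) a@(inj₂ (inj₁ (o , _))) with g-good (π k) (i k) o
          ... | inj₁ (z , _) = ⊥-elim (proj₂ (true-⌊⌋ z) (suc r , a))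
          ... | inj₂ (_ , _ , d) = subst (Att r) (sym (trans e (cong (succ _) (c o)))) (d r a (noAtt r k l))
        inZ : ∀ k → π (T + k) ∈ Z
        inZ k = ⌊⌋-true (i (T + k) , λ { (r , a) → noAtt r (T + k) (m≤m+n T k) a })
        fol : Follows σ (fZ σ) (λ k → π (T + k))
        fol k with Follows-tail {f = g} T F k
        ... | b , e , c = b , e , λ o → trans (c o) (isZ o)
          where
          isZ : own (π (T + k)) ≡ σ → g (π (T + k)) ≡ fZ σ (π (T + k))
          isZ o with g-good (π (T + k)) (i (T + k)) o
          ... | inj₁ (_ , e) = e
          ... | inj₂ (n , _) = ⊥-elim (n (inZ k))

    determined : Determined A
    determined = pick σ A′ ⋃ , pick σ g glue , pick-elim σ reg region ,
      λ v a → pick-cover σ v (cover v a)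
      where
      cover : ∀ v → v ∈ A → v ∈ A′ ⊎ v ∈ ⋃
      cover v a with em (v ∈ ⋃)
      ... | inj₁ u = inj₂ u
      ... | inj₂ n = inj₁ (⌊⌋-true (a , n))

  determinacy-between : ∀ n m A → Closed A → (∀ v → v ∈ A → m ≤ pr v × pr v < m + n) → Determined A
  determinacy-between zero m A c b = (λ _ → A) , (λ _ _ → false) ,
    (λ σ → record { sub = λ _ a → a ; mine = λ v a → ⊥-elim (empty v a) ; his = λ v a → ⊥-elim (empty v a)
                  ; win = λ π i → ⊥-elim (empty _ (i 0)) }) , λ v a → inj₁ a
    where
    empty : ∀ v → ¬ (v ∈ A)
    empty v a = <-irrefl refl (<-≤-trans (subst (pr v <_) (+-identityʳ m) (proj₂ (b v a))) (proj₁ (b v a)))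
  determinacy-between (suc n) m A c b =
    Step.determined m n (determinacy-between n (suc m)) A c b ⋃ glue region maximal
    where open Maximal (not (even m)) A

  determinacy : ∀ N → (∀ v → pr v < N) → Determined (λ _ → true)
  determinacy N bd = determinacy-between N 0 (λ _ → true) (λ v _ → true , refl) (λ v _ → z≤n , bd v)

-- Formulas for finite-state conditions and definable sets

module Definability (em : ExcludedMiddle) where
  open Classical em
  open ParityAutomata em using (slice)
  open import Data.Vec using (Vec; []; _∷_; head; tail; _++_)

  infix 1 _⟺_
  _⟺_ : Set → Set → Set
  A ⟺ B = (A → B) × (B → A)

  ⟺-trans : ∀ {A B C} → A ⟺ B → B ⟺ C → A ⟺ C
  ⟺-trans (f , g) (h , k) = (λ a → h (f a)) , λ c → g (k c)

  ⟺-sym : ∀ {A B} → A ⟺ B → B ⟺ A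
  ⟺-sym (f , g) = g , f

  true-⟺ : ∀ {a b : Bool} → (a ≡ true ⟺ b ≡ true) → a ≡ b
  true-⟺ {true}  {b}     (f , g) = sym (f refl)
  true-⟺ {false} {true}  (f , g) = g refl
  true-⟺ {false} {false} (f , g) = refl

  Sat-agree : ∀ φ {a b} ρ ρ′ σ σ′ → FOBelow a φ → SOBelow b φ → (∀ x → x < a → ρ x ≡ ρ′ x) →
    (∀ X → X < b → ∀ t → σ X t ≡ σ′ X t) → Sat ρ σ φ ⟺ Sat ρ′ σ′ φ
  Sat-agree (x <′ y) ρ ρ′ σ σ′ (fx , fy) so e e′ rewrite e x fx | e y fy = (λ s → s) , λ s → s
  Sat-agree (x ∈′ X) ρ ρ′ σ σ′ fo so e e′ rewrite e x fo | e′ X so (ρ′ x) = (λ s → s) , λ s → s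
  Sat-agree (¬′ φ) ρ ρ′ σ σ′ fo so e e′ with Sat-agree φ ρ ρ′ σ σ′ fo so e e′
  ... | f , g = (λ n s → n (g s)) , λ n s → n (f s)
  Sat-agree (φ ∧′ ψ) ρ ρ′ σ σ′ (fo , fo′) (so , so′) e e′
    with Sat-agree φ ρ ρ′ σ σ′ fo so e e′ | Sat-agree ψ ρ ρ′ σ σ′ fo′ so′ e e′
  ... | f , g | h , k = (λ { (a , b) → f a , h b }) , λ { (a , b) → g a , k b }
  Sat-agree (∃₁ φ) ρ ρ′ σ σ′ fo so e e′ =
    (λ { (n , s) → n , proj₁ (sub n) s }) , λ { (n , s) → n , proj₂ (sub n) s }
    where
    sub : ∀ n → Sat (extend n ρ) σ φ ⟺ Sat (extend n ρ′) σ′ φ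
    sub n = Sat-agree φ _ _ σ σ′ fo so (λ { zero l → refl ; (suc x) (s≤s l) → e x l }) e′
  Sat-agree (∃₂ φ) ρ ρ′ σ σ′ fo so e e′ =
    (λ { (S , s) → S , proj₁ (sub S) s }) , λ { (S , s) → S , proj₂ (sub S) s }
    where
    sub : ∀ S → Sat ρ (extend S σ) φ ⟺ Sat ρ′ (extend S σ′) φ
    sub S = Sat-agree φ ρ ρ′ _ _ fo so e (λ { zero l t → refl ; (suc X) (s≤s l) t → e′ X l t })

  FOBelow-mono : ∀ φ {a a′} → a ≤ a′ → FOBelow a φ → FOBelow a′ φ
  FOBelow-mono (x <′ y) l (p , q) = ≤-trans p l , ≤-trans q l
  FOBelow-mono (x ∈′ X) l p = ≤-trans p l
  FOBelow-mono (¬′ φ) l p = FOBelow-mono φ l p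
  FOBelow-mono (φ ∧′ ψ) l (p , q) = FOBelow-mono φ l p , FOBelow-mono ψ l q
  FOBelow-mono (∃₁ φ) l p = FOBelow-mono φ (s≤s l) p
  FOBelow-mono (∃₂ φ) l p = FOBelow-mono φ l p

  SOBelow-mono : ∀ φ {a a′} → a ≤ a′ → SOBelow a φ → SOBelow a′ φ
  SOBelow-mono (x <′ y) l p = tt
  SOBelow-mono (x ∈′ X) l p = ≤-trans p l
  SOBelow-mono (¬′ φ) l p = SOBelow-mono φ l p
  SOBelow-mono (φ ∧′ ψ) l (p , q) = SOBelow-mono φ l p , SOBelow-mono ψ l q
  SOBelow-mono (∃₁ φ) l p = SOBelow-mono φ l p
  SOBelow-mono (∃₂ φ) l p = SOBelow-mono φ (s≤s l) p

  varBound : Fm → ℕ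
  varBound (x <′ y) = suc x ⊔ suc y
  varBound (x ∈′ X) = suc x ⊔ suc X
  varBound (¬′ φ)   = varBound φ
  varBound (φ ∧′ ψ) = varBound φ ⊔ varBound ψ
  varBound (∃₁ φ)   = varBound φ
  varBound (∃₂ φ)   = varBound φ

  FOBelow-varBound : ∀ φ → FOBelow (varBound φ) φ
  FOBelow-varBound (x <′ y) = m≤m⊔n (suc x) (suc y) , m≤n⊔m (suc x) (suc y)
  FOBelow-varBound (x ∈′ X) = m≤m⊔n (suc x) (suc X)
  FOBelow-varBound (¬′ φ)   = FOBelow-varBound φ
  FOBelow-varBound (φ ∧′ ψ) = FOBelow-mono φ (m≤m⊔n (varBound φ) _) (FOBelow-varBound φ) ,
      FOBelow-mono ψ (m≤n⊔m (varBound φ) _) (FOBelow-varBound ψ)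
  FOBelow-varBound (∃₁ φ)   = FOBelow-mono φ (n≤1+n _) (FOBelow-varBound φ)
  FOBelow-varBound (∃₂ φ)   = FOBelow-varBound φ

  SOBelow-varBound : ∀ φ → SOBelow (varBound φ) φ
  SOBelow-varBound (x <′ y) = tt
  SOBelow-varBound (x ∈′ X) = m≤n⊔m (suc x) (suc X)
  SOBelow-varBound (¬′ φ)   = SOBelow-varBound φ
  SOBelow-varBound (φ ∧′ ψ) = SOBelow-mono φ (m≤m⊔n (varBound φ) _) (SOBelow-varBound φ) ,
      SOBelow-mono ψ (m≤n⊔m (varBound φ) _) (SOBelow-varBound ψ)
  SOBelow-varBound (∃₁ φ)   = SOBelow-varBound φ
  SOBelow-varBound (∃₂ φ)   = SOBelow-mono φ (n≤1+n _) (SOBelow-varBound φ)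

  Sat-ext : ∀ φ {ρ ρ′ σ σ′} → (∀ x → ρ x ≡ ρ′ x) → (∀ X t → σ X t ≡ σ′ X t) → Sat ρ σ φ ⟺ Sat ρ′ σ′ φ
  Sat-ext φ e e′ = Sat-agree φ _ _ _ _ (FOBelow-varBound φ) (SOBelow-varBound φ) (λ x _ → e x) (λ X _ → e′ X)

  lift : (ℕ → ℕ) → ℕ → ℕ
  lift f zero    = zero
  lift f (suc n) = suc (f n)

  ren : (ℕ → ℕ) → Fm → Fm
  ren f (x <′ y) = x <′ y
  ren f (x ∈′ X) = x ∈′ f X
  ren f (¬′ φ)   = ¬′ ren f φ
  ren f (φ ∧′ ψ) = ren f φ ∧′ ren f ψ
  ren f (∃₁ φ)   = ∃₁ (ren f φ)
  ren f (∃₂ φ)   = ∃₂ (ren (lift f) φ)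

  Sat-ren : ∀ φ f ρ σ → Sat ρ σ (ren f φ) ⟺ Sat ρ (λ X → σ (f X)) φ
  Sat-ren (x <′ y) f ρ σ = (λ s → s) , λ s → s
  Sat-ren (x ∈′ X) f ρ σ = (λ s → s) , λ s → s
  Sat-ren (¬′ φ) f ρ σ with Sat-ren φ f ρ σ
  ... | g , h = (λ n s → n (h s)) , λ n s → n (g s)
  Sat-ren (φ ∧′ ψ) f ρ σ with Sat-ren φ f ρ σ | Sat-ren ψ f ρ σ
  ... | g , h | g′ , h′ = (λ { (a , b) → g a , g′ b }) , λ { (a , b) → h a , h′ b }
  Sat-ren (∃₁ φ) f ρ σ = (λ { (n , s) → n , proj₁ (Sat-ren φ f _ σ) s }) ,
      λ { (n , s) → n , proj₂ (Sat-ren φ f _ σ) s }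
  Sat-ren (∃₂ φ) f ρ σ = (λ { (S , s) → S , proj₁ (sub S) s }) , λ { (S , s) → S , proj₂ (sub S) s }
    where
    sub : ∀ S → Sat ρ (extend S σ) (ren (lift f) φ) ⟺ Sat ρ (extend S (λ X → σ (f X))) φ
    sub S = ⟺-trans (Sat-ren φ (lift f) ρ (extend S σ))
        (Sat-ext φ (λ _ → refl) λ { zero t → refl ; (suc X) t → refl })

  FOBelow-ren : ∀ φ f {a} → FOBelow a φ → FOBelow a (ren f φ)
  FOBelow-ren (x <′ y) f p = p
  FOBelow-ren (x ∈′ X) f p = p
  FOBelow-ren (¬′ φ) f p = FOBelow-ren φ f p
  FOBelow-ren (φ ∧′ ψ) f (p , q) = FOBelow-ren φ f p , FOBelow-ren ψ f q
  FOBelow-ren (∃₁ φ) f p = FOBelow-ren φ f p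
  FOBelow-ren (∃₂ φ) f p = FOBelow-ren φ (lift f) p

  infixr 6 _⇒′_
  infix 5 _⇔′_
  _⇒′_ _⇔′_ : Fm → Fm → Fm
  φ ⇒′ ψ = ¬′ (φ ∧′ (¬′ ψ))
  φ ⇔′ ψ = (φ ⇒′ ψ) ∧′ (ψ ⇒′ φ)

  ∀₁ : Fm → Fm
  ∀₁ φ = ¬′ ∃₁ (¬′ φ)

  ⇒-sat : ∀ {A B : Set} → ¬ (A × ¬ B) ⟺ (A → B)
  ⇒-sat = (λ n a → ¬¬-elim λ b → n (a , b)) , λ { f (a , nb) → nb (f a) }

  ⇔-sat : ∀ {A B : Set} → (¬ (A × ¬ B)) × (¬ (B × ¬ A)) ⟺ (A ⟺ B)
  ⇔-sat = (λ { (f , g) → proj₁ ⇒-sat f , proj₁ ⇒-sat g }) , λ { (f , g) → proj₂ ⇒-sat f , proj₂ ⇒-sat g }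

  ∀-sat : ∀ {A : Set} {B : A → Set} → ¬ Σ A (λ a → ¬ B a) ⟺ (∀ a → B a)
  ∀-sat = (λ n a → ¬¬-elim λ b → n (a , b)) , λ { f (a , nb) → nb (f a) }

  zero′ : ℕ → Fm
  zero′ x = ¬′ ∃₁ (0 <′ suc x)

  zero-sat : ∀ n → ¬ Σ ℕ (λ m → m < n) ⟺ n ≡ 0
  zero-sat zero = (λ _ → refl) , λ { _ (_ , ()) }
  zero-sat (suc n) = (λ h → ⊥-elim (h (0 , s≤s z≤n))) , λ ()

  succ′ : ℕ → ℕ → Fm
  succ′ x y = (x <′ y) ∧′ (¬′ ∃₁ ((suc x <′ 0) ∧′ (0 <′ suc y)))

  succ-sat : ∀ m n → m < n × (¬ Σ ℕ λ k → m < k × k < n) ⟺ n ≡ suc m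
  succ-sat m n = (λ { (l , h) → ≤-antisym (≮⇒≥ λ l′ → h (suc m , ≤-refl , l′)) l }) ,
    λ { refl → ≤-refl , λ { (k , a , b) → <⇒≱ a (≤-pred b) } }

  bool′ : Bool → Fm
  bool′ true  = ¬′ ∃₁ (0 <′ 0)
  bool′ false = ∃₁ (0 <′ 0)

  bool-sat : ∀ b {ρ σ} → Sat ρ σ (bool′ b) ⟺ b ≡ true
  bool-sat true  = (λ _ → refl) , λ { _ (n , l) → <-irrefl refl l }
  bool-sat false = (λ { (n , l) → ⊥-elim (<-irrefl refl l) }) , λ ()

  cases : ∀ k → ℕ → ℕ → (Vec Bool k → Fm) → Fm
  cases zero    X x g = g []
  cases (suc k) X x g = ((x ∈′ X) ⇒′ cases k (suc X) x (λ v → g (true ∷ v))) ∧′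
                        ((¬′ (x ∈′ X)) ⇒′ cases k (suc X) x (λ v → g (false ∷ v)))

  cases-sat : ∀ k X x g ρ σ → Sat ρ σ (cases k X x g) ⟺ Sat ρ σ (g (slice k (λ i → σ (X + i)) (ρ x)))
  cases-sat zero    X x g ρ σ = (λ s → s) , λ s → s
  cases-sat (suc k) X x g ρ σ = ⟺-trans (pick (σ X (ρ x)) refl)
      (same _ _ (cong₂ _∷_ (cong (λ i → σ i (ρ x)) (sym (+-identityʳ X))) (slice-shift k X)))
    where
    same : ∀ u v → u ≡ v → Sat ρ σ (g u) ⟺ Sat ρ σ (g v)
    same u v refl = (λ s → s) , λ s → s
    slice-cong : ∀ k {τ τ′ : ℕ → ℕ → Bool} {t} → (∀ i → τ i t ≡ τ′ i t) → slice k τ t ≡ slice k τ′ t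
    slice-cong zero    e = refl
    slice-cong (suc k) e = cong₂ _∷_ (e 0) (slice-cong k (λ i → e (suc i)))
    slice-shift : ∀ k X → slice k (λ i → σ (suc X + i)) (ρ x) ≡ slice k (λ i → σ (X + suc i)) (ρ x)
    slice-shift k X = slice-cong k (λ i → cong (λ j → σ j (ρ x)) (sym (+-suc X i)))
    IH : ∀ b → Sat ρ σ (cases k (suc X) x (λ v → g (b ∷ v))) ⟺
        Sat ρ σ (g (b ∷ slice k (λ i → σ (suc X + i)) (ρ x)))
    IH b = cases-sat k (suc X) x (λ v → g (b ∷ v)) ρ σ
    pick : ∀ b → σ X (ρ x) ≡ b → Sat ρ σ (cases (suc k) X x g) ⟺
        Sat ρ σ (g (b ∷ slice k (λ i → σ (suc X + i)) (ρ x)))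
    pick true e = (λ { (f , _) → proj₁ (IH true) (proj₁ ⇒-sat f e) }) ,
      λ s → proj₂ ⇒-sat (λ _ → proj₂ (IH true) s) , proj₂ ⇒-sat (λ n → ⊥-elim (n e))
    pick false e = (λ { (_ , f) → proj₁ (IH false) (proj₁ ⇒-sat f λ e′ → diff (trans (sym e) e′)) }) ,
      λ s → proj₂ ⇒-sat (λ e′ → ⊥-elim (diff (trans (sym e) e′))) , proj₂ ⇒-sat (λ _ → proj₂ (IH false) s)
      where diff : false ≢ true
            diff ()

  FOBelow-cases : ∀ k X x g {a} → x < a → (∀ v → FOBelow a (g v)) → FOBelow a (cases k X x g)
  FOBelow-cases zero    X x g l h = h []
  FOBelow-cases (suc k) X x g l h =
    (l , FOBelow-cases k (suc X) x _ l (λ v → h (true ∷ v))) ,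
        (l , FOBelow-cases k (suc X) x _ l (λ v → h (false ∷ v)))

  FOBelow-bool : ∀ b {a} → FOBelow a (bool′ b)
  FOBelow-bool true  = s≤s z≤n , s≤s z≤n
  FOBelow-bool false = s≤s z≤n , s≤s z≤n

  -- A case distinction over all letters whose leaves are truth values decided by excluded middle.
  -- The formula is not computed from `I` and `R`; only its existence is used, since the search
  -- meets every formula.
  local : ∀ k → (Vec Bool k → Set) → (Vec Bool k → Vec Bool k → Set) → Fm
  local k I R =
    (∀₁ (zero′ 0 ⇒′ cases k 0 0 (λ u → bool′ ⌊ I u ⌋))) ∧′
    (∀₁ (∀₁ (succ′ 1 0 ⇒′ cases k 0 1 (λ u → cases k 0 0 (λ v → bool′ ⌊ R u v ⌋)))))

  ⌊⌋-sat : ∀ {A} → ⌊ A ⌋ ≡ true ⟺ A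
  ⌊⌋-sat = true-⌊⌋ , ⌊⌋-true

  local-sat : ∀ k I R ρ σ → Sat ρ σ (local k I R) ⟺
    (I (slice k σ 0) × ∀ t → R (slice k σ t) (slice k σ (suc t)))
  local-sat k I R ρ σ = to , from
    where
    case₁ : ∀ ρ x (f : Vec Bool k → Set) → Sat ρ σ (cases k 0 x (λ u → bool′ ⌊ f u ⌋)) ⟺ f (slice k σ (ρ x))
    case₁ ρ x f = ⟺-trans (cases-sat k 0 x _ ρ σ) (⟺-trans (bool-sat _) ⌊⌋-sat)
    case₂ : ∀ ρ x y (f : Vec Bool k → Vec Bool k → Set) →
      Sat ρ σ (cases k 0 x (λ u → cases k 0 y (λ v → bool′ ⌊ f u v ⌋))) ⟺ f (slice k σ (ρ x)) (slice k σ (ρ y))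
    case₂ ρ x y f = ⟺-trans (cases-sat k 0 x _ ρ σ) (case₁ ρ y (f (slice k σ (ρ x))))
    to : _
    to (a , b) = proj₁ (case₁ (extend 0 ρ) 0 I) (proj₁ ⇒-sat (proj₁ ∀-sat a 0) (proj₂ (zero-sat 0) refl)) ,
      λ t → proj₁ (case₂ (extend (suc t) (extend t ρ)) 1 0 R)
        (proj₁ ⇒-sat (proj₁ ∀-sat (proj₁ ∀-sat b t) (suc t)) (proj₂ (succ-sat t (suc t)) refl))
    from : _
    from (i , r) =
      proj₂ ∀-sat (λ n → proj₂ ⇒-sat (λ z → proj₂ (case₁ (extend n ρ) 0 I)
          (subst (λ n → I (slice k σ n)) (sym (proj₁ (zero-sat n) z)) i))) ,
      proj₂ ∀-sat (λ m → proj₂ ∀-sat (λ n → proj₂ ⇒-sat (λ s →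
        proj₂ (case₂ (extend n (extend m ρ)) 1 0 R)
            (subst (λ n → R (slice k σ m) (slice k σ n)) (sym (proj₁ (succ-sat m n) s)) (r m)))))

  FOBelow-local : ∀ k I R {a} → FOBelow a (local k I R)
  FOBelow-local k I R =
    ((s≤s z≤n , s≤s (s≤s z≤n)) , FOBelow-cases k 0 0 _ (s≤s z≤n) (λ u → FOBelow-bool ⌊ I u ⌋)) ,
    (((s≤s (s≤s z≤n) , s≤s z≤n) , (s≤s (s≤s (s≤s z≤n)) , s≤s z≤n) , (s≤s z≤n , s≤s (s≤s z≤n))) ,
     FOBelow-cases k 0 1 _ (s≤s (s≤s z≤n)) (λ u → FOBelow-cases k 0 0 _ (s≤s z≤n) (λ v → FOBelow-bool ⌊ R u v ⌋)))

  extends : ∀ {k} → (ℕ → Vec Bool k) → (ℕ → ℕ → Bool) → ℕ → ℕ → Bool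
  extends {zero}  w σ = σ
  extends {suc k} w σ = extend (λ t → head (w t)) (extends (λ t → tail (w t)) σ)

  ∃₂^ : ℕ → Fm → Fm
  ∃₂^ zero    φ = φ
  ∃₂^ (suc k) φ = ∃₂^ k (∃₂ φ)

  ∃₂^-intro : ∀ k {φ ρ σ} (w : ℕ → Vec Bool k) → Sat ρ (extends w σ) φ → Sat ρ σ (∃₂^ k φ)
  ∃₂^-intro zero    w s = s
  ∃₂^-intro (suc k) w s = ∃₂^-intro k (λ t → tail (w t)) (_ , s)

  ∃₂^-elim : ∀ k {φ ρ σ} → Sat ρ σ (∃₂^ k φ) → Σ (ℕ → Vec Bool k) λ w → Sat ρ (extends w σ) φ
  ∃₂^-elim zero    s = (λ _ → []) , s
  ∃₂^-elim (suc k) s with ∃₂^-elim k s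
  ... | w , S , x = (λ t → S t ∷ w t) , x

  FOBelow-∃₂^ : ∀ k φ {a} → FOBelow a φ → FOBelow a (∃₂^ k φ)
  FOBelow-∃₂^ zero    φ p = p
  FOBelow-∃₂^ (suc k) φ p = FOBelow-∃₂^ k (∃₂ φ) p

  slice-extends : ∀ {n} k (w : ℕ → Vec Bool n) σ t → slice (n + k) (extends w σ) t ≡ w t ++ slice k σ t
  slice-extends {zero}  k w σ t with w t
  ... | [] = refl
  slice-extends {suc n} k w σ t rewrite slice-extends k (λ t → tail (w t)) σ t with w t
  ... | b ∷ v = refl

  extends-+ : ∀ {n} (w : ℕ → Vec Bool n) σ i → extends w σ (n + i) ≡ σ i
  extends-+ {zero}  w σ i = refl
  extends-+ {suc n} w σ i = extends-+ (λ t → tail (w t)) σ i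

  Defines : (ℕ → ℕ → Bool) → Fm → (ℕ → Bool) → Set
  Defines σ ζ Z = ∀ ρ → Sat ρ σ ζ ⟺ Z (ρ 0) ≡ true

  Definable : (ℕ → ℕ → Bool) → (ℕ → Bool) → Set
  Definable σ Z = Σ Fm λ ζ → Defines σ ζ Z

  -- Substitution of `ζ` for set variable 0, expressed by a quantifier so that nothing has to be
  -- substituted under binders.
  eliminate : Fm → Fm → Fm
  eliminate ζ φ = ∃₂ (∀₁ ((0 ∈′ 0) ⇔′ ren suc ζ) ∧′ φ)

  eliminate-sat : ∀ ζ φ {Z} ρ σ → Defines σ ζ Z → Sat ρ σ (eliminate ζ φ) ⟺ Sat ρ (extend Z σ) φ
  eliminate-sat ζ φ {Z} ρ σ D =
    (λ { (S , e , s) → proj₁ (Sat-ext φ (λ _ → refl)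
        λ { zero t → true-⟺ (⟺-trans (proj₁ ⇔-sat (proj₁ ∀-sat e t)) (⟺-trans (Sat-ren ζ suc _ _) (D _))) ;
            (suc X) t → refl }) s }) ,
    λ s → Z , proj₂ ∀-sat (λ t → proj₂ ⇔-sat (⟺-sym
        (⟺-trans (Sat-ren ζ suc _ (extend Z σ)) (D (extend t ρ))))) , s

  Definable-trans : ∀ {σ W Z} → Definable σ W → Definable (extend W σ) Z → Definable σ Z
  Definable-trans {σ} (ζ , D) (ζ′ , D′) = eliminate ζ ζ′ , λ ρ → ⟺-trans (eliminate-sat ζ ζ′ ρ σ D) (D′ ρ)

-- Definable solutions of satisfiable conditions

module DefinableChoice (em : ExcludedMiddle) where
  open Classical em
  open Recognition em using (take-++; drop-++; ≡ᵇ-refl; ≡ᵇ-≢)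
  open ParityAutomata em
  open Definability em
  open import Data.Vec using (Vec; []; _∷_; head; tail; _++_; take; drop)

  AgreeUpTo : ℕ → (ℕ → Bool) → (ℕ → Bool) → Set
  AgreeUpTo n Z W = ∀ x → x < n → Z x ≡ W x

  agree-sym : ∀ {n Z W} → AgreeUpTo n Z W → AgreeUpTo n W Z
  agree-sym a x l = sym (a x l)

  agree-trans : ∀ {n Z W V} → AgreeUpTo n Z W → AgreeUpTo n W V → AgreeUpTo n Z V
  agree-trans a b x l = trans (a x l) (b x l)

  agree-suc : ∀ {n Z W} → AgreeUpTo n Z W → Z n ≡ W n → AgreeUpTo (suc n) Z W
  agree-suc {n} a e x l with m<1+n⇒m<n∨m≡n l
  ... | inj₁ l′   = a x l′
  ... | inj₂ refl = e

  put : (ℕ → Bool) → ℕ → Bool → ℕ → Bool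
  put Z n b x = if x ≡ᵇ n then b else Z x

  put-same : ∀ Z n b → put Z n b n ≡ b
  put-same Z n b rewrite ≡ᵇ-refl n = refl

  put-below : ∀ Z n b → AgreeUpTo n (put Z n b) Z
  put-below Z n b x l rewrite ≡ᵇ-≢ (<⇒≢ l) = refl

  put-agree : ∀ {n Z W b} → AgreeUpTo n Z W → W n ≡ b → AgreeUpTo (suc n) (put Z n b) W
  put-agree {n} {Z} {W} {b} a e = agree-suc (agree-trans (put-below Z n b) a) (trans (put-same Z n b) (sym e))

  agree′ : ℕ → ℕ → ℕ → Fm
  agree′ x X Y = ∀₁ ((0 <′ suc x) ⇒′ ((0 ∈′ X) ⇔′ (0 ∈′ Y)))

  agree-sat : ∀ {Z W : ℕ → Bool} {n} → ¬ Σ ℕ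
      (λ x → ¬ ¬ (x < n × ¬ ((¬ (Z x ≡ true × ¬ W x ≡ true)) × (¬ (W x ≡ true × ¬ Z x ≡ true))))) ⟺
          AgreeUpTo n Z W
  agree-sat = (λ h x l → true-⟺ (proj₁ ⇔-sat (proj₁ ⇒-sat (proj₁ ∀-sat h x) l))) ,
    λ a → proj₂ ∀-sat λ x → proj₂ ⇒-sat λ l → proj₂ ⇔-sat ((λ e → trans (sym (a x l)) e) , λ e → trans (a x l) e)

  -- The leftmost branch (true before false) of the tree of good prefixes is definable.
  module Greedy (σ : ℕ → ℕ → Bool) (e : Fm) (Γ : (ℕ → Bool) → ℕ → Set)
    (e-sat : ∀ ρ Z → Sat ρ (extend Z σ) e ⟺ Γ Z (ρ 0))
    (Γ-local : ∀ Z W n → AgreeUpTo n Z W → Γ Z n → Γ W n)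
    (Γ-start : ∀ Z → Γ Z 0)
    (Γ-step : ∀ Z n → Γ Z n → Σ Bool λ b → Γ (put Z n b) (suc n)) where

    Next : (ℕ → Bool) → ℕ → Set
    Next Z n = Γ (put Z n true) (suc n)

    next′ : Fm
    next′ = ∃₂ (agree′ 0 0 1 ∧′ ((0 ∈′ 0) ∧′ ∃₁ (succ′ 1 0 ∧′ ren (lift suc) e)))

    next-sat : ∀ ρ Z → Sat ρ (extend Z σ) next′ ⟺ Next Z (ρ 0)
    next-sat ρ Z =
      (λ { (W , a , t , m , s , x) → Γ-local W _ _ (agree-sym (put-agree (agree-sym (proj₁ agree-sat a)) t))
             (subst (Γ W) (proj₁ (succ-sat (ρ 0) m) s) (proj₁ (inner W m) x)) }) ,
      λ g → put Z (ρ 0) true , proj₂ agree-sat (put-below Z (ρ 0) true) , put-same Z (ρ 0) true ,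
            suc (ρ 0) , proj₂ (succ-sat (ρ 0) (suc (ρ 0))) refl , proj₂ (inner _ _) g
      where
      inner : ∀ W m → Sat (extend m ρ) (extend W (extend Z σ)) (ren (lift suc) e) ⟺ Γ W m
      inner W m = ⟺-trans (Sat-ren e (lift suc) _ _)
        (⟺-trans (Sat-ext e (λ _ → refl) λ { zero t → refl ; (suc X) t → refl }) (e-sat (extend m ρ) W))

    pre : ℕ → ℕ → Bool
    pre zero    = λ _ → false
    pre (suc n) = put (pre n) n ⌊ Next (pre n) n ⌋

    Z* : ℕ → Bool
    Z* n = pre (suc n) n

    pre-agree : ∀ n → AgreeUpTo n (pre n) Z*
    pre-agree (suc n) = agree-suc (agree-trans (put-below (pre n) n _) (pre-agree n)) refl

    Next-local : ∀ Z W n → AgreeUpTo n Z W → Next Z n → Next W n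
    Next-local Z W n a = Γ-local _ _ _ (put-agree (agree-trans a (agree-sym (put-below W n true)))
        (put-same W n true))

    Z*-next : ∀ n → Z* n ≡ true ⟺ Next Z* n
    Z*-next n = ⟺-trans (subst (λ b → b ≡ true ⟺ Next (pre n) n) (sym (put-same (pre n) n _)) ⌊⌋-sat)
      (Next-local _ _ n (pre-agree n) , Next-local _ _ n (agree-sym (pre-agree n)))

    branch : ∀ n → Γ Z* n
    branch zero = Γ-start Z*
    branch (suc n) with Γ-step Z* n (branch n) | em (Next Z* n)
    ... | _ , _ | inj₁ x = Γ-local _ _ _ (put-agree (λ _ _ → refl) (proj₂ (Z*-next n) x)) x
    ... | true , g | inj₂ x = ⊥-elim (x g)
    ... | false , g | inj₂ x = Γ-local _ _ _ (put-agree (λ _ _ → refl) (¬-not λ h → x (proj₁ (Z*-next n) h))) g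

    -- The greedy recursion determines each bit from the earlier ones, so `Z*` is the only set
    -- obeying it, and quantifying over the sets that obey it defines `Z*`.
    definable : Definable σ Z*
    definable = ∃₂ (∀₁ ((0 ∈′ 0) ⇔′ next′) ∧′ (0 ∈′ 0)) , λ ρ →
      (λ { (W , h , t) → trans (sym (unique W (λ n →
          ⟺-trans (proj₁ ⇔-sat (proj₁ ∀-sat h n)) (next-sat (extend n ρ) W)) (suc (ρ 0)) (ρ 0) ≤-refl)) t }) ,
      λ t → Z* , proj₂ ∀-sat (λ n → proj₂ ⇔-sat (⟺-trans (Z*-next n) (⟺-sym (next-sat (extend n ρ) Z*)))) , t
      where
      unique : ∀ W → (∀ n → W n ≡ true ⟺ Next W n) → ∀ n → AgreeUpTo n W Z*
      unique W h (suc n) = agree-suc a (true-⟺ (⟺-trans (h n)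
          (⟺-trans (Next-local _ _ n a , Next-local _ _ n (agree-sym a)) (⟺-sym (Z*-next n)))))
        where a = unique W h n

  slice-extends₀ : ∀ {n} (w : ℕ → Vec Bool n) σ t → slice n (extends w σ) t ≡ w t
  slice-extends₀ {zero}  w σ t with w t
  ... | [] = refl
  slice-extends₀ {suc n} w σ t rewrite slice-extends₀ (λ t → tail (w t)) σ t with w t
  ... | b ∷ v = refl

  module Selection (σ : ℕ → ℕ → Bool) (b n : ℕ) (start : Vec Bool n) (δ : Vec Bool n → Vec Bool (suc b) → Vec Bool n)
    (prio : Vec Bool n → ℕ) (q : Vec Bool n) (m : ℕ) where

    A : Automaton (Vec Bool (suc b))
    A = record { dim = n ; start = start ; δ = δ ; prio = prio }

    st : (ℕ → Bool) → ℕ → Vec Bool n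
    st Z = Automaton.states A (slice (suc b) (extend Z σ))

    st-local : ∀ Z W t → AgreeUpTo t Z W → st Z t ≡ st W t
    st-local Z W zero    a = refl
    st-local Z W (suc t) a = cong₂ δ (st-local Z W t (λ x l → a x (m<n⇒m<1+n l)))
        (cong (_∷ slice b σ t) (a t ≤-refl))

    -- The positions in C are visits of the run on Z to q, from the first of which on no
    -- priority is below m.
    β : (ℕ → Bool) → (ℕ → Bool) → Set
    β C Z = (∀ t → C t ≡ true → st Z t ≡ q) × (∀ t u → ¬ (t < u) → C u ≡ true → m ≤ prio (st Z t))

    -- The run is guessed as `n` further sets in front of `C`, which puts `C` at index `n + 0`;
    -- `tail` skips the track of `C`, which the automaton does not read.
    β′ : Fm
    β′ = ∃₂^ n (local (n + suc (suc b)) (λ v → take n v ≡ start)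
        (λ u v → take n v ≡ δ (take n u) (tail (drop n u)))
      ∧′ (∀₁ ((0 ∈′ (n + 0)) ⇒′ cases n 0 0 (λ s → bool′ ⌊ s ≡ q ⌋))
      ∧′ ∀₁ (∀₁ ((¬′ (1 <′ 0)) ⇒′ ((0 ∈′ (n + 0)) ⇒′ cases n 0 1 (λ s → bool′ ⌊ m ≤ prio s ⌋))))))

    β-sat : ∀ ρ C Z → Sat ρ (extend C (extend Z σ)) β′ ⟺ β C Z
    β-sat ρ C Z = to , from
      where
      τ : (ℕ → Vec Bool n) → ℕ → ℕ → Bool
      τ w = extends w (extend C (extend Z σ))
      letter : ∀ w t → slice (n + suc (suc b)) (τ w) t ≡ w t ++ (C t ∷ slice (suc b) (extend Z σ) t)
      letter w t = slice-extends (suc (suc b)) w (extend C (extend Z σ)) t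
      fst≡ : ∀ w t → take n (slice (n + suc (suc b)) (τ w) t) ≡ w t
      fst≡ w t = trans (cong (take n) (letter w t)) (take-++ (w t) _)
      snd≡ : ∀ w t → tail (drop n (slice (n + suc (suc b)) (τ w) t)) ≡ slice (suc b) (extend Z σ) t
      snd≡ w t = cong tail (trans (cong (drop n) (letter w t)) (drop-++ (w t) _))
      C≡ : ∀ w t → τ w (n + 0) t ≡ C t
      C≡ w t = cong (λ S → S t) (extends-+ w (extend C (extend Z σ)) 0)
      case : ∀ w ρ x (f : Vec Bool n → Set) → Sat ρ (τ w) (cases n 0 x (λ s → bool′ ⌊ f s ⌋)) ⟺ f (w (ρ x))
      case w ρ x f = ⟺-trans (cases-sat n 0 x _ ρ (τ w)) (⟺-trans (bool-sat _) (⟺-trans ⌊⌋-sat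
        (subst f (slice-extends₀ w _ (ρ x)) , subst f (sym (slice-extends₀ w _ (ρ x))))))
      to : Sat ρ (extend C (extend Z σ)) β′ → β C Z
      to s with ∃₂^-elim n s
      ... | w , l , c₁ , c₂ = (λ t c → trans (sym (runs t))
            (proj₁ (case w _ 0 (_≡ q)) (proj₁ ⇒-sat (proj₁ ∀-sat c₁ t) (trans (C≡ w t) c)))) ,
          λ t u h c → subst (λ s → m ≤ prio s) (runs t)
              (proj₁ (case w (extend u (extend t ρ)) 1 (λ s → m ≤ prio s))
            (proj₁ ⇒-sat (proj₁ ⇒-sat (proj₁ ∀-sat (proj₁ ∀-sat c₂ t) u) h) (trans (C≡ w u) c)))
        where
        L = proj₁ (local-sat (n + suc (suc b)) (λ v → take n v ≡ start)
            (λ u v → take n v ≡ δ (take n u) (tail (drop n u))) ρ (τ w)) l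
        runs : ∀ t → w t ≡ st Z t
        runs zero    = trans (sym (fst≡ w 0)) (proj₁ L)
        runs (suc t) = trans (sym (fst≡ w (suc t)))
            (trans (proj₂ L t) (cong₂ δ (trans (fst≡ w t) (runs t)) (snd≡ w t)))
      from : β C Z → Sat ρ (extend C (extend Z σ)) β′
      from (h₁ , h₂) = ∃₂^-intro n w
        ( proj₂ (local-sat (n + suc (suc b)) _ _ ρ (τ w))
            (fst≡ w 0 , λ t → trans (fst≡ w (suc t)) (sym (cong₂ δ (fst≡ w t) (snd≡ w t))))
        , proj₂ ∀-sat (λ t → proj₂ ⇒-sat λ c → proj₂ (case w _ 0 (_≡ q)) (h₁ t (trans (sym (C≡ w t)) c)))
        , proj₂ ∀-sat (λ t → proj₂ ∀-sat λ u → proj₂ ⇒-sat λ h → proj₂ ⇒-sat λ c →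
            proj₂ (case w (extend u (extend t ρ)) 1 (λ s → m ≤ prio s)) (h₂ t u h (trans (sym (C≡ w u)) c))))
        where w = st Z

    Unb : (ℕ → Bool) → Set
    Unb C = ∀ x → Σ ℕ λ y → x < y × C y ≡ true

    Γ₁ : (ℕ → Bool) → ℕ → Set
    Γ₁ C k = Σ (ℕ → Bool) λ Z → Σ (ℕ → Bool) λ D → AgreeUpTo k D C × Unb D × β D Z

    e₁ : Fm
    e₁ = ∃₂ (∃₂ (agree′ 0 0 2 ∧′ (∀₁ (∃₁ ((1 <′ 0) ∧′ (0 ∈′ 0))) ∧′ ren (lift (lift suc)) β′)))

    e₁-sat : ∀ ρ C → Sat ρ (extend C σ) e₁ ⟺ Γ₁ C (ρ 0)
    e₁-sat ρ C =
      (λ { (Z , D , a , u , x) → Z , D , proj₁ agree-sat a , proj₁ ∀-sat u , proj₁ (inner Z D) x }) ,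
      λ { (Z , D , a , u , x) → Z , D , proj₂ agree-sat a , proj₂ ∀-sat u , proj₂ (inner Z D) x }
      where
      inner : ∀ Z D → Sat ρ (extend D (extend Z (extend C σ))) (ren (lift (lift suc)) β′) ⟺ β D Z
      inner Z D = ⟺-trans (Sat-ren β′ (lift (lift suc)) ρ _)
        (⟺-trans (Sat-ext β′ (λ _ → refl) λ { zero t → refl ; (suc zero) t → refl ; (suc (suc X)) t →
            refl }) (β-sat ρ D Z))

    Γ₁-local : ∀ C D k → AgreeUpTo k C D → Γ₁ C k → Γ₁ D k
    Γ₁-local C D k a (Z , E , a′ , u , x) = Z , E , agree-trans a′ a , u , x

    Γ₁-step : ∀ C k → Γ₁ C k → Σ Bool λ b → Γ₁ (put C k b) (suc k)
    Γ₁-step C k (Z , E , a , u , x) = E k , Z , E , agree-sym (put-agree (agree-sym a) refl) , u , x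

    module _ (Z₀ C₀ : ℕ → Bool) (unb₀ : Unb C₀) (β₀ : β C₀ Z₀) where
      Γ₁-start : ∀ C → Γ₁ C 0
      Γ₁-start C = Z₀ , C₀ , (λ _ ()) , unb₀ , β₀

      open Greedy σ e₁ Γ₁ e₁-sat Γ₁-local Γ₁-start Γ₁-step
        using () renaming (Z* to C*; branch to C*-branch; definable to C*-definable; Z*-next to C*-next)

      -- C* contains the earliest possible next cut, which therefore cannot be postponed forever.
      C*-unb : Unb C*
      C*-unb x with C*-branch (suc x)
      ... | Z , D , a , u , y with least (λ c → x < c × D c ≡ true) (u x)
      ... | c , (x<c , t) , min = ¬¬-elim λ none →
            none (c , x<c , proj₂ (C*-next c) (Z , D , agree-sym (put-agree (same none) t) , u , y))
        where
        same : ¬ (Σ ℕ λ y → x < y × C* y ≡ true) → AgreeUpTo c C* D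
        same none z l with <-≤-connex x z
        ... | inj₂ l′ = sym (a z (s≤s l′))
        ... | inj₁ l′ = trans (¬-not λ h → none (z , l′ , h)) (sym (¬-not λ h → min z l (l′ , h)))

      -- Every prefix of `C*` extends to the cuts of a solution, but the solution may depend on the
      -- prefix; hence the quantifier over `T` instead of a solution for `C*` itself.
      Γ₂ : (ℕ → Bool) → ℕ → Set
      Γ₂ Z k = ∀ T → Σ (ℕ → Bool) λ W → Σ (ℕ → Bool) λ D → AgreeUpTo T D C* × AgreeUpTo k W Z × β D W

      e₂ : Fm
      e₂ = ∀₁ (∃₂ (∃₂ (agree′ 0 0 3 ∧′ (agree′ 1 1 2 ∧′ ren (lift (lift (λ X → suc (suc X)))) β′))))

      e₂-sat : ∀ ρ Z → Sat ρ (extend Z (extend C* σ)) e₂ ⟺ Γ₂ Z (ρ 0)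
      e₂-sat ρ Z =
        (λ { h T → let (W , D , a , a′ , x) = proj₁ ∀-sat h T in
            W , D , proj₁ agree-sat a , proj₁ agree-sat a′ , proj₁ (inner T W D) x }) ,
        λ { h → proj₂ ∀-sat λ T → let (W , D , a , a′ , x) = h T in
            W , D , proj₂ agree-sat a , proj₂ agree-sat a′ , proj₂ (inner T W D) x }
        where
        inner : ∀ T W D → Sat (extend T ρ) (extend D (extend W (extend Z (extend C* σ))))
            (ren (lift (lift (λ X → suc (suc X)))) β′) ⟺ β D W
        inner T W D = ⟺-trans (Sat-ren β′ _ _ _)
          (⟺-trans (Sat-ext β′ (λ _ → refl) λ { zero t → refl ; (suc zero) t → refl ; (suc (suc X)) t →
              refl }) (β-sat _ D W))

      -- König's lemma: if each bit failed for some prefix of `C*`, both would fail for the longer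
      -- of the two prefixes.
      Γ₂-step : ∀ Z k → Γ₂ Z k → Σ Bool λ b → Γ₂ (put Z k b) (suc k)
      Γ₂-step Z k g with em (Γ₂ (put Z k true) (suc k)) | em (Γ₂ (put Z k false) (suc k))
      ... | inj₁ x | _ = true , x
      ... | inj₂ _ | inj₁ x = false , x
      ... | inj₂ x | inj₂ y with ¬∀⇒∃¬ x | ¬∀⇒∃¬ y
      ... | T , nt | T′ , nf with g (T ⊔ T′)
      ... | W , D , a , a′ , h with W k in eq
      ...   | true  = ⊥-elim (nt (W , D , (λ x l → a x (≤-trans l (m≤m⊔n T T′))) ,
            agree-sym (put-agree (agree-sym a′) eq) , h))
      ...   | false = ⊥-elim (nf (W , D , (λ x l → a x (≤-trans l (m≤n⊔m T T′))) ,
            agree-sym (put-agree (agree-sym a′) eq) , h))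

      Γ₂-local : ∀ Z W k → AgreeUpTo k Z W → Γ₂ Z k → Γ₂ W k
      Γ₂-local Z W k a g T = let (V , D , x , y , h) = g T in V , D , x , agree-trans y a , h

      Γ₂-start : ∀ Z → Γ₂ Z 0
      Γ₂-start Z T = let (V , D , x , u , h) = C*-branch T in V , D , x , (λ _ ()) , h

      module G₂ = Greedy (extend C* σ) e₂ Γ₂ e₂-sat Γ₂-local Γ₂-start Γ₂-step

      -- The condition is closed: its instance at `t` involves only the cuts up to `t` and the run
      -- up to time `t`, on which the limit agrees with an actual solution.
      β* : β C* G₂.Z*
      β* = (λ t c → let (W , D , a , a′ , h) = G₂.branch (suc t) (suc t) in
              trans (st-local _ _ t (λ x l → sym (a′ x (m<n⇒m<1+n l)))) (proj₁ h t (trans (a t ≤-refl) c))) ,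
           λ t u n c → let (W , D , a , a′ , h) = G₂.branch (suc t) (suc t) in
              subst (λ s → m ≤ prio s) (st-local _ _ t (λ x l → a′ x (m<n⇒m<1+n l)))
                  (proj₂ h t u n (trans (a u (s≤s (≮⇒≥ n))) c))

      selected : Σ (ℕ → Bool) λ C → Σ (ℕ → Bool) λ Z → Definable σ Z × Unb C × β C Z
      selected = C* , G₂.Z* , Definable-trans {σ} {C*} {G₂.Z*} C*-definable G₂.definable , C*-unb , β*

  module _ (σ : ℕ → ℕ → Bool) (α : Fm) (b : ℕ) (A : Automaton (Vec Bool (suc b)))
    (correct : ∀ ρ σ → Parity ⌊ Sat ρ σ α ⌋ (λ t → Automaton.prio A (Automaton.states A (slice (suc b) σ) t)))
    (Z₀ : ℕ → Bool) where
    open Automaton A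

    select : Parity true (λ t → prio (states (slice (suc b) (extend Z₀ σ)) t)) →
      Σ (ℕ → Bool) λ Z → Definable σ Z × Sat ρ₀ (extend Z σ) α
    select (m , ev , inf , (T , big)) =
      let (q , inf′) = pigeon-Vec (λ t → prio (states (slice (suc b) (extend Z₀ σ)) t) ≡ m) (states (slice (suc b) (extend Z₀ σ))) inf
      in recurring q inf′
      where
      module _ (q : Vec Bool dim)
        (inf′ : Inf (λ t → prio (states (slice (suc b) (extend Z₀ σ)) t) ≡ m × states (slice (suc b) (extend Z₀ σ)) t ≡ q)) where
        open Selection σ b dim start δ prio q m
        C₀ : ℕ → Bool
        C₀ t = ⌊ T ≤ t × st Z₀ t ≡ q ⌋
        prio-q : prio q ≡ m
        prio-q with inf′ 0
        ... | t , _ , e , e′ = trans (cong prio (sym e′)) e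
        unb₀ : Unb C₀
        unb₀ x with inf′ (suc x ⊔ T)
        ... | y , l , _ , e = y , ≤-trans (m≤m⊔n (suc x) T) l , ⌊⌋-true (≤-trans (m≤n⊔m (suc x) T) l , e)
        β₀ : β C₀ Z₀
        β₀ = (λ t c → proj₂ (true-⌊⌋ c)) , λ t u n c → big t (≤-trans (proj₁ (true-⌊⌋ c)) (≮⇒≥ n))
        -- Unboundedly many cuts make `q`, hence the priority `m`, recur, and from the first cut on
        -- no priority is smaller: the run on `Z` accepts.
        finish : (Σ (ℕ → Bool) λ C → Σ (ℕ → Bool) λ Z → Definable σ Z × Unb C × β C Z) → Σ (ℕ → Bool) λ Z →
            Definable σ Z × Sat ρ₀ (extend Z σ) α
        finish (C , Z , D , u , h₁ , h₂) = Z , D , true-⌊⌋ (Parity-unique (correct ρ₀ (extend Z σ))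
          (m , ev , (λ N → let (y , l , c) = u N in y , <⇒≤ l , trans (cong prio (h₁ y c)) prio-q) ,
           proj₁ (u 0) , λ t l → h₂ t (proj₁ (u 0)) (≤⇒≯ l) (proj₂ (proj₂ (u 0)))))
        recurring : Σ (ℕ → Bool) λ Z → Definable σ Z × Sat ρ₀ (extend Z σ) α
        recurring = finish (selected Z₀ C₀ unb₀ β₀)

  abstract
    selection : ∀ σ α → FOBelow 0 α → ∀ Z₀ → Sat ρ₀ (extend Z₀ σ) α →
      Σ (ℕ → Bool) λ Z → Definable σ Z × Sat ρ₀ (extend Z σ) α
    selection σ α fo Z₀ s = by (fm-automaton α (suc b) fo (SOBelow-mono α (n≤1+n b) (SOBelow-varBound α)))
      where
      b : ℕ
      b = varBound α
      by : (Σ (Automaton (Vec Bool (suc b))) λ A →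
             ∀ ρ σ → Parity ⌊ Sat ρ σ α ⌋ (λ t → Automaton.prio A (Automaton.states A (slice (suc b) σ) t))) →
           Σ (ℕ → Bool) λ Z → Definable σ Z × Sat ρ₀ (extend Z σ) α
      by (A , correct) = select σ α b A correct Z₀
        (subst (λ x → Parity x (λ t → Automaton.prio A
            (Automaton.states A (slice (suc b) (extend Z₀ σ)) t))) (⌊⌋-true s) (correct ρ₀ (extend Z₀ σ)))

  -- A telescope: each set is defined over the sets of higher index, in the order in which nested
  -- set quantifiers are resolved from the outside.
  DefineAll : ∀ {k} → (ℕ → ℕ → Bool) → Vec Fm k → (ℕ → Vec Bool k) → Set
  DefineAll σ []       w = ⊤
  DefineAll σ (ζ ∷ ζs) w = Defines (extends (λ t → tail (w t)) σ) ζ (λ t → head (w t)) × DefineAll σ ζs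
      (λ t → tail (w t))

  selections : ∀ k σ φ → FOBelow 0 φ → (w : ℕ → Vec Bool k) → Sat ρ₀ (extends w σ) φ →
    Σ (ℕ → Vec Bool k) λ w′ → Σ (Vec Fm k) λ ζs → DefineAll σ ζs w′ × Sat ρ₀ (extends w′ σ) φ
  selections zero    σ φ fo w s = w , [] , tt , s
  selections (suc k) σ φ fo w s =
    let (w′ , ζs , D , (Z₀ , s′)) = selections k σ (∃₂ φ) fo (λ t → tail (w t)) ((λ t → head (w t)) , s)
        (Z , (ζ , d) , s″) = selection (extends w′ σ) φ fo Z₀ s′
    in (λ t → Z t ∷ w′ t) , ζ ∷ ζs , (d , D) , s″

  eliminateAll : ∀ {k} → Vec Fm k → Fm → Fm
  eliminateAll []       φ = φ
  eliminateAll (ζ ∷ ζs) φ = eliminateAll ζs (eliminate ζ φ)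

  eliminateAll-sat : ∀ {k} (ζs : Vec Fm k) φ {w} ρ σ → DefineAll σ ζs w → Sat ρ σ (eliminateAll ζs φ) ⟺
      Sat ρ (extends w σ) φ
  eliminateAll-sat []       φ ρ σ _ = (λ s → s) , λ s → s
  eliminateAll-sat (ζ ∷ ζs) φ ρ σ (d , D) =
      ⟺-trans (eliminateAll-sat ζs (eliminate ζ φ) ρ σ D) (eliminate-sat ζ φ ρ _ d)

  lifts : ℕ → (ℕ → ℕ) → ℕ → ℕ
  lifts zero    f = f
  lifts (suc k) f = lift (lifts k f)

  renAll : ∀ {k} → (ℕ → ℕ) → Vec Fm k → Vec Fm k
  renAll f []                = []
  renAll {suc k} f (ζ ∷ ζs) = ren (lifts k f) ζ ∷ renAll f ζs

  DefineAll-ren : ∀ {k} f (ζs : Vec Fm k) w σ → DefineAll (λ X → σ (f X)) ζs w → DefineAll σ (renAll f ζs) w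
  DefineAll-ren f [] w σ _ = tt
  DefineAll-ren {suc k} f (ζ ∷ ζs) w σ (d , D) =
    (λ ρ → ⟺-trans (Sat-ren ζ (lifts k f) ρ _)
        (⟺-trans (Sat-ext ζ (λ _ → refl) (shift k (λ t → tail (w t)))) (d ρ))) , DefineAll-ren f ζs _ σ D
    where
    shift : ∀ k (w : ℕ → Vec Bool k) X t → extends w σ (lifts k f X) t ≡ extends w (λ X → σ (f X)) X t
    shift zero    w X       t = refl
    shift (suc k) w zero    t = refl
    shift (suc k) w (suc X) t = shift k (λ t → tail (w t)) X t

-- The synthesis game and its definable strategies

module Strategies (em : ExcludedMiddle) where
  open Classical em
  open Recognition em using (take-++; drop-++; size; table; look; look-table)
  open ParityAutomata em
  open Definability em
  open DefinableChoice em
  open import Data.Vec using (Vec; []; _∷_; head; tail; _++_; take; drop)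

  -- Splits the number of a move into its round and its phase; it also extracts one binary digit in
  -- the enumeration of the vertices.
  half : ℕ → ℕ × Bool
  half zero = 0 , false
  half (suc n) with half n
  ... | m , false = m , true
  ... | m , true  = suc m , false

  half-suc : ∀ n {m b} → half n ≡ (m , b) → half (suc n) ≡ (if b then suc m , false else (m , true))
  half-suc n e with half n
  half-suc n refl | m , false = refl
  half-suc n refl | m , true  = refl

  half-double : ∀ m → half (m + m) ≡ (m , false)
  half-double zero = refl
  half-double (suc m) rewrite +-suc m m = half-suc (suc (m + m)) (half-suc (m + m) (half-double m))

  half-bound : ∀ n → n ≤ suc (proj₁ (half n) + proj₁ (half n))
  half-bound n = ≤-trans (go n) (le (proj₂ (half n)))
    where
    val : ℕ × Bool → ℕ
    val (m , b) = m + m + (if b then 1 else 0)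
    go : ∀ n → n ≤ val (half n)
    go zero = z≤n
    go (suc n) with half n | go n
    ... | m , false | l = ≤-trans (s≤s l) (≤-reflexive
          (trans (cong suc (+-identityʳ (m + m))) (+-comm 1 (m + m))))
    ... | m , true  | l = ≤-trans (s≤s l) (≤-reflexive
          (trans (cong suc (trans (+-comm (m + m) 1) (sym (+-suc m m)))) (sym (+-identityʳ _))))
    le : ∀ b → proj₁ (half n) + proj₁ (half n) + (if b then 1 else 0) ≤ suc (proj₁ (half n) + proj₁ (half n))
    le true  = ≤-reflexive (+-comm _ 1)
    le false = ≤-trans (≤-reflexive (+-identityʳ _)) (n≤1+n _)

  enumerate : ∀ k → ℕ → ℕ × Vec Bool k
  enumerate zero    i = i , []
  enumerate (suc k) i = proj₁ (enumerate k (proj₁ (half i))) ,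
      proj₂ (half i) ∷ proj₂ (enumerate k (proj₁ (half i)))

  enumerate-onto : ∀ k v → Σ ℕ λ i → enumerate k i ≡ v
  enumerate-onto zero    (t , [])    = t , refl
  enumerate-onto (suc k) (t , b ∷ v) with enumerate-onto k (t , v)
  ... | j , e = code b , trans (cong (λ h → proj₁ (enumerate k (proj₁ h)) ,
        proj₂ h ∷ proj₂ (enumerate k (proj₁ h))) (half-code b))
                               (cong (λ u → proj₁ u , b ∷ proj₂ u) e)
    where
    code : Bool → ℕ
    code false = j + j
    code true  = suc (j + j)
    half-code : ∀ b → half (code b) ≡ (j , b)
    half-code false = half-double j
    half-code true  = half-suc (j + j) (half-double j)

  Parity-half : ∀ {b} p → Parity b (λ k → p (proj₁ (half k))) → Parity b p
  Parity-half p (m , e , inf , (T , ev)) = m , e , inf′ , T , λ t l →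
      subst (λ h → m ≤ p (proj₁ h)) (half-double t) (ev (t + t) (≤-trans l (m≤m+n t t)))
    where
    inf′ : Inf (λ t → p t ≡ m)
    inf′ N with inf (suc (N + N))
    ... | k , l , q = proj₁ (half k) , ≮⇒≥ (λ lt → <⇒≱ (+-mono-< lt lt) (≤-pred (≤-trans l (half-bound k)))) , q

  -- The environment that `layers` simulates. In it every formula, whatever its free set variables,
  -- speaks of `P` and `U` alone, so the search need not filter its candidates.
  alt : (ℕ → Bool) → (ℕ → Bool) → ℕ → ℕ → Bool
  alt P U zero          = P
  alt P U (suc zero)    = U
  alt P U (suc (suc i)) = alt P U i

  inSet outSet : Bool → ℕ
  inSet true  = 0
  inSet false = 1
  outSet true  = 1
  outSet false = 0

  input output firstOf secondOf : Bool → (ℕ → Bool) → (ℕ → Bool) → ℕ → Bool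
  input true  X Y = X
  input false X Y = Y
  output true  X Y = Y
  output false X Y = X
  firstOf true  U O = U
  firstOf false U O = O
  secondOf true  U O = O
  secondOf false U O = U

  input-≡ : ∀ τ X Y (σ : ℕ → ℕ → Bool) → extend X (extend Y σ) (inSet τ) ≡ input τ X Y
  input-≡ true  X Y σ = refl
  input-≡ false X Y σ = refl

  output-≡ : ∀ τ X Y (σ : ℕ → ℕ → Bool) → extend X (extend Y σ) (outSet τ) ≡ output τ X Y
  output-≡ true  X Y σ = refl
  output-≡ false X Y σ = refl

  input-of : ∀ τ U O → input τ (firstOf τ U O) (secondOf τ U O) ≡ U
  input-of true  U O = refl
  input-of false U O = refl

  output-of : ∀ τ U O → output τ (firstOf τ U O) (secondOf τ U O) ≡ O
  output-of true  U O = refl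
  output-of false U O = refl

  Goal : Bool → Fm → (ℕ → Bool) → (ℕ → Bool) → (ℕ → Bool) → Set
  Goal true  ψ P U O = Holds3 ψ U O P
  Goal false ψ P U O = ¬ Holds3 ψ O U P

  -- The input positions known to player `τ` when it moves in round `n`: player `true` answers the
  -- input of the round, player `false` moves before it.
  Earlier : Bool → ℕ → ℕ → Set
  Earlier true  i n = i ≤ n
  Earlier false i n = i < n

  CausalFor : Bool → ((ℕ → Bool) → ℕ → Bool) → Set
  CausalFor τ O = ∀ n U U′ → (∀ i → Earlier τ i n → U i ≡ U′ i) → O U n ≡ O U′ n

  module Church (ψ : Fm) (ψ-fo : FOBelow 0 ψ) (ψ-so : SOBelow 3 ψ) (P : ℕ → Bool)
    (A : Automaton (Vec Bool 3))
    (correct : ∀ ρ σ → Parity ⌊ Sat ρ σ ψ ⌋ (λ t → Automaton.prio A (Automaton.states A (slice 3 σ) t))) where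
    open Automaton A

    K : ℕ
    K = size (suc dim)

    -- Player `false` chooses before any bit of the round is known; a constant takes the place of
    -- that bit.
    key : Bool → Bool → Vec Bool dim → Vec Bool (suc dim)
    key true  x s = x ∷ s
    key false x s = false ∷ s

    chosen : Bool → Bool → Bool → Bool
    chosen true  x y = y
    chosen false x y = x

    Move : Bool → Bool → Bool → Vec Bool dim → Vec Bool K → Set
    Move τ x y s z = chosen τ x y ≡ look z (key τ x s)

    record Play (τ : Bool) (X Y : ℕ → Bool) (s : ℕ → Vec Bool dim) (z : ℕ → Vec Bool K) : Set where
      constructor play
      field
        init  : s 0 ≡ start
        steps : ∀ t → s (suc t) ≡ δ (s t) (X t ∷ Y t ∷ P t ∷ [])
        moves : ∀ t → Move τ (X t) (Y t) (s t) (z t)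

    Holds : (ℕ → Bool) → (ℕ → Bool) → Set
    Holds X Y = Holds3 ψ X Y P

    Wins : Bool → (ℕ → Bool) → (ℕ → Bool) → Set
    Wins true  X Y = Holds X Y
    Wins false X Y = ¬ Holds X Y

    wins : ∀ τ X Y → ⌊ Holds X Y ⌋ ≡ τ → Wins τ X Y
    wins true  X Y e = true-⌊⌋ e
    wins false X Y e h with trans (sym (⌊⌋-true h)) e
    ... | ()

    V : Set
    V = ℕ × Vec Bool (suc (suc dim))

    own : V → Bool
    own (t , ph ∷ _) = ph

    succ : V → Bool → V
    succ (t , false ∷ _ ∷ q) b = t , true ∷ b ∷ q
    succ (t , true ∷ x ∷ q)  b = suc t , false ∷ false ∷ δ q (x ∷ b ∷ P t ∷ [])

    pr : V → ℕ
    pr (t , _ ∷ _ ∷ q) = prio q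

    open ParityGames em V own succ pr (enumerate _) (enumerate-onto _)

    v₀ : V
    v₀ = 0 , false ∷ false ∷ start

    stays : ∀ {τ W f} → WinReg τ (λ _ → true) W f → ∀ π → Follows τ f π → π 0 ∈ W → ∀ k → π k ∈ W
    stays r π F i zero = i
    stays {τ} {W} {f} r π F i (suc k) with F k | own (π k) Data.Bool.≟ τ
    ... | b , e , c | yes o = subst (_∈ W) (sym (trans e (cong (succ (π k)) (c o))))
          (WinReg.mine r (π k) (stays r π F i k) o)
    ... | b , e , c | no o  = subst (_∈ W) (sym e) (WinReg.his r (π k) (stays r π F i k) o b refl)

    strategy-table : Bool → Strategy → ℕ → Vec Bool K
    strategy-table τ f t = table (λ v → f (t , τ ∷ v))

    -- Round `t` takes the moves `2t` and `2t + 1` of the game, both from vertices with the state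
    -- `s t`; repeating each priority does not affect the limit inferior.
    play-won : ∀ τ W f → WinReg τ (λ _ → true) W f → v₀ ∈ W → ∀ X Y s → Play τ X Y s (strategy-table τ f) →
        Wins τ X Y
    play-won τ W f r i X Y s (play s₀ sₛ mv) =
        wins τ X Y (Parity-unique (correct ρ₀ (extend X (extend Y (extend P σ₀))))
        (Parity-cong (λ t → cong prio (s≡ t)) (Parity-half (λ t → prio (s t)) (Parity-cong pr≡ won))))
      where
      s≡ : ∀ t → s t ≡ states (slice 3 (extend X (extend Y (extend P σ₀)))) t
      s≡ zero    = s₀
      s≡ (suc t) = trans (sₛ t) (cong (λ q → δ q (X t ∷ Y t ∷ P t ∷ [])) (s≡ t))
      vertex : ℕ × Bool → V
      vertex (t , false) = t , false ∷ false ∷ s t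
      vertex (t , true)  = t , true ∷ X t ∷ s t
      π : ℕ → V
      π k = vertex (half k)
      mv′ : ∀ τ t → (∀ t → Move τ (X t) (Y t) (s t) (strategy-table τ f t)) →
          chosen τ (X t) (Y t) ≡ f (t , τ ∷ key τ (X t) (s t))
      mv′ τ t mv = trans (mv t) (look-table (λ v → f (t , τ ∷ v)) (key τ (X t) (s t)))
      step : ∀ τ h → (∀ t → Move τ (X t) (Y t) (s t) (strategy-table τ f t)) →
        Σ Bool λ b → vertex (if proj₂ h then suc (proj₁ h) , false else (proj₁ h , true)) ≡ succ (vertex h)
            b × (own (vertex h) ≡ τ → b ≡ f (vertex h))
      step true  (t , false) mv = X t , refl , λ ()
      step true  (t , true)  mv = Y t , cong (λ q → suc t , false ∷ false ∷ q) (sₛ t) , λ _ → mv′ true t mv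
      step false (t , false) mv = X t , refl , λ _ → mv′ false t mv
      step false (t , true)  mv = Y t , cong (λ q → suc t , false ∷ false ∷ q) (sₛ t) , λ ()
      follows : Follows τ f π
      follows k = subst (λ h → Σ Bool λ b → vertex h ≡ succ (π k) b × (own (π k) ≡ τ → b ≡ f (π k)))
          (sym (half-suc k refl)) (step τ (half k) mv)
      won : Parity τ (λ k → pr (π k))
      won = WinReg.win r π (stays r π follows (subst (λ q → (0 , false ∷ false ∷ q) ∈ W) (sym s₀) i)) follows
      pr≡ : ∀ k → pr (π k) ≡ prio (s (proj₁ (half k)))
      pr≡ k with half k
      ... | t , false = refl
      ... | t , true  = refl

    abstract
      positional : Σ Bool λ τ → Σ (ℕ → Vec Bool K) λ z → ∀ X Y s → Play τ X Y s z → Wins τ X Y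
      positional = decide (determinacy (proj₁ (bounded prio)) λ { (t , _ ∷ _ ∷ q) → proj₂ (bounded prio) q })
        where
        decide : Determined (λ _ → true) → Σ Bool λ τ → Σ (ℕ → Vec Bool K) λ z → ∀ X Y s → Play τ X Y s z →
            Wins τ X Y
        decide (W , f , r , cover) with cover v₀ refl
        ... | inj₁ i = true , strategy-table true (f true) , play-won true (W true) (f true) (r true) i
        ... | inj₂ i = false , strategy-table false (f false) , play-won false (W false) (f false) (r false) i

    width : ℕ
    width = suc (suc (dim + (K + 1)))

    xOf yOf pOf : Vec Bool width → Bool
    xOf v = head v
    yOf v = head (tail v)
    pOf v = head (drop K (drop dim (tail (tail v))))

    sOf : Vec Bool width → Vec Bool dim
    sOf v = take dim (tail (tail v))

    zOf : Vec Bool width → Vec Bool K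
    zOf v = take K (drop dim (tail (tail v)))

    module Formulas (τ : Bool) where
      MoveOf : Vec Bool width → Set
      MoveOf v = Move τ (xOf v) (yOf v) (sOf v) (zOf v)

      Init : Vec Bool width → Set
      Init v = sOf v ≡ start × MoveOf v

      Step : Vec Bool width → Vec Bool width → Set
      Step u v = sOf v ≡ δ (sOf u) (xOf u ∷ yOf u ∷ pOf u ∷ []) × MoveOf v

      play′ : Fm
      play′ = local width Init Step

      env : (X Y : ℕ → Bool) (s : ℕ → Vec Bool dim) (z : ℕ → Vec Bool K) → (ℕ → ℕ → Bool) → ℕ → ℕ → Bool
      env X Y s z σ = extend X (extend Y (extends s (extends z σ)))

      module _ (X Y : ℕ → Bool) (s : ℕ → Vec Bool dim) (z : ℕ → Vec Bool K) (σ : ℕ → ℕ → Bool) where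
        rest : ∀ t → slice (dim + (K + 1)) (extends s (extends z σ)) t ≡ s t ++ (z t ++ slice 1 σ t)
        rest t = trans (slice-extends (K + 1) s (extends z σ) t) (cong (s t ++_) (slice-extends 1 z σ t))

        s≡ : ∀ t → sOf (slice width (env X Y s z σ) t) ≡ s t
        s≡ t = trans (cong (take dim) (rest t)) (take-++ (s t) _)

        z≡ : ∀ t → zOf (slice width (env X Y s z σ) t) ≡ z t
        z≡ t = trans (cong (λ v → take K (drop dim v)) (rest t))
            (trans (cong (take K) (drop-++ (s t) _)) (take-++ (z t) _))

        p≡ : ∀ t → pOf (slice width (env X Y s z σ) t) ≡ σ 0 t
        p≡ t = trans (cong (λ v → head (drop K (drop dim v))) (rest t))
                 (trans (cong (λ v → head (drop K v)) (drop-++ (s t) _)) (cong head (drop-++ (z t) _)))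

        move≡ : ∀ t → MoveOf (slice width (env X Y s z σ) t) ⟺ Move τ (X t) (Y t) (s t) (z t)
        move≡ t rewrite s≡ t | z≡ t = (λ m → m) , λ m → m

        play-sat : ∀ ρ → (∀ t → σ 0 t ≡ P t) → Sat ρ (env X Y s z σ) play′ ⟺ Play τ X Y s z
        play-sat ρ p = ⟺-trans (local-sat width Init Step ρ (env X Y s z σ)) (to , from)
          where
          step≡ : ∀ t → δ (sOf (slice width (env X Y s z σ) t))
              (X t ∷ Y t ∷ pOf (slice width (env X Y s z σ) t) ∷ []) ≡ δ (s t) (X t ∷ Y t ∷ P t ∷ [])
          step≡ t = cong₂ (λ q b → δ q (X t ∷ Y t ∷ b ∷ [])) (s≡ t) (trans (p≡ t) (p t))
          to : _ → Play τ X Y s z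
          to ((i , m) , r) = play (trans (sym (s≡ 0)) i)
              (λ t → trans (sym (s≡ (suc t))) (trans (proj₁ (r t)) (step≡ t)))
            λ { zero → proj₁ (move≡ 0) m ; (suc t) → proj₁ (move≡ (suc t)) (proj₂ (r t)) }
          from : Play τ X Y s z → _
          from (play i r m) = (trans (s≡ 0) i , proj₂ (move≡ 0) (m 0)) ,
            λ t → trans (s≡ (suc t)) (trans (r t) (sym (step≡ t))) , proj₂ (move≡ (suc t)) (m (suc t))

        base : ∀ i → env X Y s z σ (suc (suc (dim + (K + i)))) ≡ σ i
        base i = trans (extends-+ s (extends z σ) (K + i)) (extends-+ z σ i)

      -- `P` is found behind `X`, `Y`, the `dim` tracks of the run and the `K` tracks of the
      -- strategy.
      g : ℕ → ℕ
      g zero          = 0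
      g (suc zero)    = 1
      g (suc (suc i)) = suc (suc (dim + (K + i)))

      ψ-sat : ∀ X Y s z σ ρ → (∀ t → σ 0 t ≡ P t) → Sat ρ (env X Y s z σ) (ren g ψ) ⟺ Holds X Y
      ψ-sat X Y s z σ ρ p = ⟺-trans (Sat-ren ψ g ρ (env X Y s z σ))
        (Sat-agree ψ ρ ρ₀ _ _ ψ-fo ψ-so (λ x ()) λ
          { zero l t → refl ; (suc zero) l t → refl
          ; (suc (suc zero)) l t → trans (cong (λ S → S t) (base X Y s z σ 0)) (p t)
          ; (suc (suc (suc X))) (s≤s (s≤s (s≤s ()))) t })

      bad : Bool → Fm
      bad true  = ¬′ ren g ψ
      bad false = ren g ψ

      bad-sat : ∀ τ X Y s z σ ρ → (∀ t → σ 0 t ≡ P t) → ¬ Sat ρ (env X Y s z σ) (bad τ) ⟺ Wins τ X Y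
      bad-sat true  X Y s z σ ρ p = (λ n → ¬¬-elim λ m → n λ y → m (proj₁ (ψ-sat X Y s z σ ρ p) y)) ,
          λ h n → n (proj₂ (ψ-sat X Y s z σ ρ p) h)
      bad-sat false X Y s z σ ρ p = (λ n h → n (proj₂ (ψ-sat X Y s z σ ρ p) h)) , λ n h →
          n (proj₁ (ψ-sat X Y s z σ ρ p) h)

      winning′ : Fm
      winning′ = ¬′ ∃₂^ dim (∃₂ (∃₂ (play′ ∧′ bad τ)))

      winning-sat : ∀ ρ z σ → (∀ t → σ 0 t ≡ P t) → Sat ρ (extends z σ) winning′ ⟺
          (∀ X Y s → Play τ X Y s z → Wins τ X Y)
      winning-sat ρ z σ p =
        (λ n X Y s pl → proj₁ (bad-sat τ X Y s z σ ρ p) λ b →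
            n (∃₂^-intro dim s (Y , X , proj₂ (play-sat X Y s z σ ρ p) pl , b))) ,
        λ h x → refute h (∃₂^-elim dim x)
        where
        refute : (∀ X Y s → Play τ X Y s z → Wins τ X Y) →
          (Σ (ℕ → Vec Bool dim) λ s → Sat ρ (extends s (extends z σ)) (∃₂ (∃₂ (play′ ∧′ bad τ)))) → ⊥
        refute h (s , Y , X , pl , b) = proj₂ (bad-sat τ X Y s z σ ρ p)
            (h X Y s (proj₁ (play-sat X Y s z σ ρ p) pl)) b

      winning-fo : FOBelow 0 winning′
      winning-fo = FOBelow-∃₂^ dim (∃₂ (∃₂ (play′ ∧′ bad τ))) (FOBelow-local width Init Step , bad-fo τ)
        where
        bad-fo : ∀ τ → FOBelow 0 (bad τ)
        bad-fo true  = FOBelow-ren ψ g ψ-fo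
        bad-fo false = FOBelow-ren ψ g ψ-fo

    letter : Bool → Bool → Bool → ℕ → Vec Bool 3
    letter true  u o t = u ∷ o ∷ P t ∷ []
    letter false u o t = o ∷ u ∷ P t ∷ []

    module Operator (τ : Bool) (z : ℕ → Vec Bool K) where
      st : (ℕ → Bool) → ℕ → Vec Bool dim
      st U zero    = start
      st U (suc t) = δ (st U t) (letter τ (U t) (look (z t) (key τ (U t) (st U t))) t)

      O : (ℕ → Bool) → ℕ → Bool
      O U t = look (z t) (key τ (U t) (st U t))

    open Operator

    operator-play : ∀ τ z U → Play τ (firstOf τ U (O τ z U)) (secondOf τ U (O τ z U)) (st τ z U) z
    operator-play true  z U = play refl (λ _ → refl) (λ _ → refl)
    operator-play false z U = play refl (λ _ → refl) (λ _ → refl)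

    operator-goal : ∀ τ z → (∀ X Y s → Play τ X Y s z → Wins τ X Y) → ∀ U → Goal τ ψ P U (O τ z U)
    operator-goal true  z w U = w _ _ _ (operator-play true z U)
    operator-goal false z w U = w _ _ _ (operator-play false z U)

    -- Input and strategy determine the play round by round, so that a formula quantifying over
    -- plays defines the operator.
    play-unique : ∀ τ X Y s z U → Play τ X Y s z → (∀ t → input τ X Y t ≡ U t) → ∀ t →
        s t ≡ st τ z U t × output τ X Y t ≡ O τ z U t
    play-unique τ X Y s z U (play i r m) e t = state t , outs τ t m e (state t)
      where
      outs : ∀ τ t → (∀ t → Move τ (X t) (Y t) (s t) (z t)) → (∀ t → input τ X Y t ≡ U t) →
          s t ≡ st τ z U t → output τ X Y t ≡ O τ z U t
      outs true  t m e h = trans (m t) (cong₂ (λ u q → look (z t) (u ∷ q)) (e t) h)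
      outs false t m e h = trans (m t) (cong (λ q → look (z t) (false ∷ q)) h)
      letters : ∀ τ t → input τ X Y t ≡ U t → output τ X Y t ≡ O τ z U t →
          X t ∷ Y t ∷ P t ∷ [] ≡ letter τ (U t) (O τ z U t) t
      letters true  t a b rewrite a | b = refl
      letters false t a b rewrite a | b = refl
      state : ∀ t → s t ≡ st τ z U t
      state zero    = i
      state (suc t) = trans (r t) (cong₂ δ (state t) (letters τ t (e t) (outs τ t m e (state t))))

    st-cong : ∀ τ z U U′ n → (∀ i → i < n → U i ≡ U′ i) → st τ z U n ≡ st τ z U′ n
    st-cong τ z U U′ zero    h = refl
    st-cong τ z U U′ (suc n) h = cong₂ (λ u q → δ q (letter τ u (look (z n) (key τ u q)) n))
      (h n ≤-refl) (st-cong τ z U U′ n (λ i l → h i (m<n⇒m<1+n l)))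

    operator-causal : ∀ τ z → CausalFor τ (O τ z)
    operator-causal true  z n U U′ h = cong₂ (λ u q → look (z n) (u ∷ q)) (h n ≤-refl)
        (st-cong true z U U′ n λ i l → h i (<⇒≤ l))
    operator-causal false z n U U′ h = cong (λ q → look (z n) (false ∷ q)) (st-cong false z U U′ n h)

    module OperatorFormula (τ : Bool) (z : ℕ → Vec Bool K) (ζs : Vec Fm K) (D : DefineAll (λ _ → P) ζs z) where
      open Formulas τ

      body : Fm
      body = play′ ∧′ (∀₁ ((0 ∈′ inSet τ) ⇔′ (0 ∈′ suc (suc (dim + (K + 1))))) ∧′ (0 ∈′ outSet τ))

      -- The sets of the strategy were defined over an environment that is constantly `P`; sending
      -- all its indices to 0 fits these definitions into `alt P U`.
      operator′ : Fm
      operator′ = eliminateAll (renAll (λ _ → 0) ζs) (∃₂^ dim (∃₂ (∃₂ body)))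

      operator-sat : ∀ U ρ → Sat ρ (alt P U) operator′ ⟺ O τ z U (ρ 0) ≡ true
      operator-sat U ρ = ⟺-trans (eliminateAll-sat (renAll (λ _ → 0) ζs) _ ρ (alt P U)
          (DefineAll-ren (λ _ → 0) ζs z (alt P U) D))
          ((λ x → to (∃₂^-elim dim x)) , from)
        where
        σ : ℕ → ℕ → Bool
        σ = alt P U
        env-in : ∀ X Y s t → env X Y s z σ (inSet τ) t ≡ input τ X Y t
        env-in X Y s t = cong (λ S → S t) (input-≡ τ X Y (extends s (extends z σ)))
        env-out : ∀ X Y s t → env X Y s z σ (outSet τ) t ≡ output τ X Y t
        env-out X Y s t = cong (λ S → S t) (output-≡ τ X Y (extends s (extends z σ)))
        base₁ : ∀ X Y s t → env X Y s z σ (suc (suc (dim + (K + 1)))) t ≡ U t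
        base₁ X Y s t = cong (λ S → S t) (base X Y s z σ 1)
        to : (Σ (ℕ → Vec Bool dim) λ s → Sat ρ (extends s (extends z σ)) (∃₂ (∃₂ body))) → O τ z U (ρ 0) ≡ true
        to (s , Y , X , pl , same , o) = trans (sym
            (proj₂ (play-unique τ X Y s z U (proj₁ (play-sat X Y s z σ ρ (λ _ → refl)) pl)
            (λ t → trans (sym (env-in X Y s t)) (trans (true-⟺ (proj₁ ⇔-sat (proj₁ ∀-sat same t)))
                (base₁ X Y s t))) (ρ 0))))
          (trans (sym (env-out X Y s (ρ 0))) o)
        from : O τ z U (ρ 0) ≡ true → Sat ρ (extends z σ) (∃₂^ dim (∃₂ (∃₂ body)))
        from o = ∃₂^-intro dim s (Y , X , proj₂ (play-sat X Y s z σ ρ (λ _ → refl)) (operator-play τ z U) ,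
            proj₂ ∀-sat (λ t → proj₂ ⇔-sat (subst (λ b → env X Y s z σ (inSet τ) t ≡ true ⟺ b ≡ true)
                (same t) ((λ e → e) , λ e → e))) ,
            trans (env-out X Y s (ρ 0)) (trans (cong (λ S → S (ρ 0)) (output-of τ U (O τ z U))) o))
          where
          s = st τ z U
          X = firstOf τ U (O τ z U)
          Y = secondOf τ U (O τ z U)
          same : ∀ t → env X Y s z σ (inSet τ) t ≡ env X Y s z σ (suc (suc (dim + (K + 1)))) t
          same t = trans (env-in X Y s t) (trans (cong (λ S → S t) (input-of τ U (O τ z U)))
              (sym (base₁ X Y s t)))

  DefinableStrategy : Fm → (ℕ → Bool) → Set
  DefinableStrategy ψ P = Σ Bool λ τ → Σ Fm λ c → Σ ((ℕ → Bool) → ℕ → Bool) λ O →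
    (∀ U ρ → Sat ρ (alt P U) c ⟺ O U (ρ 0) ≡ true) × CausalFor τ O × (∀ U → Goal τ ψ P U (O U))

  module _ (ψ : Fm) (ψ-fo : FOBelow 0 ψ) (ψ-so : SOBelow 3 ψ) (P : ℕ → Bool) where
    private
      module _ (A : Automaton (Vec Bool 3))
        (correct : ∀ ρ σ → Parity ⌊ Sat ρ σ ψ ⌋ (λ t → Automaton.prio A (Automaton.states A (slice 3 σ) t))) where
        open Church ψ ψ-fo ψ-so P A correct

        fromSelected : ∀ τ → (Σ (ℕ → Vec Bool K) λ z → Σ (Vec Fm K) λ ζs →
            DefineAll (λ _ → P) ζs z × Sat ρ₀ (extends z (λ _ → P)) (Formulas.winning′ τ)) →
          DefinableStrategy ψ P
        fromSelected τ (z , ζs , D , w) = τ , operator′ , Operator.O τ z , operator-sat , operator-causal τ z ,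
            operator-goal τ z (proj₁ (Formulas.winning-sat τ ρ₀ z (λ _ → P) (λ _ → refl)) w)
          where open OperatorFormula τ z ζs D

        fromPositional : (Σ Bool λ τ → Σ (ℕ → Vec Bool K) λ z → ∀ X Y s → Play τ X Y s z → Wins τ X Y) →
            DefinableStrategy ψ P
        fromPositional (τ , z , h) = fromSelected τ
            (selections K (λ _ → P) winning′ winning-fo z (proj₂ (winning-sat ρ₀ z (λ _ → P) (λ _ → refl)) h))
          where open Formulas τ

    abstract
      definable-strategy : DefinableStrategy ψ P
      definable-strategy = let (A , correct) = fm-automaton ψ 3 ψ-fo ψ-so in
        fromPositional A correct (Church.positional ψ ψ-fo ψ-so P A correct)

-- Sentences that test a candidate and query its values

module Sentences (em : ExcludedMiddle) where
  open Classical em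
  open Definability em
  open Strategies em using (alt; Goal; Earlier; inSet; outSet; input; output; firstOf; secondOf; input-≡; output-≡; input-of; output-of)
  open import Data.List using (List; []; _∷_; map; applyUpTo)

  same′ : ℕ → ℕ → Fm
  same′ X Y = ∀₁ ((0 ∈′ X) ⇔′ (0 ∈′ Y))

  same-sat : ∀ X Y ρ σ → Sat ρ σ (same′ X Y) ⟺ (∀ t → σ X t ≡ σ Y t)
  same-sat X Y ρ σ = (λ h t → true-⟺ (proj₁ ⇔-sat (proj₁ ∀-sat h t))) ,
    λ e → proj₂ ∀-sat λ t → proj₂ ⇔-sat ((λ h → trans (sym (e t)) h) , λ h → trans (e t) h)

  0<1+ : ∀ {n} → 0 < suc n
  0<1+ = s≤s z≤n

  1<2+ : ∀ {n} → 1 < suc (suc n)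
  1<2+ = s≤s 0<1+

  same-fo : ∀ X Y {a} → FOBelow a (same′ X Y)
  same-fo X Y = (0<1+ , 0<1+) , (0<1+ , 0<1+)

  same-so : ∀ {X Y b} → X < b → Y < b → SOBelow b (same′ X Y)
  same-so x y = (x , y) , (y , x)

  equal′ : Fm
  equal′ = (¬′ (0 <′ 1)) ∧′ (¬′ (1 <′ 0))

  layer : Fm → Fm
  layer φ = ∃₂ (same′ 0 2 ∧′ ∃₂ (same′ 0 2 ∧′ ∃₁ (equal′ ∧′ φ)))

  layer-sat : ∀ φ ρ σ → Sat ρ σ (layer φ) ⟺ Sat (extend (ρ 0) ρ) (extend (σ 0) (extend (σ 1) σ)) φ
  layer-sat φ ρ σ = to , from
    where
    to : Sat ρ σ (layer φ) → _
    to (U , e , P , e′ , n , (a , b) , s) = proj₁ (Sat-ext φ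
      (λ { zero → ≤-antisym (≮⇒≥ b) (≮⇒≥ a) ; (suc x) → refl })
      λ { zero t → proj₁ (same-sat 0 2 ρ (extend P (extend U σ))) e′ t ; (suc zero) t →
          proj₁ (same-sat 0 2 ρ (extend U σ)) e t ; (suc (suc X)) t → refl }) s
    from : _ → Sat ρ σ (layer φ)
    from s = σ 1 , proj₂ (same-sat 0 2 ρ (extend (σ 1) σ)) (λ _ → refl) , σ 0 ,
        proj₂ (same-sat 0 2 ρ (extend (σ 0) (extend (σ 1) σ))) (λ _ → refl) ,
      ρ 0 , (<-irrefl refl , <-irrefl refl) , s

  layer-fo : ∀ φ {a} → FOBelow (suc (suc a)) φ → FOBelow (suc a) (layer φ)
  layer-fo φ p = same-fo 0 2 , same-fo 0 2 , ((0<1+ , 1<2+) , (1<2+ , 0<1+)) , p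

  layer-so : ∀ φ {b} → SOBelow (suc (suc (suc (suc b)))) φ → SOBelow (suc (suc b)) (layer φ)
  layer-so φ p = same-so 0<1+ (s≤s 1<2+) , same-so 0<1+ (s≤s 1<2+) , (tt , tt) , p

  -- Each layer rebinds variable 0 and two set variables to copies of those already present, so
  -- that D layers bind every variable of a formula with indices at most D.
  layers : ℕ → Fm → Fm
  layers zero    φ = φ
  layers (suc D) φ = layers D (layer φ)

  layers-fo : ∀ D φ → FOBelow (suc D) φ → FOBelow 1 (layers D φ)
  layers-fo zero    φ p = p
  layers-fo (suc D) φ p = layers-fo D (layer φ) (layer-fo φ p)

  layers-so : ∀ D φ → SOBelow (suc (suc D)) φ → SOBelow 2 (layers D φ)
  layers-so zero    φ p = p
  layers-so (suc D) φ p = layers-so D (layer φ) (layer-so φ (SOBelow-mono φ (n≤1+n _) p))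

  layers-sat : ∀ D φ ρ σ → FOBelow (suc D) φ → SOBelow (suc (suc D)) φ →
    Sat ρ σ (layers D φ) ⟺ Sat (λ _ → ρ 0) (alt (σ 0) (σ 1)) φ
  layers-sat zero φ ρ σ fo so = Sat-agree φ ρ _ σ _ fo so (λ { zero l → refl ; (suc x) (s≤s ()) })
    λ { zero l t → refl ; (suc zero) l t → refl ; (suc (suc X)) (s≤s (s≤s ())) t }
  layers-sat (suc D) φ ρ σ fo so = ⟺-trans
    (layers-sat D (layer φ) ρ σ (layer-fo φ fo) (layer-so φ (SOBelow-mono φ (n≤1+n _) so)))
    (⟺-trans (layer-sat φ _ _) (Sat-ext φ (λ { zero → refl ; (suc x) → refl })
        λ { zero t → refl ; (suc zero) t → refl ; (suc (suc X)) t → refl }))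

  early′ : Bool → Fm
  early′ true  = ¬′ (1 <′ 0)
  early′ false = 0 <′ 1

  early-sat : ∀ τ m n ρ σ → Sat (extend m (extend n ρ)) σ (early′ τ) ⟺ Earlier τ m n
  early-sat true  m n ρ σ = ≮⇒≥ , ≤⇒≯
  early-sat false m n ρ σ = (λ l → l) , λ l → l

  truncate : Bool → (ℕ → Bool) → ℕ → ℕ → Bool
  truncate τ U n m = ⌊ U m ≡ true × Earlier τ m n ⌋

  -- Rebinding `P` after the truncated input brings the two to the indices 0 and 1 that `φ` expects;
  -- index 4 is `P` behind `X`, `Y` and the two new sets.
  op : Bool → Fm → Fm
  op τ φ = ∃₂ (∀₁ ((0 ∈′ 0) ⇔′ ((0 ∈′ suc (inSet τ)) ∧′ early′ τ)) ∧′ ∃₂ (same′ 0 4 ∧′ φ))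

  op-fo : ∀ τ φ → FOBelow 1 φ → FOBelow 1 (op τ φ)
  op-fo true  φ p = ((0<1+ , 0<1+ , 1<2+ , 0<1+) , ((0<1+ , 1<2+ , 0<1+) , 0<1+)) , same-fo 0 4 , p
  op-fo false φ p = ((0<1+ , 0<1+ , 0<1+ , 1<2+) , ((0<1+ , 0<1+ , 1<2+) , 0<1+)) , same-fo 0 4 , p

  op-so : ∀ τ φ → SOBelow 2 φ → SOBelow 3 (op τ φ)
  op-so true  φ p = ((0<1+ , 1<2+ , tt) , ((1<2+ , tt) , 0<1+)) , same-so 0<1+ ≤-refl ,
      SOBelow-mono φ (s≤s (s≤s z≤n)) p
  op-so false φ p = ((0<1+ , s≤s 1<2+ , tt) , ((s≤s 1<2+ , tt) , 0<1+)) , same-so 0<1+ ≤-refl ,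
      SOBelow-mono φ (s≤s (s≤s z≤n)) p

  op-sat : ∀ τ φ ρ X Y P σ → SOBelow 2 φ → FOBelow 1 φ → Sat ρ (extend X (extend Y (extend P σ))) (op τ φ) ⟺
    Sat (λ _ → ρ 0) (extend P (λ _ → truncate τ (input τ X Y) (ρ 0))) φ
  op-sat τ φ ρ X Y P σ so fo = to , from
    where
    n = ρ 0
    σ₃ : ℕ → ℕ → Bool
    σ₃ = extend X (extend Y (extend P σ))
    agree : ∀ U P′ → (∀ t → P′ t ≡ P t) → (∀ t → U t ≡ truncate τ (input τ X Y) n t) →
      Sat ρ (extend P′ (extend U σ₃)) φ ⟺ Sat (λ _ → ρ 0) (extend P (λ _ → truncate τ (input τ X Y) n)) φ
    agree U P′ e e′ = Sat-agree φ _ _ _ _ fo so (λ { zero l → refl ; (suc x) (s≤s ()) })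
      λ { zero l t → e t ; (suc zero) l t → e′ t ; (suc (suc X)) (s≤s (s≤s ())) t }
    member : ∀ U t → Sat (extend t ρ) (extend U σ₃) ((0 ∈′ suc (inSet τ)) ∧′ early′ τ) ⟺
        truncate τ (input τ X Y) n t ≡ true
    member U t = (λ { (a , b) → ⌊⌋-true (trans (cong (λ S → S t) (sym (input-≡ τ X Y (extend P σ)))) a ,
        proj₁ ea b) }) ,
      λ h → trans (cong (λ S → S t) (input-≡ τ X Y (extend P σ))) (proj₁ (true-⌊⌋ h)) ,
          proj₂ ea (proj₂ (true-⌊⌋ h))
      where
      ea : Sat (extend t ρ) (extend U σ₃) (early′ τ) ⟺ Earlier τ t n
      ea = ⟺-trans (Sat-ext (early′ τ) (λ { zero → refl ; (suc x) → sym (extend-η x) }) (λ _ _ → refl))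
          (early-sat τ t n (λ x → ρ (suc x)) (extend U σ₃))
        where
        extend-η : ∀ x → extend (ρ 0) (λ x → ρ (suc x)) x ≡ ρ x
        extend-η zero    = refl
        extend-η (suc x) = refl
    to : _ → _
    to (U , e , P′ , e′ , s) = proj₁ (agree U P′ (proj₁ (same-sat 0 4 ρ (extend P′ (extend U σ₃))) e′)
      (λ t → true-⟺ (⟺-trans (proj₁ ⇔-sat (proj₁ ∀-sat e t)) (member U t)))) s
    from : _ → _
    from s = U , proj₂ ∀-sat (λ t → proj₂ ⇔-sat (⟺-sym (member U t))) , P ,
        proj₂ (same-sat 0 4 ρ (extend P (extend U σ₃))) (λ _ → refl) ,
            proj₂ (agree U P (λ _ → refl) (λ _ → refl)) s
      where U = truncate τ (input τ X Y) n

  badFor : Bool → Fm → Fm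
  badFor true  ψ = ¬′ ψ
  badFor false ψ = ψ

  test : Bool → Fm → Fm → Fm
  test τ ψ o = ¬′ ∃₂ (∃₂ (∀₁ ((0 ∈′ outSet τ) ⇔′ o) ∧′ badFor τ ψ))

  test-sentence : ∀ τ ψ o → Fm3 ψ → FOBelow 1 o → SOBelow 3 o → Sentence (test τ ψ o)
  test-sentence true  ψ o (fo , so) fo′ so′ = (((0<1+ , fo′) , (fo′ , 0<1+)) , fo) ,
      (((1<2+ , so′) , (so′ , 1<2+)) , so)
  test-sentence false ψ o (fo , so) fo′ so′ = (((0<1+ , fo′) , (fo′ , 0<1+)) , fo) ,
      (((0<1+ , so′) , (so′ , 0<1+)) , so)

  literal : Bool → Bool → Fm
  literal τ true  = 0 ∈′ inSet τ
  literal τ false = ¬′ (0 ∈′ inSet τ)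

  -- The description ends one position past the last letter; this steps back to the position whose
  -- output is asked for.
  finish′ : Fm → Fm
  finish′ o = ∃₁ (succ′ 0 1 ∧′ o)

  describe : Bool → Fm → List Bool → Fm
  describe τ o []       = finish′ o
  describe τ o (b ∷ bs) = literal τ b ∧′ ∃₁ (succ′ 1 0 ∧′ describe τ o bs)

  query : Bool → Fm → List Bool → Fm
  query τ o bs = ∃₂ (∃₂ (∃₁ (zero′ 0 ∧′ describe τ o bs)))

  describe-fo : ∀ τ o bs {a} → FOBelow 1 o → FOBelow (suc a) (describe τ o bs)
  describe-fo τ o [] fo = ((0<1+ , 1<2+) , (1<2+ , 0<1+) , (0<1+ , s≤s 1<2+)) , FOBelow-mono o (s≤s z≤n) fo
  describe-fo τ o (b ∷ bs) fo = lit b , ((1<2+ , 0<1+) , (s≤s 1<2+ , 0<1+) , (0<1+ , 1<2+)) ,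
      describe-fo τ o bs fo
    where
    lit : ∀ b {a} → FOBelow (suc a) (literal τ b)
    lit true  = 0<1+
    lit false = 0<1+

  describe-so : ∀ τ o bs → SOBelow 3 o → SOBelow 3 (describe τ o bs)
  describe-so τ o [] so = (tt , (tt , tt)) , so
  describe-so τ o (b ∷ bs) so = lit τ b , (tt , (tt , tt)) , describe-so τ o bs so
    where
    lit : ∀ τ b → SOBelow 3 (literal τ b)
    lit true  true  = 0<1+
    lit true  false = 0<1+
    lit false true  = 1<2+
    lit false false = 1<2+

  query-sentence : ∀ τ o bs → FOBelow 1 o → SOBelow 3 o → Sentence (query τ o bs)
  query-sentence τ o bs fo so = ((0<1+ , 1<2+) , describe-fo τ o bs fo) , (tt , describe-so τ o bs so)

  literal-sat : ∀ τ b ρ σ → Sat ρ σ (literal τ b) ⟺ σ (inSet τ) (ρ 0) ≡ b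
  literal-sat τ true  ρ σ = (λ s → s) , λ s → s
  literal-sat τ false ρ σ = ¬-not , λ e t → diff (trans (sym e) t)
    where diff : false ≢ true
          diff ()

  -- `f` generalises the identity, because `applyUpTo` recurses by shifting its function.
  describe-sat : ∀ τ o (ω : ℕ → Bool) n k f ρ σ → (∀ i → f i ≡ k + i) → FOBelow 1 o →
    Sat (extend k ρ) σ (describe τ o (map ω (applyUpTo f n))) ⟺
    ((∀ i → i < n → σ (inSet τ) (k + i) ≡ ω (k + i)) × Σ ℕ λ m → suc m ≡ k + n × Sat (λ _ → m) σ o)
  describe-sat τ o ω zero k f ρ σ e fo =
    (λ { (m , s , x) → (λ _ ()) , m , trans (sym (proj₁ (succ-sat m k) s)) (sym (+-identityʳ k)) ,
        proj₁ (ag m) x }) ,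
    λ { (_ , m , s , x) → m , proj₂ (succ-sat m k) (sym (trans s (+-identityʳ k))) , proj₂ (ag m) x }
    where
    ag : ∀ m → Sat (extend m (extend k ρ)) σ o ⟺ Sat (λ _ → m) σ o
    ag m = Sat-agree o _ _ σ σ fo (SOBelow-varBound o) (λ { zero l → refl ; (suc x) (s≤s ()) }) (λ _ _ _ → refl)
  describe-sat τ o ω (suc n) k f ρ σ e fo = to , from
    where
    fk : f 0 ≡ k
    fk = trans (e 0) (+-identityʳ k)
    lit : Sat (extend k ρ) σ (literal τ (ω (f 0))) ⟺ σ (inSet τ) k ≡ ω (f 0)
    lit = literal-sat τ (ω (f 0)) (extend k ρ) σ
    IH : ∀ j → j ≡ suc k → _
    IH j e′ = describe-sat τ o ω n j (λ i → f (suc i)) (extend k ρ) σ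
        (λ i → trans (e (suc i)) (trans (+-suc k i) (cong (_+ i) (sym e′)))) fo
    to : _ → _
    to (l , j , s , x) with proj₁ (succ-sat k j) s
    ... | refl with proj₁ (IH (suc k) refl) x
    ... | h , m , e′ , y = (λ { zero _ → subst (λ u → σ (inSet τ) u ≡ ω u) (sym (+-identityʳ k))
          (trans (proj₁ lit l) (cong ω fk))
                              ; (suc i) (s≤s i<) → subst (λ u → σ (inSet τ) u ≡ ω u) (sym (+-suc k i))
                                  (h i i<) }) ,
                           m , trans e′ (sym (+-suc k n)) , y
    from : _ → _
    from (h , m , e′ , y) = proj₂ lit (trans (subst (λ u → σ (inSet τ) u ≡ ω u) (+-identityʳ k)
        (h 0 (s≤s z≤n))) (cong ω (sym fk))) ,
      suc k , proj₂ (succ-sat k (suc k)) refl ,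
      proj₂ (IH (suc k) refl) ((λ i l → subst (λ u → σ (inSet τ) u ≡ ω u) (+-suc k i) (h (suc i) (s≤s l))) ,
          m , trans e′ (+-suc k n) , y)

  module Candidate (P : ℕ → Bool) (τ : Bool) (D : ℕ) (c : Fm)
    (c-fo : FOBelow (suc D) c) (c-so : SOBelow (suc (suc D)) c) where
    o : Fm
    o = op τ (layers D c)

    o-fo : FOBelow 1 o
    o-fo = op-fo τ (layers D c) (layers-fo D c c-fo)

    o-so : SOBelow 3 o
    o-so = op-so τ (layers D c) (layers-so D c c-so)

    -- Causal for every formula c, which only sees the truncated input.
    O : (ℕ → Bool) → ℕ → Bool
    O U n = ⌊ Sat (λ _ → n) (alt P (truncate τ U n)) c ⌋

    o-sat : ∀ ρ X Y σ → Sat ρ (extend X (extend Y (extend P σ))) o ⟺ O (input τ X Y) (ρ 0) ≡ true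
    o-sat ρ X Y σ = ⟺-trans (op-sat τ (layers D c) ρ X Y P σ (layers-so D c c-so) (layers-fo D c c-fo))
      (⟺-trans (layers-sat D c _ _ c-fo c-so) (⟺-sym ⌊⌋-sat))

    O-cong : ∀ U U′ n → (∀ i → Earlier τ i n → U i ≡ U′ i) → O U n ≡ O U′ n
    O-cong U U′ n h = ⌊⌋-cong (proj₁ s) (proj₂ s)
      where
      tr : ∀ m → truncate τ U n m ≡ truncate τ U′ n m
      tr m = ⌊⌋-cong (λ { (a , b) → trans (sym (h m b)) a , b }) (λ { (a , b) → trans (h m b) a , b })
      alt-cong : ∀ X t → alt P (truncate τ U n) X t ≡ alt P (truncate τ U′ n) X t
      alt-cong zero          t = refl
      alt-cong (suc zero)    t = tr t
      alt-cong (suc (suc X)) t = alt-cong X t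
      s = Sat-ext c {λ _ → n} {λ _ → n} (λ _ → refl) alt-cong

    test-sat : ∀ ψ → TrueIn P (test τ ψ o) ⟺ (∀ U → Goal τ ψ P U (O U))
    test-sat ψ = (λ h U → goal τ U (λ x → h (secondOf τ U (O U) , firstOf τ U (O U) , defines U , x))) ,
        λ { h (Y , X , d , b) → bad⊥ X Y (λ t → true-⟺
            (⟺-trans (out≡ X Y t) (⟺-trans (proj₁ ⇔-sat (proj₁ ∀-sat d t)) (o-sat _ X Y σ₀))))
                (h (input τ X Y)) b }
      where
      out≡ : ∀ X Y t → output τ X Y t ≡ true ⟺ extend X (extend Y (extend P σ₀)) (outSet τ) t ≡ true
      out≡ X Y t = trans (cong (λ S → S t) (output-≡ τ X Y (extend P σ₀))) ,
          trans (cong (λ S → S t) (sym (output-≡ τ X Y (extend P σ₀))))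
      defines : ∀ U → Sat ρ₀ (extend (firstOf τ U (O U)) (extend (secondOf τ U (O U)) (extend P σ₀)))
          (∀₁ ((0 ∈′ outSet τ) ⇔′ o))
      defines U = proj₂ ∀-sat λ t → proj₂ ⇔-sat (⟺-trans (⟺-sym (out≡ _ _ t))
        (⟺-trans (subst (λ S → S t ≡ true ⟺ O U t ≡ true) (sym (output-of τ U (O U))) ((λ e → e) , λ e → e))
          (⟺-sym (subst (λ V → Sat (extend t ρ₀) (extend (firstOf τ U (O U))
              (extend (secondOf τ U (O U)) (extend P σ₀))) o ⟺ O V t ≡ true) (input-of τ U (O U))
                  (o-sat (extend t ρ₀) _ _ σ₀)))))
      goal : ∀ τ U {V} → ¬ Sat ρ₀ (extend (firstOf τ U V) (extend (secondOf τ U V) (extend P σ₀)))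
          (badFor τ ψ) → Goal τ ψ P U V
      goal true  U n = ¬¬-elim n
      goal false U n = n
      bad⊥ : ∀ X Y → (∀ t → output τ X Y t ≡ O (input τ X Y) t) → Goal τ ψ P (input τ X Y) (O (input τ X Y)) →
        ¬ Sat ρ₀ (extend X (extend Y (extend P σ₀))) (badFor τ ψ)
      bad⊥ X Y = go τ (O (input τ X Y))
        where
        go : ∀ τ V → (∀ t → output τ X Y t ≡ V t) → Goal τ ψ P (input τ X Y) V →
            ¬ Sat ρ₀ (extend X (extend Y (extend P σ₀))) (badFor τ ψ)
        go true  V e g n = n (proj₂ (Sat-ext ψ (λ _ → refl)
            λ { zero t → refl ; (suc zero) t → e t ; (suc (suc X)) t → refl }) g)
        go false V e g n = g (proj₁ (Sat-ext ψ (λ _ → refl) λ { zero t → e t ; (suc X) t → refl }) n)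

    -- An existential query suffices: the output at `n` depends only on the described prefix, so any
    -- set beginning with it gives the same answer as `ω`.
    query-sat : ∀ ω n → TrueIn P (query τ o (prefix ω n)) ⟺ O ω n ≡ true
    query-sat ω n = to , from
      where
      to : _ → _
      to (Y , X , z , e , d) with proj₁ (zero-sat z) e
      ... | refl with proj₁ (describe-sat τ o ω (suc n) 0 (λ i → i) ρ₀ (extend X (extend Y (extend P σ₀)))
            (λ _ → refl) o-fo) d
      ... | h , m , refl , x = trans (O-cong ω (input τ X Y) n λ i l →
            sym (trans (cong (λ S → S i) (sym (input-≡ τ X Y (extend P σ₀)))) (h i (s≤s (earlier τ l)))))
                                 (proj₁ (o-sat (λ _ → n) X Y σ₀) x)
        where
        earlier : ∀ τ {i n} → Earlier τ i n → i ≤ n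
        earlier true  l = l
        earlier false l = <⇒≤ l
      from : O ω n ≡ true → _
      from h = ω , ω , 0 , proj₂ (zero-sat 0) refl ,
        proj₂ (describe-sat τ o ω (suc n) 0 (λ i → i) ρ₀ (extend ω (extend ω (extend P σ₀))) (λ _ → refl) o-fo)
          ((λ i _ → cong (λ S → S i) (trans (input-≡ τ ω ω (extend P σ₀)) (in-both τ))) , n , refl ,
           proj₂ (o-sat (λ _ → n) ω ω σ₀) (trans (cong (λ U → O U n) (in-both τ)) h))
        where
        in-both : ∀ τ → input τ ω ω ≡ ω
        in-both true  = refl
        in-both false = refl

-- The program that searches for a winning formula

module SearchProgram (em : ExcludedMiddle) where
  open Classical em
  open While
  open Definability em
  open Sentences em
  open Strategies em using (inSet; outSet; alt; Goal; CausalFor; definable-strategy)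
  open import Data.Maybe using (Maybe; just; nothing)
  open import Data.List using (List; []; _∷_; map; foldl; foldr; replicate; reverse)
  open import Data.List.Properties using (reverse-foldl)
  open import Data.List.Relation.Unary.All using (All; []; _∷_)
  import Data.List.Relation.Unary.All as All
  open import Data.List.Relation.Unary.Any using (here; there)
  open import Data.List.Membership.Propositional using (_∈_)
  open import Data.List.Membership.Propositional.Properties using (∈-++⁺ˡ; ∈-++⁺ʳ)

  cast : ∀ {p i o o′} → o ≡ o′ → p ⊢ i ⇒ o → p ⊢ i ⇒ o′
  cast refl r = r

  foldl-inv : ∀ {A B : Set} (F : B → A → B) (R : B → Set) {xs} → (∀ y {x} → x ∈ xs → R y → R (F y x)) →
      ∀ y → R y → R (foldl F y xs)
  foldl-inv F R {[]}     h y r = r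
  foldl-inv F R {x ∷ xs} h y r = foldl-inv F R (λ y i → h y (there i)) (F y x) (h y (here refl) r)

  -- `I` is maintained until `x` is met, `R` from there on.
  foldl-reach : ∀ {A B : Set} (F : B → A → B) (I R : B → Set) {xs} → (∀ y {x} → x ∈ xs → I y → I (F y x)) →
    (∀ y {x} → x ∈ xs → R y → R (F y x)) → ∀ {x} → x ∈ xs → (∀ y → I y → R (F y x)) → ∀ y → I y → R (foldl F y xs)
  foldl-reach F I R hI h (here refl) k y i = foldl-inv F R (λ y i → h y (there i)) (F y _) (k y i)
  foldl-reach F I R hI h (there m) k y i =
    foldl-reach F I R (λ y i → hI y (there i)) (λ y i → h y (there i)) m k (F y _) (hI y (here refl) i)

  -- A tree paired with the text of an expression that denotes it, so that it can be inserted
  -- into the text of a program.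
  quoted : Tree → Tree
  quoted t = cons t (encExpr (quoteE t))

  -- Templates with two readings, the tree itself and the text of an expression denoting it.
  -- Building both in parallel spares the program from computing `quoteE`.
  data T₀ : Set where
    hole : E₀ → T₀
    kᵀ   : Tree → T₀
    _∙ᵀ_ : T₀ → T₀ → T₀

  infixr 5 _∙ᵀ_

  valᵀ codeᵀ both : T₀ → E₀
  valᵀ (hole e)  = hd₀ e
  valᵀ (kᵀ t)    = con t
  valᵀ (a ∙ᵀ b)  = valᵀ a ∙ valᵀ b
  codeᵀ (hole e) = tl₀ e
  codeᵀ (kᵀ t)   = con (encExpr (quoteE t))
  codeᵀ (a ∙ᵀ b) = con (encℕ 2) ∙ codeᵀ a ∙ codeᵀ b
  both e = valᵀ e ∙ codeᵀ e

  fm : Fm → T₀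
  fm φ = kᵀ (encFm φ)

  ¬ᵀ ∃₁ᵀ ∃₂ᵀ : T₀ → T₀
  ¬ᵀ a  = kᵀ (encℕ 2) ∙ᵀ a
  ∃₁ᵀ a = kᵀ (encℕ 4) ∙ᵀ a
  ∃₂ᵀ a = kᵀ (encℕ 5) ∙ᵀ a

  _∧ᵀ_ : T₀ → T₀ → T₀
  a ∧ᵀ b = kᵀ (encℕ 3) ∙ᵀ a ∙ᵀ b

  _⇔ᵀ_ : T₀ → T₀ → T₀
  a ⇔ᵀ b = ¬ᵀ (a ∧ᵀ ¬ᵀ b) ∧ᵀ ¬ᵀ (b ∧ᵀ ¬ᵀ a)

  ∀₁ᵀ : T₀ → T₀
  ∀₁ᵀ a = ¬ᵀ (∃₁ᵀ (¬ᵀ a))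

  qfm : Fm → Tree
  qfm φ = quoted (encFm φ)

  layerᵀ : T₀ → T₀
  layerᵀ a = ∃₂ᵀ (fm (same′ 0 2) ∧ᵀ ∃₂ᵀ (fm (same′ 0 2) ∧ᵀ ∃₁ᵀ (fm equal′ ∧ᵀ a)))

  opᵀ : Bool → T₀ → T₀
  opᵀ τ a = ∃₂ᵀ (fm (∀₁ ((0 ∈′ 0) ⇔′ ((0 ∈′ suc (inSet τ)) ∧′ early′ τ))) ∧ᵀ ∃₂ᵀ (fm (same′ 0 4) ∧ᵀ a))

  badᵀ : Bool → E₀ → E₀
  badᵀ true  a = con (encℕ 2) ∙ a
  badᵀ false a = a

  testᴱ : Bool → E₀ → T₀ → E₀
  testᴱ τ p o = con (encℕ 2) ∙ con (encℕ 5) ∙ con (encℕ 5) ∙ con (encℕ 3) ∙ valᵀ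
      (∀₁ᵀ (fm (0 ∈′ outSet τ) ⇔ᵀ o)) ∙ badᵀ τ p

  -- The two numbers are a stock of variable indices from which atomic formulas are formed; growing
  -- them in unit steps keeps each round a finite list operation.
  record Item : Set where
    constructor item
    field
      fo so   : ℕ
      formula : Fm
  open Item

  encItem : Item → Tree
  encItem (item x y φ) = cons (quoted (encℕ x)) (cons (quoted (encℕ y)) (qfm φ))

  variants : Item → List Item → List Item
  variants (item x y φ) acc =
    item x y φ ∷ item (suc x) y φ ∷ item x (suc y) φ ∷ item x y (x <′ y) ∷ item x y (x ∈′ y) ∷
    item x y (¬′ φ) ∷ item x y (∃₁ φ) ∷ item x y (∃₂ φ) ∷ acc

  conj : Item → Item → Item
  conj (item x y φ) (item _ _ ψ) = item x y (φ ∧′ ψ)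

  inner : Item × List Item → Item → Item × List Item
  inner (i , acc) j = i , conj i j ∷ acc

  outer : List Item × List Item → Item → List Item × List Item
  outer (L , acc) i = L , proj₂ (foldl inner (i , variants i acc) L)

  round : List Item → List Item
  round L = proj₂ (foldl outer (L , []) L)

  items : ℕ → List Item
  items zero    = item 0 0 (0 <′ 0) ∷ []
  items (suc n) = round (items n)

  -- Bounds the variables by the number of the round, so that in round `n` exactly `n` layers can be
  -- applied to every formula without inspecting it.
  ValidItem : ℕ → Item → Set
  ValidItem n (item x y φ) = x ≤ n × y ≤ n × varBound φ ≤ suc n

  valid-variants : ∀ n i acc → ValidItem n i → All (ValidItem (suc n)) acc →
      All (ValidItem (suc n)) (variants i acc)
  valid-variants n (item x y φ) acc (a , b , c) h =
    (a′ , b′ , c′) ∷ (s≤s a , b′ , c′) ∷ (a′ , s≤s b , c′) ∷ (a′ , b′ , m≤n⇒m≤1+n (⊔-lub (s≤s a) (s≤s b))) ∷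
        (a′ , b′ , m≤n⇒m≤1+n (⊔-lub (s≤s a) (s≤s b))) ∷
    (a′ , b′ , c′) ∷ (a′ , b′ , c′) ∷ (a′ , b′ , c′) ∷ h
    where
    a′ = m≤n⇒m≤1+n a
    b′ = m≤n⇒m≤1+n b
    c′ = m≤n⇒m≤1+n c

  valid-items : ∀ n → All (ValidItem n) (items n)
  valid-items zero    = (z≤n , z≤n , s≤s z≤n) ∷ []
  valid-items (suc n) = proj₂ (foldl-inv outer (λ z → proj₁ z ≡ items n × All (ValidItem (suc n)) (proj₂ z))
      step (items n , []) (refl , []))
    where
    step : ∀ z {i} → i ∈ items n → proj₁ z ≡ items n × All (ValidItem (suc n)) (proj₂ z) →
      proj₁ (outer z i) ≡ items n × All (ValidItem (suc n)) (proj₂ (outer z i))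
    step (L , acc) {i} m (refl , h) = refl , proj₂
        (foldl-inv inner (λ z → proj₁ z ≡ i × All (ValidItem (suc n)) (proj₂ z)) step′
        (i , variants i acc) (refl , valid-variants n i acc vi h))
      where
      vi = All.lookup (valid-items n) m
      step′ : ∀ z {j} → j ∈ items n → proj₁ z ≡ i × All (ValidItem (suc n)) (proj₂ z) →
        proj₁ (inner z j) ≡ i × All (ValidItem (suc n)) (proj₂ (inner z j))
      step′ (item x y φ , acc) {item x′ y′ φ′} m (refl , h) =
        refl , (m≤n⇒m≤1+n (proj₁ vi) , m≤n⇒m≤1+n (proj₁ (proj₂ vi)) ,
                m≤n⇒m≤1+n (⊔-lub (proj₂ (proj₂ vi)) (proj₂ (proj₂ (All.lookup (valid-items n) m))))) ∷ h

  Reached : Item → Set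
  Reached i = Σ ℕ λ n → i ∈ items n

  inner-keeps : ∀ L i acc {j} → j ∈ acc → j ∈ proj₂ (foldl inner (i , acc) L)
  inner-keeps L i acc {j} m = foldl-inv inner (λ z → j ∈ proj₂ z) {L} (λ z _ → there) (i , acc) m

  variants-later : ∀ i {acc j} → j ∈ acc → j ∈ variants i acc
  variants-later (item x y φ) = ∈-++⁺ʳ (variants (item x y φ) [])

  variants-here : ∀ i {acc j} → j ∈ variants i [] → j ∈ variants i acc
  variants-here (item x y φ) = ∈-++⁺ˡ

  outer-keeps : ∀ z i {j} → j ∈ proj₂ z → j ∈ proj₂ (outer z i)
  outer-keeps (L , acc) i h = inner-keeps L i (variants i acc) (variants-later i h)

  variants-in : ∀ n i {j} → i ∈ items n → j ∈ variants i [] → j ∈ items (suc n)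
  variants-in n i {j} m v = foldl-reach outer (λ z → proj₁ z ≡ items n) (λ z → j ∈ proj₂ z) (λ { z _ e → e })
    (λ z {i} _ → outer-keeps z i) m
    (λ { (L , acc) e → inner-keeps L i (variants i acc) (variants-here i v) }) (items n , []) refl

  conj-in : ∀ n i j → i ∈ items n → j ∈ items n → conj i j ∈ items (suc n)
  conj-in n i j m m′ = foldl-reach outer (λ z → proj₁ z ≡ items n) (λ z → conj i j ∈ proj₂ z) (λ { z _ e → e })
    (λ z {i} _ → outer-keeps z i) m
    (λ { (L , acc) refl → foldl-reach inner (λ z → proj₁ z ≡ i) (λ z → conj i j ∈ proj₂ z) (λ { z _ e → e })
        (λ z _ → there) m′
           (λ { (i , acc) refl → here refl }) (i , variants i acc) refl }) (items n , []) refl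

  items-mono : ∀ d n {i} → i ∈ items n → i ∈ items (d + n)
  items-mono zero    n m = m
  items-mono (suc d) n {i} m = variants-in (d + n) i (items-mono d n m) (self i)
    where
    self : ∀ i → i ∈ variants i []
    self (item x y φ) = here refl

  items-≤ : ∀ {m n i} → m ≤ n → i ∈ items m → i ∈ items n
  items-≤ {m} {n} {i} l h = subst (λ n → i ∈ items n) (m∸n+n≡m l) (items-mono (n ∸ m) m h)

  reach-numbers : ∀ x y → Reached (item x y (0 <′ 0))
  reach-numbers zero    zero    = 0 , here refl
  reach-numbers (suc x) zero    = let (n , m) = reach-numbers x zero in suc n , variants-in n _ m (there (here refl))
  reach-numbers x       (suc y) = let (n , m) = reach-numbers x y in suc n , variants-in n _ m (there (there (here refl)))

  reach : ∀ φ → Σ ℕ λ x → Σ ℕ λ y → Reached (item x y φ)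
  reach (x <′ y) = let (n , m) = reach-numbers x y in
    x , y , suc n , variants-in n _ m (there (there (there (here refl))))
  reach (x ∈′ y) = let (n , m) = reach-numbers x y in
    x , y , suc n , variants-in n _ m (there (there (there (there (here refl)))))
  reach (¬′ φ) = let (x , y , n , m) = reach φ in
    x , y , suc n , variants-in n _ m (there (there (there (there (there (here refl))))))
  reach (φ ∧′ ψ) = let (x , y , n , m) = reach φ ; (x′ , y′ , n′ , m′) = reach ψ in
    x , y , suc (n ⊔ n′) , conj-in (n ⊔ n′) _ _ (items-≤ (m≤m⊔n n n′) m) (items-≤ (m≤n⊔m n n′) m′)
  reach (∃₁ φ) = let (x , y , n , m) = reach φ in
    x , y , suc n , variants-in n _ m (there (there (there (there (there (there (here refl)))))))
  reach (∃₂ φ) = let (x , y , n , m) = reach φ in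
    x , y , suc n , variants-in n _ m (there (there (there (there (there (there (there (here refl))))))))

  xᴱ yᴱ φᴱ : E₀ → E₀
  xᴱ e = hd₀ e
  yᴱ e = hd₀ (tl₀ e)
  φᴱ e = tl₀ (tl₀ e)

  itemᴱ : T₀ → T₀ → T₀ → E₀
  itemᴱ x y φ = both x ∙ both y ∙ both φ

  variantsᴱ : E₀ → E₀ → E₀
  variantsᴱ i acc =
    itemᴱ x y φ ∙ itemᴱ (kᵀ nil ∙ᵀ x) y φ ∙ itemᴱ x (kᵀ nil ∙ᵀ y) φ ∙
    itemᴱ x y (kᵀ (encℕ 0) ∙ᵀ x ∙ᵀ y) ∙ itemᴱ x y (kᵀ (encℕ 1) ∙ᵀ x ∙ᵀ y) ∙
    itemᴱ x y (¬ᵀ φ) ∙ itemᴱ x y (∃₁ᵀ φ) ∙ itemᴱ x y (∃₂ᵀ φ) ∙ acc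
    where
    x = hole (xᴱ i)
    y = hole (yᴱ i)
    φ = hole (φᴱ i)

  innerP outerP roundP : Proc
  innerP = expr (hd₀ (tl₀ ●) ∙ itemᴱ (hole (xᴱ i)) (hole (yᴱ i)) (hole (φᴱ i) ∧ᵀ hole (φᴱ (hd₀ ●))) ∙ tl₀ (tl₀ ●))
    where i = hd₀ (tl₀ ●)
  outerP = expr (hd₀ (tl₀ ●) ∙ hd₀ (tl₀ ●) ∙ hd₀ ● ∙ variantsᴱ (hd₀ ●) (tl₀ (tl₀ ●)))
    ⨾ under (foldP innerP ⨾ expr (tl₀ ●))
  roundP = expr (● ∙ ● ∙ con nil) ⨾ foldP outerP ⨾ expr (tl₀ ●)

  encItems : List Item → Tree
  encItems = encList encItem

  ⇒inner : ∀ j i → innerP ⊢ cons (encItem j) (cons (encItem (proj₁ i)) (encItems (proj₂ i))) ⇒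
    cons (encItem (proj₁ (inner i j))) (encItems (proj₂ (inner i j)))
  ⇒inner j (i , acc) = ⇒expr

  ⇒outer : ∀ i L → outerP ⊢ cons (encItem i) (cons (encItems (proj₁ L)) (encItems (proj₂ L))) ⇒
    cons (encItems (proj₁ (outer L i))) (encItems (proj₂ (outer L i)))
  ⇒outer i (L , acc) = ⇒seq ⇒expr (⇒under (⇒seq
    (⇒fold encItem (λ z → cons (encItem (proj₁ z)) (encItems (proj₂ z))) inner ⇒inner L
        (i , variants i acc)) ⇒expr))

  ⇒round : ∀ L → roundP ⊢ encItems L ⇒ encItems (round L)
  ⇒round L = ⇒seq ⇒expr (⇒seq (⇒fold encItem (λ z → cons (encItems (proj₁ z)) (encItems (proj₂ z))) outer
      ⇒outer L (L , [])) ⇒expr)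

  layersP : Proc
  layersP = foldP (expr (both (layerᵀ (hole (tl₀ ●)))))

  foldl-layers : ∀ n φ → foldl (λ φ (_ : ⊤) → layer φ) φ (replicate n tt) ≡ layers n φ
  foldl-layers zero    φ = refl
  foldl-layers (suc n) φ = foldl-layers n (layer φ)

  encℕ-list : ∀ n → encList (λ (_ : ⊤) → nil) (replicate n tt) ≡ encℕ n
  encℕ-list zero    = refl
  encℕ-list (suc n) = cong (cons nil) (encℕ-list n)

  ⇒layers : ∀ n φ → layersP ⊢ cons (encℕ n) (qfm φ) ⇒ qfm (layers n φ)
  ⇒layers n φ = subst (λ t → layersP ⊢ cons t (qfm φ) ⇒ qfm (layers n φ)) (encℕ-list n)
    (cast (cong qfm (foldl-layers n φ)) (⇒fold (λ _ → nil) qfm (λ φ _ → layer φ) (λ x φ → ⇒expr)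
        (replicate n tt) φ))

  module Oracle (P : ℕ → Bool) (a : Prog)
    (oracle : ∀ φ → Sentence φ → Run a (encFm φ) (encBool ⌊ TrueIn P φ ⌋)) where

    describeP : Bool → Proc
    describeP τ = ifP (expr (step true)) (expr (step false))
      where
      step : Bool → E₀
      step b = con (encℕ 3) ∙ con (encFm (literal τ b)) ∙ con (encℕ 4) ∙ con (encℕ 3) ∙ con
          (encFm (succ′ 1 0)) ∙ ●

    ⇒describe : ∀ τ b φ → describeP τ ⊢ cons (encBool b) (encFm φ) ⇒ encFm (literal τ b ∧′ ∃₁ (succ′ 1 0 ∧′ φ))
    ⇒describe τ true  φ = ⇒if-true ⇒expr
    ⇒describe τ false φ = ⇒if-false ⇒expr

    -- The description nests with the first letter outermost, so the prefix is reversed and the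
    -- formula is built from its innermost end.
    answerP : Bool → Proc
    answerP τ = expr (hd₀ ● ∙ tl₀ ● ∙ con nil) ⨾ under (foldP (expr ●))
      ⨾ expr (tl₀ ● ∙ con (encℕ 4) ∙ con (encℕ 3) ∙ con (encFm (succ′ 0 1)) ∙ hd₀ ●)
      ⨾ foldP (describeP τ)
      ⨾ expr (con (encℕ 5) ∙ con (encℕ 5) ∙ con (encℕ 4) ∙ con (encℕ 3) ∙ con (encFm (zero′ 0)) ∙ ●)
      ⨾ call a

    describe-foldr : ∀ τ o bs → foldl (λ φ b → literal τ b ∧′ ∃₁ (succ′ 1 0 ∧′ φ)) (finish′ o) (reverse bs)
        ≡ describe τ o bs
    describe-foldr τ o bs = trans (reverse-foldl _ (finish′ o) bs) (go bs)
      where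
      go : ∀ bs → foldr (λ b φ → literal τ b ∧′ ∃₁ (succ′ 1 0 ∧′ φ)) (finish′ o) bs ≡ describe τ o bs
      go []       = refl
      go (b ∷ bs) = cong (λ φ → literal τ b ∧′ ∃₁ (succ′ 1 0 ∧′ φ)) (go bs)

    ⇒answer : ∀ τ o bs → FOBelow 1 o → SOBelow 3 o →
      answerP τ ⊢ cons (encFm o) (encList encBool bs) ⇒ encBool ⌊ TrueIn P (query τ o bs) ⌋
    ⇒answer τ o bs fo so = ⇒seq ⇒expr (⇒seq (⇒under
        (⇒fold encBool (encList encBool) (λ acc b → b ∷ acc) (λ b acc → ⇒expr) bs []))
      (⇒seq ⇒expr (⇒seq (cast (cong encFm (describe-foldr τ o bs))
          (⇒fold encBool encFm _ (⇒describe τ) (reverse bs) (finish′ o)))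
      (⇒seq ⇒expr (⇒call (oracle (query τ o bs) (query-sentence τ o bs fo so)))))))

    strategyP : Bool → Fm → Proc
    strategyP τ o = expr (con (encFm o) ∙ ●) ⨾ answerP τ

    -- Writes the answer bit and the text of `strategyP`. Only the part for `o` varies; the text of
    -- `answerP`, oracle included, is a constant of the search program.
    resultᴱ : Bool → T₀ → E₀
    resultᴱ τ o = con (encBool τ) ∙ con (encℕ 1) ∙
      (con (encℕ 0) ∙ con (encℕ 0) ∙ con (encℕ 2) ∙ codeᵀ o ∙ con (encExpr (var 0))) ∙ con ⌜ code (answerP τ) ⌝

    result : Bool → Fm → Tree
    result τ o = cons (encBool τ) ⌜ code (strategyP τ o) ⌝

    askP : Bool → Proc
    askP τ = expr (● ∙ testᴱ τ (hd₀ ●) (opᵀ τ (hole (tl₀ ●)))) ⨾ under (call a) ⨾ expr (tl₀ ● ∙ hd₀ ●)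

    tryP : Proc
    tryP = askP true ⨾ ifP (expr (resultᴱ true (opᵀ true (hole (tl₀ ●)))))
      (askP false ⨾ ifP (expr (resultᴱ false (opᵀ false (hole (tl₀ ●))))) (expr (con nil)))

    scanP : Proc
    scanP = expr (tl₀ (tl₀ (tl₀ ●)) ∙ ●) ⨾ ifP (expr (tl₀ ●))
      (expr ((hd₀ (tl₀ ●) ∙ hd₀ (tl₀ (tl₀ ●))) ∙ hd₀ (tl₀ ●) ∙ hd₀ (tl₀ (tl₀ ●)) ∙ φᴱ (hd₀ ●))
        ⨾ under (under layersP ⨾ tryP) ⨾ expr (hd₀ (hd₀ ●) ∙ tl₀ (hd₀ ●) ∙ tl₀ ●))

    -- The state of the loop consists of a flag, the input formula, the number of the round, the
    -- items of the round and the result; the flag is nil once the result is not.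
    bodyP searchP : Proc
    bodyP = expr ((hd₀ (tl₀ ●) ∙ con nil ∙ hd₀ (tl₀ (tl₀ ●))) ∙ hd₀ (tl₀ (tl₀ (tl₀ ●)))) ⨾ under roundP
      ⨾ expr (tl₀ ● ∙ tl₀ ● ∙ hd₀ (hd₀ ●) ∙ tl₀ (hd₀ ●) ∙ con nil) ⨾ under (foldP scanP)
      ⨾ expr ((tl₀ (tl₀ (tl₀ ●)) ≟₀ con nil) ∙ hd₀ (tl₀ ●) ∙ hd₀ (tl₀ (tl₀ ●)) ∙ hd₀ ● ∙ tl₀ (tl₀ (tl₀ ●)))
    searchP = expr (con (encBool true) ∙ ● ∙ con nil ∙ con (encItems (items 0)) ∙ con nil) ⨾ loop bodyP ⨾
        expr (tl₀ (tl₀ (tl₀ (tl₀ ●))))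

    module Scan (ψ : Fm) (ψ3 : Fm3 ψ) where
      passes : Bool → Fm → Bool
      passes τ φ = ⌊ TrueIn P (test τ ψ (op τ φ)) ⌋

      Found : Set
      Found = Σ Bool λ τ → Σ ℕ λ n → Σ Fm λ c →
        FOBelow (suc n) c × SOBelow (suc (suc n)) c × TrueIn P (test τ ψ (op τ (layers n c)))

      encFound : Maybe Found → Tree
      encFound nothing = nil
      encFound (just (τ , n , c , _)) = result τ (op τ (layers n c))

      ⇒ask : ∀ τ φ → FOBelow 1 φ → SOBelow 2 φ → askP τ ⊢ cons (encFm ψ) (qfm φ) ⇒
          cons (encBool (passes τ φ)) (cons (encFm ψ) (qfm φ))
      ⇒ask true φ fo so = ⇒seq ⇒expr (⇒seq (⇒under (⇒call (oracle (test true ψ (op true φ))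
        (test-sentence true ψ (op true φ) ψ3 (op-fo true φ fo) (op-so true φ so))))) ⇒expr)
      ⇒ask false φ fo so = ⇒seq ⇒expr (⇒seq (⇒under (⇒call (oracle (test false ψ (op false φ))
        (test-sentence false ψ (op false φ) ψ3 (op-fo false φ fo) (op-so false φ so))))) ⇒expr)

      Untested : ℕ → Fm → Bool → Set
      Untested n c τ = TrueIn P (test τ ψ (op τ (layers n c))) ⊎ ¬ TrueIn P (test τ ψ (op τ (layers n c)))

      -- The two decisions are arguments, so that the run of `tryP` can be followed by cases on
      -- them.
      attempt : ∀ n c → FOBelow (suc n) c → SOBelow (suc (suc n)) c → Untested n c true →
          Untested n c false → Maybe Found
      attempt n c fo so (inj₁ x) _        = just (true , n , c , fo , so , x)
      attempt n c fo so (inj₂ _) (inj₁ x) = just (false , n , c , fo , so , x)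
      attempt n c fo so (inj₂ _) (inj₂ _) = nothing

      ⇒attempt : ∀ n c fo so d d′ → tryP ⊢ cons (encFm ψ) (qfm (layers n c)) ⇒ encFound (attempt n c fo so d d′)
      ⇒attempt n c fo so d d′ = go d d′
        where
        φ = layers n c
        asked : ∀ τ b → passes τ φ ≡ b → askP τ ⊢ cons (encFm ψ) (qfm φ) ⇒
            cons (encBool b) (cons (encFm ψ) (qfm φ))
        asked τ b e = cast (cong (λ b → cons (encBool b) (cons (encFm ψ) (qfm φ))) e)
            (⇒ask τ φ (layers-fo n c fo) (layers-so n c so))
        go : ∀ d d′ → tryP ⊢ cons (encFm ψ) (qfm φ) ⇒ encFound (attempt n c fo so d d′)
        go (inj₁ x) _        = ⇒seq (asked true true (⌊⌋-true x)) (⇒if-true ⇒expr)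
        go (inj₂ x) (inj₁ y) = ⇒seq (asked true false (⌊⌋-false x))
            (⇒if-false (⇒seq (asked false true (⌊⌋-true y)) (⇒if-true ⇒expr)))
        go (inj₂ x) (inj₂ y) = ⇒seq (asked true false (⌊⌋-false x))
            (⇒if-false (⇒seq (asked false false (⌊⌋-false y)) (⇒if-false ⇒expr)))

      Bounded : ℕ → Fm → Set
      Bounded n c = FOBelow (suc n) c × SOBelow (suc (suc n)) c

      tryItem : ∀ n c → Bounded n c ⊎ ¬ Bounded n c → Maybe Found
      tryItem n c (inj₁ (fo , so)) = attempt n c fo so (em _) (em _)
      tryItem n c (inj₂ _)         = nothing

      scan : ℕ → Maybe Found → Item → Maybe Found
      scan n (just f) i = just f
      scan n nothing  i = tryItem n (formula i) (em _)

      encScan : ℕ → Maybe Found → Tree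
      encScan n r = cons (encFm ψ) (cons (encℕ n) (encFound r))

      ⇒scan : ∀ n i r → Bounded n (formula i) → scanP ⊢ cons (encItem i) (encScan n r) ⇒ encScan n (scan n r i)
      ⇒scan n i (just _) b = ⇒seq ⇒expr (⇒if-true ⇒expr)
      ⇒scan n i nothing  b = ⇒seq ⇒expr (⇒if-false
          (⇒seq ⇒expr (⇒seq (⇒under (⇒seq (⇒under (⇒layers n (formula i))) (tried (em _)))) ⇒expr)))
        where
        tried : ∀ d → tryP ⊢ cons (encFm ψ) (qfm (layers n (formula i))) ⇒ encFound (tryItem n (formula i) d)
        tried (inj₁ (fo , so)) = ⇒attempt n (formula i) fo so (em _) (em _)
        tried (inj₂ nb) = ⊥-elim (nb b)

      scanned : ℕ → Maybe Found
      scanned n = foldl (scan n) nothing (items n)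

      searching : Bool → ℕ → Maybe Found → Tree
      searching b n r = cons (encBool b) (cons (encFm ψ) (cons (encℕ n) (cons (encItems (items n)) (encFound r))))

      valid-bounded : ∀ n i → ValidItem n i → Bounded n (formula i)
      valid-bounded n (item x y φ) (_ , _ , l) = FOBelow-mono φ l (FOBelow-varBound φ) ,
          SOBelow-mono φ (m≤n⇒m≤1+n l) (SOBelow-varBound φ)

      ⇒body : ∀ n r → bodyP ⊢ searching true n r ⇒
        cons (encBool (encFound (scanned (suc n)) ==ᵀ nil))
            (cons (encFm ψ) (cons (encℕ (suc n)) (cons (encItems (items (suc n))) (encFound (scanned (suc n))))))
      ⇒body n r = ⇒seq ⇒expr (⇒seq (⇒under (⇒round (items n))) (⇒seq ⇒expr (⇒seq (⇒under
        (⇒fold-All encItem (encScan (suc n)) (scan (suc n)) (λ i → Bounded (suc n) (formula i))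
            (λ i r b → ⇒scan (suc n) i r b)
          (items (suc n)) nothing (All.map (λ {i} → valid-bounded (suc n) i) (valid-items (suc n))))) ⇒expr)))

      Stops : ℕ → Set
      Stops n = Σ Found λ f → scanned n ≡ just f

      -- `d` serves only as a bound for the recursion; the loop may well end in an earlier round.
      ⇒search : ∀ d n r → Stops (suc d + n) → Σ Found λ f → Σ ℕ λ m → loop bodyP ⊢ searching true n r ⇒
          searching false m (just f)
      ⇒search d n r s with scanned (suc n) in eq
      ... | just f = f , suc n , ⇒loop (cast (cong
            (λ q → cons (encBool (encFound q ==ᵀ nil))
                (cons (encFm ψ) (cons (encℕ (suc n)) (cons (encItems (items (suc n))) (encFound q))))) eq)
                    (⇒body n r)) ⇒stop
      ⇒search zero    n r (f , e) | nothing with trans (sym eq) e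
      ... | ()
      ⇒search (suc d) n r s | nothing with ⇒search d (suc n) nothing (subst Stops (cong suc (sym (+-suc d n))) s)
      ... | f , m , R = f , m , ⇒loop (cast (cong
            (λ q → cons (encBool (encFound q ==ᵀ nil))
                (cons (encFm ψ) (cons (encℕ (suc n)) (cons (encItems (items (suc n))) (encFound q))))) eq)
                    (⇒body n r)) R

      -- The truncated input agrees with the input wherever a causal operator looks, so truncation
      -- does not change the operator that `c` defines.
      strategy-passes : ∀ τ c (O : (ℕ → Bool) → ℕ → Bool) → (∀ U ρ → Sat ρ (alt P U) c ⟺ O U (ρ 0) ≡ true) →
          CausalFor τ O →
        (∀ U → Goal τ ψ P U (O U)) → ∀ n → Bounded n c → TrueIn P (test τ ψ (op τ (layers n c)))
      strategy-passes τ c O def causal goal n (fo , so) =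
        proj₂ (test-sat ψ) λ U → transport τ U (λ m → sym (same U m)) (goal U)
        where
        open Candidate P τ n c fo so using (test-sat) renaming (O to O′)
        same : ∀ U m → O′ U m ≡ O U m
        same U m = trans (true-⟺ (⟺-trans ⌊⌋-sat (def (truncate τ U m) (λ _ → m))))
          (causal m _ U λ i l → true-⟺ (⟺-trans ⌊⌋-sat (proj₁ , λ e → e , l)))
        transport : ∀ τ U {V V′} → (∀ m → V m ≡ V′ m) → Goal τ ψ P U V → Goal τ ψ P U V′
        transport true  U e g = proj₁ (Sat-ext ψ (λ _ → refl)
            λ { zero t → refl ; (suc zero) t → e t ; (suc (suc X)) t → refl }) g
        transport false U e g h = g (proj₂ (Sat-ext ψ (λ _ → refl) λ { zero t → e t ; (suc X) t → refl }) h)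

      -- A formula for a definable winning strategy is reached in some round and kept in all later
      -- ones. The loop advances the round before scanning, whence the successor.
      stops : Σ ℕ λ d → Stops (suc d + 0)
      stops with definable-strategy ψ (proj₁ ψ3) (proj₂ ψ3) P
      ... | τ , c , O , def , causal , goal with reach c
      ... | x , y , n , m = n , subst Stops (cong suc (sym (+-identityʳ n)))
          (just? (foldl-reach (scan (suc n)) (λ _ → ⊤) IsJust (λ _ _ _ → tt) (λ { (just f) _ j → j }) m′
              here-just nothing tt))
        where
        IsJust : Maybe Found → Set
        IsJust r = Σ Found λ f → r ≡ just f
        just? : IsJust (scanned (suc n)) → Stops (suc n)
        just? j = j
        m′ : item x y c ∈ items (suc n)
        m′ = items-≤ (n≤1+n n) m
        bd : Bounded (suc n) c
        bd = valid-bounded (suc n) (item x y c) (All.lookup (valid-items (suc n)) m′)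
        here-just : ∀ r → ⊤ → IsJust (scan (suc n) r (item x y c))
        here-just (just f) _ = f , refl
        here-just nothing  _ = go (em _)
          where
          attempted : ∀ fo so τ → TrueIn P (test τ ψ (op τ (layers (suc n) c))) → ∀ d d′ →
              IsJust (attempt (suc n) c fo so d d′)
          attempted fo so τ     p (inj₁ x) _ = _ , refl
          attempted fo so τ     p (inj₂ x) (inj₁ y) = _ , refl
          attempted fo so true  p (inj₂ x) (inj₂ y) = ⊥-elim (x p)
          attempted fo so false p (inj₂ x) (inj₂ y) = ⊥-elim (y p)
          go : ∀ d → IsJust (tryItem (suc n) c d)
          go (inj₁ (fo , so)) = attempted fo so τ (strategy-passes τ c O def causal goal (suc n) (fo , so))
              (em _) (em _)
          go (inj₂ nb) = ⊥-elim (nb bd)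

      search : Σ Found λ f → searchP ⊢ encFm ψ ⇒ encFound (just f)
      search = let (d , s) = stops ; (f , m , R) = ⇒search d 0 nothing s in f , ⇒seq ⇒expr (⇒seq R ⇒expr)

-- The equivalences

open While
open import Data.List using (List; []; _∷_; map; foldl; reverse; upTo)
open import Data.List.Properties using (reverse-involutive; map-∘)

module Proof (em : ExcludedMiddle) (P : ℕ → Bool) where
  open Classical em
  open Definability em
  open Sentences em
  open SearchProgram em

  -- `q` is known only from `initStore`, but a procedure leaves every variable except 0 empty, so
  -- the store it hands over looks the same to `q`.
  run-then : ∀ {p q i m o} → p ⊢ i ⇒ m → Run q m o → Run (seq (code p) q) i o
  run-then {q = q} {m = m} R (s , x , e) with exec-code R (initStore _) refl (λ _ _ → refl)
  ... | s₁ , x₁ , z , n with exec-agree {t = s₁} (suc (boundC q)) x (n≤1+n _) agree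
    where
    agree : ∀ y → y < suc (boundC q) → initStore m y ≡ s₁ y
    agree zero    _ = sym z
    agree (suc y) _ = sym (n y)
  ... | s₂ , x₂ , a , _ = s₂ , exec-seq x₁ x₂ , trans (sym (a 0 (s≤s z≤n))) e

  -- The new bound variable takes the index that P has in φ, so that φ need not be renamed.
  substituted : Fm → Fm
  substituted φ = ∃₂ (same′ 0 3 ∧′ φ)

  substituted-Fm3 : ∀ φ → Sentence φ → Fm3 (substituted φ)
  substituted-Fm3 φ (fo , so) = (same-fo 0 3 , fo) , (same-so (s≤s z≤n) ≤-refl , SOBelow-mono φ (s≤s z≤n) so)

  substituted-sat : ∀ φ → Sentence φ → ∀ X Y → Holds3 (substituted φ) X Y P ⟺ TrueIn P φ
  substituted-sat φ (fo , so) X Y =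
    (λ { (Z , e , s) → proj₁ (agree Z (proj₁ (same-sat 0 3 ρ₀
        (extend Z (extend X (extend Y (extend P σ₀))))) e)) s }) ,
    λ s → P , proj₂ (same-sat 0 3 ρ₀ (extend P (extend X (extend Y (extend P σ₀))))) (λ _ → refl) ,
        proj₂ (agree P (λ _ → refl)) s
    where
    agree : ∀ Z → (∀ t → Z t ≡ P t) → Sat ρ₀ (extend Z (extend X (extend Y (extend P σ₀)))) φ ⟺ TrueIn P φ
    agree Z e = Sat-agree φ ρ₀ ρ₀ _ _ fo so (λ _ _ → refl) (λ { zero l t → e t ; (suc X) (s≤s ()) t })

  wrapP : Prog → Proc
  wrapP a = expr (con (encℕ 5) ∙ con (encℕ 3) ∙ con (encFm (same′ 0 3)) ∙ ●) ⨾ call a ⨾ expr (hd₀ ●)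

  decide-by : (a : Prog) → (∀ φ → Sentence φ → Σ Bool λ b → Σ Tree λ t →
    Run a (encFm (substituted φ)) (cons (encBool b) t) × (b ≡ true ⟺ TrueIn P φ)) → MonadicTheoryDecidable P
  decide-by a h = code (wrapP a) , λ φ s →
    let (b , t , r , f , g) = h φ s in b , run-code (wrapP a) (⇒seq ⇒expr (⇒seq (⇒call r) ⇒expr)) , mk⇔ f g

  yes? : ∀ b → ¬ (b ≡ false) → b ≡ true
  yes? true  n = refl
  yes? false n = ⊥-elim (n refl)

  const-false : ∀ {A : Set} (enc : A → Tree) → Σ Prog λ q → RecC enc q (λ _ _ → false)
  const-false enc = code (expr (con nil)) , (λ _ _ _ _ _ _ → refl) , λ _ _ → run-code (expr (con nil)) ⇒expr

  1⇒4 : Problem1Computable P → MonadicTheoryDecidable P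
  1⇒4 (a , h) = decide-by a λ φ s → let (b , t , r , e , _) = h (substituted φ) (substituted-Fm3 φ s) in
    b , t , r ,
    (λ bt → let (F , _ , w) = Equivalence.to e bt in
      proj₁ (substituted-sat φ s (λ _ → false) (F (zipω (λ _ → false) P))) (w (λ _ → false))) ,
    λ tr → Equivalence.from e ((λ _ _ → false) , (λ _ _ _ _ _ _ → refl) , λ X →
        proj₂ (substituted-sat φ s X _) tr)

  2⇒4 : Problem2Computable P → MonadicTheoryDecidable P
  2⇒4 (a , h) = decide-by a λ φ s → let (b , t , r , e , _) = h (substituted φ) (substituted-Fm3 φ s) in
    b , t , r ,
    (λ bt → let (_ , F , _ , w) = Equivalence.to e bt in
      proj₁ (substituted-sat φ s (λ _ → false) (F (zipω (λ _ → false) P))) (w (λ _ → false))) ,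
    λ tr → Equivalence.from e (proj₁ (const-false encPair) , _ , proj₂ (const-false encPair) , λ X →
        proj₂ (substituted-sat φ s X _) tr)

  3⇒4 : Problem3Computable P → MonadicTheoryDecidable P
  3⇒4 (a , h) = decide-by a λ φ s → let (b , t , r , e , _) = h (substituted φ) (substituted-Fm3 φ s) in
    b , t , r ,
    (λ bt → let (_ , F , _ , w) = Equivalence.to e bt in
      proj₁ (substituted-sat φ s (λ _ → false) (F (λ _ → false))) (w (λ _ → false))) ,
    λ tr → Equivalence.from e (proj₁ (const-false encBool) , _ , proj₂ (const-false encBool) , λ X →
        proj₂ (substituted-sat φ s X _) tr)

  5⇒4 : EffectiveDeterminacy P → MonadicTheoryDecidable P
  5⇒4 (_ , a , h) = decide-by a λ φ s → let (b , q , r , f , g) = h (substituted φ) (substituted-Fm3 φ s) in b , ⌜ q ⌝ , r ,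
    (λ bt → let (F , _ , w) = f bt in
      proj₁ (substituted-sat φ s (λ _ → false) (F (λ _ → false))) (w (λ _ → false))) ,
    λ tr → yes? b λ bf → let (G , _ , w) = g bf in
      w (λ _ → false) (proj₂ (substituted-sat φ s (G (λ _ → false)) (λ _ → false)) tr)

  -- Playing a causal against a strongly causal operator determines both sequences bit by bit.
  module Against (F G : (ℕ → Bool) → ℕ → Bool) (cF : Causal F) (cG : StronglyCausal G) where
    approx : ℕ → ℕ → Bool
    approx zero    = λ _ → false
    approx (suc n) = G (F (approx n))

    -- The composite gains one position at each application, so its iterates agree on ever longer
    -- prefixes and converge to a fixed point.
    GF-cong : ∀ X X′ n → (∀ i → i < n → X i ≡ X′ i) → ∀ i → i ≤ n → G (F X) i ≡ G (F X′) i
    GF-cong X X′ n h = cG n (F X) (F X′) λ i l → cF i X X′ (λ j m → h j (≤-trans (s≤s m) l)) i ≤-refl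

    approx-suc : ∀ n i → i < n → approx n i ≡ approx (suc n) i
    approx-suc (suc n) i (s≤s l) = GF-cong (approx n) (approx (suc n)) n (approx-suc n) i l

    X* : ℕ → Bool
    X* i = approx (suc i) i

    approx-X* : ∀ n i → i < n → approx n i ≡ X* i
    approx-X* (suc n) i l with m<1+n⇒m<n∨m≡n l
    ... | inj₁ l′   = trans (sym (approx-suc n i l′)) (approx-X* n i l′)
    ... | inj₂ refl = refl

    fixed : ∀ i → X* i ≡ G (F X*) i
    fixed i = GF-cong (approx i) X* i (approx-X* i) i ≤-refl

    impossible : ∀ ψ → WinX P ψ F → WinY P ψ G → ⊥
    impossible ψ w w′ = w′ (F X*) (proj₁ (Sat-ext ψ (λ _ → refl) λ { zero t → fixed t ; (suc X) t → refl })
        (w X*))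

  -- Every fold reverses the list, hence the second one.
  firstsP : Proc
  firstsP = expr (● ∙ con nil) ⨾ foldP (expr (hd₀ (hd₀ ●) ∙ tl₀ ●)) ⨾ expr (● ∙ con nil) ⨾ foldP (expr ●)

  ⇒firsts : ∀ (xs : List (Bool × Bool)) → firstsP ⊢ encList encPair xs ⇒ encList encBool (map proj₁ xs)
  ⇒firsts xs = ⇒seq ⇒expr (⇒seq (⇒fold encPair (encList encBool) (λ acc x → proj₁ x ∷ acc) (λ x acc → ⇒expr)
      xs [])
    (⇒seq ⇒expr (cast (cong (encList encBool) (twice xs))
      (⇒fold encBool (encList encBool) (λ acc b → b ∷ acc) (λ b acc → ⇒expr)
          (foldl (λ acc x → proj₁ x ∷ acc) [] xs) []))))
    where
    go : ∀ (xs : List (Bool × Bool)) acc → foldl (λ acc x → proj₁ x ∷ acc) acc xs ≡ foldl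
        (λ acc b → b ∷ acc) acc (map proj₁ xs)
    go []       acc = refl
    go (x ∷ xs) acc = go xs (proj₁ x ∷ acc)
    twice : ∀ xs → reverse (foldl (λ acc x → proj₁ x ∷ acc) [] xs) ≡ map proj₁ xs
    twice xs = trans (cong reverse (go xs [])) (reverse-involutive (map proj₁ xs))

  ignoreP : (ℕ → Bool × Bool) → ℕ → Bool
  ignoreP ω i = proj₁ (ω i)

  ignoring : ∀ q F → RecC encBool q F → RecC encPair (seq (code firstsP) q) (λ ω → F (ignoreP ω))
  ignoring q F (c , r) = (λ t ω ω′ h → c t _ _ (λ i l → cong proj₁ (h i l))) ,
    λ ω n → run-then (⇒firsts (prefix ω n)) (subst (λ bs → Run q (encList encBool bs) (encBool (F (ignoreP ω) n)))
      (map-∘ (upTo (suc n))) (r (ignoreP ω) n))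

  -- With `P` fixed, an operator of two arguments is a causal operator of `X` alone; so knowing `P`
  -- does not help against `G`.
  no-XP : ∀ ψ → (Σ ((ℕ → Bool) → ℕ → Bool) λ G → StronglyCausal G × WinY P ψ G) →
    ¬ (Σ ((ℕ → Bool × Bool) → ℕ → Bool) λ F → Causal F × WinXP P ψ F)
  no-XP ψ (G , cG , wG) (F , cF , wF) = Against.impossible (λ X → F (zipω X P)) G
    (λ t X X′ h → cF t _ _ (λ i l → cong (_, P i) (h i l))) cG ψ wF wG

  5⇒3 : EffectiveDeterminacy P → Problem3Computable P
  5⇒3 (_ , a , h) = a , λ ψ ψ3 → let (b , q , r , f , g) = h ψ ψ3 in b , ⌜ q ⌝ , r , mk⇔
    (λ bt → q , f bt) (λ { (_ , F , (c , _) , w) → yes? b λ bf →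
      let (G , (cG , _) , wG) = g bf in Against.impossible F G c cG ψ w wG }) ,
    λ bt → q , refl , f bt

  module Ignoring (E : EffectiveDeterminacy P) where
    ignoringP : Proc
    ignoringP = call (proj₁ (proj₂ E)) ⨾ expr (hd₀ ● ∙ con (encℕ 1) ∙ con ⌜ code firstsP ⌝ ∙ tl₀ ●)

    a′ : Prog
    a′ = code ignoringP

    -- If any causal operator wins, recursive or not, the opponent has no strongly causal answer, so
    -- the bit is `true`, and then a recursive operator that ignores `P` wins. One program thus
    -- serves both problems in which the operator may read `P`.
    outcome : ∀ ψ → Fm3 ψ → Σ Bool λ b → Σ Prog λ q → Run a′ (encFm ψ) (cons (encBool b) ⌜ q ⌝) ×
      (b ≡ true → Σ ((ℕ → Bool × Bool) → ℕ → Bool) λ F → RecC encPair q F × WinXP P ψ F) ×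
      ((Σ ((ℕ → Bool × Bool) → ℕ → Bool) λ F → Causal F × WinXP P ψ F) → b ≡ true)
    outcome ψ ψ3 = let (b , q , r , f , g) = proj₂ (proj₂ E) ψ ψ3 in
      b , seq (code firstsP) q , run-code ignoringP (⇒seq (⇒call r) ⇒expr) ,
      (λ bt → let (F , rec , w) = f bt in (λ ω → F (ignoreP ω)) , ignoring q F rec , λ X → w X) ,
      λ x → yes? b λ bf → let (G , (cG , _) , wG) = g bf in no-XP ψ (G , cG , wG) x

  5⇒2 : EffectiveDeterminacy P → Problem2Computable P
  5⇒2 E = a′ , λ ψ ψ3 → let (b , q , r , f , g) = outcome ψ ψ3 in b , ⌜ q ⌝ , r ,
    mk⇔ (λ bt → q , f bt) (λ { (_ , F , (c , _) , w) → g (F , c , w) }) , λ bt → q , refl , f bt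
    where open Ignoring E

  5⇒1 : EffectiveDeterminacy P → Problem1Computable P
  5⇒1 E = a′ , λ ψ ψ3 → let (b , q , r , f , g) = outcome ψ ψ3 in b , ⌜ q ⌝ , r ,
    mk⇔ (λ bt → let (F , (c , _) , w) = f bt in F , c , w) g , λ { (_ , F , (c , _) , w) → q , refl , f (g (F , c , w)) }
    where open Ignoring E

  4⇒5 : MonadicTheoryDecidable P → EffectiveDeterminacy P
  4⇒5 (a , h) = (λ ψ ψ3 → side (synthesis ψ ψ3)) , code searchP , synthesis
    where
    oracle : ∀ φ → Sentence φ → Run a (encFm φ) (encBool ⌊ TrueIn P φ ⌋)
    oracle φ s = let (b , r , e) = h φ s in subst (λ b → Run a (encFm φ) (encBool b))
      (true-⟺ (⟺-trans (Equivalence.to e , Equivalence.from e) (⟺-sym ⌊⌋-sat))) r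
    open Oracle P a oracle

    Outcome : Fm → Bool → Prog → Set
    Outcome ψ b q =
      (b ≡ true → Σ ((ℕ → Bool) → (ℕ → Bool)) λ F → RecC encBool q F × WinX P ψ F) ×
      (b ≡ false → Σ ((ℕ → Bool) → (ℕ → Bool)) λ G → RecSC q G × WinY P ψ G)

    outcome : ∀ ψ ψ3 (f : Scan.Found ψ ψ3) → let (τ , n , c , _) = f in Outcome ψ τ (code (strategyP τ (op τ (layers n c))))
    outcome ψ ψ3 (τ , n , c , fo , so , passed) = split τ computes O-cong (proj₁ (test-sat ψ) passed)
      where
      open Candidate P τ n c fo so
      computes : Computes encBool (code (strategyP τ o)) O
      computes ω m = run-code (strategyP τ o) (⇒seq ⇒expr
          (cast (cong encBool (true-⟺ (⟺-trans ⌊⌋-sat (query-sat ω m)))) (⇒answer τ o (prefix ω m) o-fo o-so)))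
      split : ∀ τ {q O} → Computes encBool q O →
          (∀ U U′ n → (∀ i → Strategies.Earlier em τ i n → U i ≡ U′ i) → O U n ≡ O U′ n) →
        (∀ U → Strategies.Goal em τ ψ P U (O U)) → Outcome ψ τ q
      split true  r cg g = (λ _ → _ , ((λ t U U′ e i l → cg U U′ i λ j m → e j (≤-trans m l)) , r) , g) , λ ()
      split false r cg g = (λ ()) , λ _ → _ , ((λ t U U′ e i l → cg U U′ i λ j m → e j (≤-trans m l)) , r) , g

    synthesis : ∀ ψ → Fm3 ψ → Σ Bool λ b → Σ Prog λ q → Run (code searchP) (encFm ψ) (cons (encBool b) ⌜ q ⌝) ×
      (b ≡ true → Σ ((ℕ → Bool) → (ℕ → Bool)) λ F → RecC encBool q F × WinX P ψ F) ×
      (b ≡ false → Σ ((ℕ → Bool) → (ℕ → Bool)) λ G → RecSC q G × WinY P ψ G)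
    synthesis ψ ψ3 = let (f@(τ , n , c , _) , R) = Scan.search ψ ψ3 in
      τ , code (strategyP τ (op τ (layers n c))) , run-code searchP R , outcome ψ ψ3 f

    side : ∀ {ψ} → (Σ Bool λ b → Σ Prog λ q →
        Run (code searchP) (encFm ψ) (cons (encBool b) ⌜ q ⌝) × Outcome ψ b q) →
      (Σ Prog λ q → Σ ((ℕ → Bool) → (ℕ → Bool)) λ F → RecC encBool q F × WinX P ψ F) ⊎
      (Σ Prog λ q → Σ ((ℕ → Bool) → (ℕ → Bool)) λ G → RecSC q G × WinY P ψ G)
    side (true  , q , _ , f , _) = inj₁ (q , f refl)
    side (false , q , _ , _ , g) = inj₂ (q , g refl)

theorem1p2 : ExcludedMiddle → (P : ℕ → Bool) →
    (Problem1Computable P ⇔ Problem2Computable P) ×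
    (Problem2Computable P ⇔ Problem3Computable P) ×
    (Problem3Computable P ⇔ MonadicTheoryDecidable P) ×
    (MonadicTheoryDecidable P ⇔ EffectiveDeterminacy P)
theorem1p2 em P =
  mk⇔ (λ x → 5⇒2 (4⇒5 (1⇒4 x))) (λ x → 5⇒1 (4⇒5 (2⇒4 x))) ,
  mk⇔ (λ x → 5⇒3 (4⇒5 (2⇒4 x))) (λ x → 5⇒2 (4⇒5 (3⇒4 x))) ,
  mk⇔ 3⇒4 (λ x → 5⇒3 (4⇒5 x)) ,
  mk⇔ 4⇒5 5⇒4
  where open Proof em P
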